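{- For odd $n\ge 3$ and every integer $r\ge 1$, there is no $r$-rainbow cycle in $\mathcal{G}_n$. For even $n\ge 2$ and every integer $r>\frac{2}{n^2}N_1(n,n/2)$, there is no $r$-rainbow cycle in $\mathcal{G}_n$.
   Context: Fix an integer $n\ge 2$ and place $2n$ points equidistantly on the unit circle. $\mathcal{M}_n$ is the set of all non-crossing straight-line perfect matchings on these $2n$ points. For $M\in\mathcal{M}_n$, two edges $e,f\in M$ span an empty quadrilateral if the convex hull of $e$ and $f$ contains no other edge of $M$; replacing $e,f$ by the other two edges of this quadrilateral yields another matching of $\mathcal{M}_n$, called a flip. $\mathcal{G}_n$ is the graph with vertex set $\mathcal{M}_n$ and an edge between any two matchings differing by a flip. A possible matching edge is a segment between two of the $2n$ points that occurs in some matching of $\mathcal{M}_n$ (there are $n^2$ of them). For an integer $r\ge1$, an $r$-rainbow cycle in $\mathcal{G}_n$ is a cycle such that every possible matching edge appears (is added to the matching) exactly $r$ times in the flips along the cycle. The generalized Narayana numbers are $N_r(n,k)=\frac{r+1}{n+1}\binom{n+1}{k}\binom{n-r-1}{k-1}$. -}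

module Defs where

open import Data.Nat using (ℕ; zero; suc; _+_; _*_; _∸_; _^_; _≤_; _<_; _<ᵇ_; _/_)
open import Data.Nat.Combinatorics using (_C_)
open import Data.Fin using (Fin; toℕ; _≟_)
open import Data.Bool using (if_then_else_)
open import Data.List using (List; length; filter; upTo)
open import Data.Product using (Σ; ∃; _×_; _,_)
open import Data.Sum using (_⊎_)
open import Relation.Nullary using (¬_; Dec)
open import Relation.Nullary.Decidable using (_×-dec_; ¬?)
open import Relation.Binary.PropositionalEquality using (_≡_; _≢_)

-- The 2n points on the unit circle, equidistant, are indexed by
-- Fin (2 * n) in their cyclic (counterclockwise) order.

Point : ℕ → Set
Point n = Fin (2 * n)

-- A non-crossing straight-line perfect matching on the 2n points,
-- encoded by its partner function (a fixed-point-free involution).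
-- Two chords {a,b}, {c,d} between points in convex position cross
-- iff their endpoints interleave: a < c < b < d.
record Matching (n : ℕ) : Set where
  field
    partner       : Point n → Point n
    involutive    : ∀ i → partner (partner i) ≡ i
    fixpoint-free : ∀ i → partner i ≢ i
    noncrossing   : ∀ a b c d → toℕ a < toℕ c → toℕ c < toℕ b → toℕ b < toℕ d →
                    partner a ≡ b → partner c ≢ d
open Matching public

SameMatching : ∀ {n} → Matching n → Matching n → Set
SameMatching M M' = ∀ i → partner M i ≡ partner M' i

HasEdge : ∀ {n} → Matching n → Point n → Point n → Set
HasEdge M x y = partner M x ≡ y

PossibleEdge : ∀ n → Point n → Point n → Set
PossibleEdge n x y = Σ (Matching n) λ M → HasEdge M x y

-- Flips.
-- For four points p1 < p2 < p3 < p4 (in cyclic order) the circle minus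
-- these points splits into four open arcs; arc number of a point x not
-- among the p's (arc 0 is the one from p4 back around to p1).
arc : ℕ → ℕ → ℕ → ℕ → ℕ → ℕ
arc p1 p2 p3 p4 x =
  if x <ᵇ p1 then 0 else
  if x <ᵇ p2 then 1 else
  if x <ᵇ p3 then 2 else
  if x <ᵇ p4 then 3 else 0

NotCorner : ∀ n → Point n → Point n → Point n → Point n → Point n → Set
NotCorner n p1 p2 p3 p4 x = x ≢ p1 × x ≢ p2 × x ≢ p3 × x ≢ p4

-- The convex hull of the quadrilateral p1p2p3p4 contains (meets) no other
-- edge of M: a chord with endpoints distinct from the corners meets the
-- convex quadrilateral iff its endpoints lie in different open arcs.
EmptyQuad : ∀ {n} → Matching n → Point n → Point n → Point n → Point n → Set
EmptyQuad {n} M p1 p2 p3 p4 =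
  ∀ x → NotCorner n p1 p2 p3 p4 x →
    arc (toℕ p1) (toℕ p2) (toℕ p3) (toℕ p4) (toℕ x)
      ≡ arc (toℕ p1) (toℕ p2) (toℕ p3) (toℕ p4) (toℕ (partner M x))

-- M' arises from M by a flip: two edges e, f of M spanning an empty
-- quadrilateral with corners p1 < p2 < p3 < p4 are replaced by the other
-- two sides of that quadrilateral; all other edges are unchanged.
-- (In a non-crossing matching, {e,f} is either {p1p2, p3p4} or {p1p4, p2p3};
-- the diagonals p1p3, p2p4 cross.)
Flip : ∀ {n} → Matching n → Matching n → Set
Flip {n} M M' =
  Σ (Point n) λ p1 → Σ (Point n) λ p2 → Σ (Point n) λ p3 → Σ (Point n) λ p4 →
    toℕ p1 < toℕ p2 × toℕ p2 < toℕ p3 × toℕ p3 < toℕ p4 ×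
    EmptyQuad M p1 p2 p3 p4 ×
    ((HasEdge M p1 p2 × HasEdge M p3 p4 × HasEdge M' p1 p4 × HasEdge M' p2 p3)
     ⊎ (HasEdge M p1 p4 × HasEdge M p2 p3 × HasEdge M' p1 p2 × HasEdge M' p3 p4)) ×
    (∀ x → NotCorner n p1 p2 p3 p4 x → partner M' x ≡ partner M x)

Added : ∀ {n} → Matching n → Matching n → Point n → Point n → Set
Added M M' x y = HasEdge M' x y × ¬ HasEdge M x y

added? : ∀ {n} (M M' : Matching n) (x y : Point n) → Dec (Added M M' x y)
added? M M' x y = (partner M' x ≟ y) ×-dec ¬? (partner M x ≟ y)

addedCount : ∀ {n} → (ℕ → Matching n) → ℕ → Point n → Point n → ℕ
addedCount W len x y =
  length (filter (λ i → added? (W i) (W (suc i)) x y) (upTo len))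

record RainbowCycle (n r : ℕ) : Set where
  field
    len      : ℕ
    len≥3    : 3 ≤ len
    W        : ℕ → Matching n
    closed   : SameMatching (W len) (W 0)
    distinct : ∀ i j → i < j → j < len → ¬ SameMatching (W i) (W j)
    steps    : ∀ i → i < len → Flip (W i) (W (suc i))
    rainbow  : ∀ x y → toℕ x < toℕ y → PossibleEdge n x y →
               addedCount W len x y ≡ r

-- Generalized Narayana numbers N_r(n,k) = (r+1)/(n+1) * C(n+1,k) * C(n-r-1,k-1):
-- we record the numerator; N_r(n,k) = narayanaNum r n k / (n + 1).
narayanaNum : ℕ → ℕ → ℕ → ℕ
narayanaNum r n k = (suc r) * ((suc n) C k) * ((n ∸ r ∸ 1) C (k ∸ 1))

-- r > (2 / n²) · N_1(n, k)   ⇔   2 · narayanaNum 1 n k < r · n² · (n+1)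
AboveBound : ℕ → ℕ → ℕ → Set
AboveBound r n k = 2 * narayanaNum 1 n k < r * (n ^ 2) * (suc n)

{-# OPTIONS --safe #-}
module Submission where

-- For points x < y at distance d = y − x put g(x,y) = min(d, 2n − d). The four
-- sides of a quadrilateral have total g at most 2n, with equality exactly when
-- the quadrilateral contains the centre of the circle. In an r-rainbow cycle
-- every pair at odd distance is added r times and removed r times, so the
-- cycle has r n²/2 flips, whose total g is 2 r Σ g = r n (n² + [n odd]). For
-- odd n this exceeds 2n per flip. For n = 2m it is exactly 2n per flip, so
-- every flip is centred.
--
-- Call an edge x < y long if y − x > n. Centred flips preserve
--   #{edges with x even} + #{long edges with x even} − #{long edges with x odd},
-- and the difference of the last two terms is 0 or 1, according to the parity
-- of the depth of the region of the centre in the tree dual to the matching.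
-- An involution of binary trees exchanges this parity with the property that
-- the first edge is long; swapping the two subtrees of the root then compares
-- long with short first edges, and a class of the invariant is expressed by
-- Narayana numbers, which are 2×2 determinants of binomial coefficients. A
-- class has C(n+2, k+1) C(n−2, k−1) / (n+1) elements for some k; this is
-- largest for k = m, where it equals N₁(n, m).

-- The vertices of the cycle are distinct and lie in one class, so r n²/2 ≤ N₁(n, m), which
-- contradicts the bound on r. The invariant survives because a centred flip trades two short edges,
-- whose left ends have the same parity, for a long edge of that parity and a short edge of the
-- other (or conversely). The obstacle is the depth of the centre: it is found by descending through
-- the whole tree, so a decomposition at the root does not show it. Whether the first edge is long
-- can be read off at the root, and as the two subtrees there have 2m - 1 edges together, exactly
-- one of them has at least m. This is why the exchange precedes the count and why swapping the
-- subtrees almost balances long against short first edges. The defect, from trees with an empty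
-- subtree, concerns trees with one edge fewer, which are again counted by determinants. Subtraction
-- is mostly avoided: determinants, counts and flip balances are equalities of sums, and the
-- invariant is shifted by one per edge.

open import Defs
open import Data.Bool using (Bool; true; false; not; if_then_else_; T)
import Data.Bool.Properties as Bool
open import Data.Bool.Properties using (not-involutive)
open import Data.Empty using (⊥; ⊥-elim)
import Data.Fin as Fin
open import Data.Fin using (Fin; toℕ; fromℕ<)
open import Data.Fin.Properties using (toℕ-injective; toℕ<n; toℕ-fromℕ<; fromℕ<-toℕ; injective⇒≤)
open import Data.List using (List; []; _∷_; _++_; map; length; filter; lookup; upTo)
open import Data.List.Properties using (length-map; length-++; upTo-∷ʳ; filter-++)
open import Data.List.Membership.Propositional using (_∈_)
open import Data.List.Membership.Propositional.Properties
open import Data.List.Relation.Unary.All as All using (All)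
import Data.List.Relation.Unary.All.Properties as All
open import Data.List.Relation.Unary.AllPairs using ([]; _∷_)
open import Data.List.Relation.Unary.Any using (here; index)
open import Data.List.Relation.Unary.Any.Properties using (lookup-index)
open import Data.List.Relation.Unary.Unique.Propositional using (Unique)
import Data.List.Relation.Unary.Unique.Propositional.Properties as Unique
open import Data.Nat
open import Data.Nat.Combinatorics using (_C_; nCk+nC[k+1]≡[n+1]C[k+1]; nCk≡nC[n∸k]; k>n⇒nCk≡0)
open import Data.Nat.DivMod using (m≡m%n+[m/n]*n)
open import Data.Nat.Properties
open import Data.Nat.Tactic.RingSolver using (solve-∀)
open import Data.Product using (∃; _×_; _,_; proj₁; proj₂)
open import Data.Sum using (_⊎_; inj₁; inj₂)
open import Data.Sum.Properties using (inj₁-injective; inj₂-injective)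
open import Data.Unit using (⊤; tt)
open import Data.Vec using (Vec; []; _∷_; head)
open import Relation.Binary.Definitions using (tri<; tri≈; tri>)
open import Relation.Binary.PropositionalEquality hiding ([_])
open import Relation.Nullary using (¬_; yes; no; does; contradiction)
open import Relation.Unary using (Decidable)

-- Binary trees and the exchange involution

-- A tree encodes a non-crossing matching of consecutive points: in node l r the
-- first point is matched across the points of l, and r describes the points
-- after its partner. The functions evens and odds count the edges by the
-- parity of the offset of their left endpoint.
data Tree : Set where
  leaf : Tree
  node : Tree → Tree → Tree

size : Tree → ℕ
size leaf       = 0
size (node l r) = suc (size l + size r)

evens odds : Tree → ℕ
evens leaf       = 0
evens (node l r) = suc (odds l + evens r)
odds leaf        = 0
odds (node l r)  = evens l + odds r

evens+odds≡size : ∀ t → evens t + odds t ≡ size t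
evens+odds≡size leaf       = refl
evens+odds≡size (node l r) = cong suc (trans (shuffle (odds l) (evens r) (evens l) (odds r))
  (cong₂ _+_ (evens+odds≡size l) (evens+odds≡size r)))
  where
  shuffle : ∀ a b c d → a + b + (c + d) ≡ c + a + (b + d)
  shuffle = solve-∀

swap : Tree → Tree
swap leaf       = leaf
swap (node l r) = node r l

swap-involutive : ∀ t → swap (swap t) ≡ t
swap-involutive leaf       = refl
swap-involutive (node l r) = refl

size-swap : ∀ t → size (swap t) ≡ size t
size-swap leaf       = refl
size-swap (node l r) = cong suc (+-comm (size r) (size l))

-- The left subtree starts one point after the root edge, the right one an even number of points
-- after it. Hence `swap` changes the parity of every edge except the first, which stays even.
0<size⇒evens-swap : ∀ t → 0 < size t → evens (swap t) ≡ suc (odds t)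
0<size⇒evens-swap (node l r) _ = cong suc (+-comm (odds r) (evens l))

0<size⇒odds-swap : ∀ t → 0 < size t → suc (odds (swap t)) ≡ evens t
0<size⇒odds-swap (node l r) _ = cong suc (+-comm (evens r) (odds l))

-- The trees encode matchings with 2m edges: an edge is long when at least m
-- edges lie below it, that is, when it separates the centre of the circle
-- from the outer arc.
module Centre (m : ℕ) (0<m : 0 < m) where

  long : Tree → Bool
  long t = m ≤ᵇ size t

  long⁺ : ∀ t → m ≤ size t → long t ≡ true
  long⁺ t p with m ≤ᵇ size t in eq
  ... | true  = refl
  ... | false = ⊥-elim (subst T eq (≤⇒≤ᵇ p))

  long⁻ : ∀ t → long t ≡ true → m ≤ size t
  long⁻ t eq = ≤ᵇ⇒≤ m (size t) (subst T (sym eq) _)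

  ¬long⁺ : ∀ t → size t < m → long t ≡ false
  ¬long⁺ t p with m ≤ᵇ size t in eq
  ... | false = refl
  ... | true  = contradiction (≤-trans p (long⁻ t eq)) (<-irrefl refl)

  ¬long⁻ : ∀ t → long t ≡ false → size t < m
  ¬long⁻ t eq = ≰⇒> λ p → contradiction (trans (sym (long⁺ t p)) eq) λ ()

  firstLong : Tree → Bool
  firstLong leaf       = false
  firstLong (node l r) = long l

  -- Whether the region of the centre lies at odd depth: the long edges are
  -- those on the path from the outer region to the region of the centre.
  centreOdd : Tree → Bool
  centreOdd leaf       = false
  centreOdd (node l r) = if long l then not (centreOdd l) else centreOdd r

  centreOdd⇒m<size : ∀ t → centreOdd t ≡ true → m < size t
  centreOdd⇒m<size (node l r) eq with long l in ll
  ... | true  = s≤s (≤-trans (long⁻ l ll) (m≤m+n (size l) (size r)))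
  ... | false = <-trans (centreOdd⇒m<size r eq) (s≤s (m≤n+m (size r) (size l)))

  size≤m⇒¬centreOdd : ∀ t → size t ≤ m → centreOdd t ≡ false
  size≤m⇒¬centreOdd t p with centreOdd t in eq
  ... | false = refl
  ... | true  = contradiction (≤-trans (centreOdd⇒m<size t eq) p) (<-irrefl refl)

  -- The first argument is fuel; it suffices that it bounds the size of the tree.
  exchange : ℕ → Tree → Tree
  exchangeLeft exchangeRight : ℕ → Tree → Tree → Tree

  exchange zero    t          = t
  exchange (suc k) leaf       = leaf
  exchange (suc k) (node l r) =
    if centreOdd l then exchangeLeft k (exchange k l) r
    else if long l then node l r
    else if centreOdd r then exchangeRight k l (exchange k r)
    else node l r

  -- When the centre is odd in `l`, the whole tree has a long first edge and an even centre, and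
  -- both have to change. The exchanged `l` is `node a b` with `a` long; `b` becomes the short left
  -- subtree and `a` moves to the right of it, where its offset has the other parity, which `swap`
  -- compensates. `exchangeRight` undoes this. Within the size bound the `leaf` clauses are never
  -- reached.
  exchangeLeft k leaf       r = node leaf r
  exchangeLeft k (node a b) r = node b (exchange k (node (swap a) r))

  exchangeRight k l leaf       = node l leaf
  exchangeRight k l (node a b) = node (exchange k (node (swap a) l)) b

  record Exchanged (k : ℕ) (t : Tree) : Set where
    field
      invol  : exchange k (exchange k t) ≡ t
      first  : firstLong (exchange k t) ≡ centreOdd t
      centre : centreOdd (exchange k t) ≡ firstLong t
      even   : evens (exchange k t) ≡ evens t
      odd    : odds (exchange k t) ≡ odds t

    sz : size (exchange k t) ≡ size t
    sz = trans (sym (evens+odds≡size (exchange k t)))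
           (trans (cong₂ _+_ even odd) (evens+odds≡size t))

  open Exchanged

  private
    exchanged : ∀ {k t} t' → exchange k t ≡ t' → exchange k t' ≡ t →
                firstLong t' ≡ centreOdd t → centreOdd t' ≡ firstLong t →
                evens t' ≡ evens t → odds t' ≡ odds t → Exchanged k t
    exchanged t' refl i f c e o =
      record { invol = i ; first = f ; centre = c ; even = e ; odd = o }

    exchange-left : ∀ k l r {a b} → centreOdd l ≡ true → exchange k l ≡ node a b →
                    exchange (suc k) (node l r) ≡ node b (exchange k (node (swap a) r))
    exchange-left k l r p q rewrite p | q = refl

    exchange-right : ∀ k l r {a b} → centreOdd l ≡ false → long l ≡ false → centreOdd r ≡ true →
                     exchange k r ≡ node a b →
                     exchange (suc k) (node l r) ≡ node (exchange k (node (swap a) l)) b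
    exchange-right k l r p q s e rewrite p | q | s | e = refl

    exchange-long : ∀ k l r → centreOdd l ≡ false → long l ≡ true →
                    exchange (suc k) (node l r) ≡ node l r
    exchange-long k l r p q rewrite p | q = refl

    exchange-short : ∀ k l r → centreOdd l ≡ false → long l ≡ false → centreOdd r ≡ false →
                     exchange (suc k) (node l r) ≡ node l r
    exchange-short k l r p q s rewrite p | q | s = refl

    centreOdd-long : ∀ l r → long l ≡ true → centreOdd (node l r) ≡ not (centreOdd l)
    centreOdd-long l r p rewrite p = refl

    centreOdd-short : ∀ l r → long l ≡ false → centreOdd (node l r) ≡ centreOdd r
    centreOdd-short l r p rewrite p = refl

    firstLong⇒node : ∀ t → firstLong t ≡ true → ∃ λ a → ∃ λ b → t ≡ node a b
    firstLong⇒node (node a b) _ = a , b , refl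

    -- Joining `a` with `r` under a new root is no larger than `l` and `r` together, so the second
    -- recursive call stays within the fuel.
    bound : ∀ {a b l r k} → suc (a + b) ≡ l → l + r ≤ k → suc (a + r) ≤ k
    bound {a} {b} {r = r} refl p = ≤-trans (s≤s (+-monoˡ-≤ r (m≤m+n a b))) p

    -- Below 2m edges there is room for one long subtree only. This is where the size bound of the
    -- exchange enters.
    rest<m : ∀ {a b r} → m ≤ a → suc (a + b) + r < 2 * m → b < m
    rest<m {a} {b} {r} m≤a p = +-cancelˡ-< m b m (begin-strict
      m + b           ≤⟨ +-monoˡ-≤ b m≤a ⟩
      a + b           ≤⟨ n≤1+n _ ⟩
      suc (a + b)     ≤⟨ m≤m+n _ r ⟩
      suc (a + b) + r <⟨ p ⟩
      2 * m           ≡⟨ cong (m +_) (+-identityʳ m) ⟩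
      m + m           ∎)
      where open ≤-Reasoning

  module _ (k : ℕ) (ih : ∀ t → size t ≤ k → size t ≤ 2 * m → Exchanged k t)
           (l r : Tree) (s≤k : size l + size r ≤ k) (s<2m : size l + size r < 2 * m) where

    private
      l≤k  = ≤-trans (m≤m+n (size l) (size r)) s≤k
      l≤2m = ≤-trans (m≤m+n (size l) (size r)) (<⇒≤ s<2m)
      r≤k  = ≤-trans (m≤n+m (size r) (size l)) s≤k
      r≤2m = ≤-trans (m≤n+m (size r) (size l)) (<⇒≤ s<2m)

    exchanged-left : centreOdd l ≡ true → Exchanged (suc k) (node l r)
    exchanged-left cl with ih l l≤k l≤2m
    ... | El with firstLong⇒node (exchange k l) (trans (first El) cl)
    ... | a , b , φl =
      exchanged (node b w) (exchange-left k l r cl φl)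
        (trans (exchange-right k b w cb lb cw (invol Eu))
          (cong (λ x → node x r) (trans (cong (λ x → exchange k (node x b)) (swap-involutive a))
            (trans (cong (exchange k) (sym φl)) (invol El)))))
        (trans lb (sym (trans (centreOdd-long l r ll) (cong not cl))))
        (trans (centreOdd-short b w lb) (trans cw (sym ll)))
        (cong suc (trans (cong (odds b +_) (trans (even Eu) (cong (_+ evens r) (0<size⇒odds-swap a 0<a))))
          (trans (shuffle (odds b) (evens a) (evens r)) (cong (_+ evens r) ol))))
        (trans (cong (evens b +_) (trans (odd Eu) (cong (_+ odds r) (0<size⇒evens-swap a 0<a))))
          (trans (shuffle (evens b) (suc (odds a)) (odds r)) (cong (_+ odds r) el)))
      where
      ll = long⁺ l (<⇒≤ (centreOdd⇒m<size l cl))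
      la : long a ≡ true
      la = trans (cong firstLong (sym φl)) (trans (first El) cl)
      m≤a = long⁻ a la
      0<a = ≤-trans 0<m m≤a
      sl : suc (size a + size b) ≡ size l
      sl = trans (cong size (sym φl)) (sz El)
      el : suc (odds a + evens b) ≡ evens l
      el = trans (cong evens (sym φl)) (even El)
      ol : evens a + odds b ≡ odds l
      ol = trans (cong odds (sym φl)) (odd El)
      b<m = rest<m {size a} {size b} {size r} m≤a (subst (λ x → x + size r < 2 * m) (sym sl) s<2m)
      lb = ¬long⁺ b b<m
      cb = size≤m⇒¬centreOdd b (<⇒≤ b<m)
      u = node (swap a) r
      su = cong (λ x → suc (x + size r)) (size-swap a)
      Eu : Exchanged k u
      Eu = ih u (≤-trans (≤-reflexive su) (bound sl s≤k))
                (≤-trans (≤-reflexive su) (bound sl (<⇒≤ s<2m)))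
      w = exchange k u
      cw : centreOdd w ≡ true
      cw = trans (centre Eu) (long⁺ (swap a) (subst (m ≤_) (sym (size-swap a)) m≤a))
      shuffle : ∀ x y z → x + (y + z) ≡ y + x + z
      shuffle = solve-∀

    exchanged-right : centreOdd l ≡ false → long l ≡ false → centreOdd r ≡ true →
                      Exchanged (suc k) (node l r)
    exchanged-right cl ll cr with ih r r≤k r≤2m
    ... | Er with firstLong⇒node (exchange k r) (trans (first Er) cr)
    ... | a , b , φr =
      exchanged (node w b) (exchange-right k l r cl ll cr φr)
        (trans (exchange-left k w b cw (invol Eu))
          (cong (node l) (trans (cong (λ x → exchange k (node x b)) (swap-involutive a))
            (trans (cong (exchange k) (sym φr)) (invol Er)))))
        (trans lw (sym (trans (centreOdd-short l r ll) cr)))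
        (trans (centreOdd-long w b lw) (trans (cong not cw) (sym ll)))
        (cong suc (trans (cong (_+ evens b) (trans (odd Eu) (cong (_+ odds l) (0<size⇒evens-swap a 0<a))))
          (trans (shuffle (suc (odds a)) (odds l) (evens b)) (cong (odds l +_) er))))
        (trans (cong (_+ odds b) (trans (even Eu) (cong (_+ evens l) (0<size⇒odds-swap a 0<a))))
          (trans (shuffle (evens a) (evens l) (odds b)) (cong (evens l +_) or)))
      where
      la : long a ≡ true
      la = trans (cong firstLong (sym φr)) (trans (first Er) cr)
      m≤a = long⁻ a la
      0<a = ≤-trans 0<m m≤a
      sr : suc (size a + size b) ≡ size r
      sr = trans (cong size (sym φr)) (sz Er)
      er : suc (odds a + evens b) ≡ evens r
      er = trans (cong evens (sym φr)) (even Er)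
      or : evens a + odds b ≡ odds r
      or = trans (cong odds (sym φr)) (odd Er)
      u = node (swap a) l
      su = cong (λ x → suc (x + size l)) (size-swap a)
      flip-sum = +-comm (size r) (size l)
      Eu : Exchanged k u
      Eu = ih u (≤-trans (≤-reflexive su) (bound sr (≤-trans (≤-reflexive flip-sum) s≤k)))
                (≤-trans (≤-reflexive su) (bound sr (≤-trans (≤-reflexive flip-sum) (<⇒≤ s<2m))))
      w = exchange k u
      cw : centreOdd w ≡ true
      cw = trans (centre Eu) (long⁺ (swap a) (subst (m ≤_) (sym (size-swap a)) m≤a))
      lw : long w ≡ true
      lw = long⁺ w (<⇒≤ (centreOdd⇒m<size w cw))
      shuffle : ∀ x y z → x + y + z ≡ y + (x + z)
      shuffle = solve-∀

    exchanged-node : Exchanged (suc k) (node l r)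
    exchanged-node with centreOdd l in cl | long l in ll | centreOdd r in cr
    ... | true  | _     | _     = exchanged-left cl
    -- Here both properties hold, and in the last case both fail, so the tree may stay fixed.
    ... | false | true  | _     = exchanged (node l r) e e
            (sym co) co refl refl
            where
            e = exchange-long k l r cl ll
            co = trans (centreOdd-long l r ll) (trans (cong not cl) (sym ll))
    ... | false | false | true  = exchanged-right cl ll cr
    ... | false | false | false = exchanged (node l r) e e (sym co) co refl refl
            where
            e = exchange-short k l r cl ll cr
            co = trans (centreOdd-short l r ll) (trans cr (sym ll))

  exchange-correct : ∀ k t → size t ≤ k → size t ≤ 2 * m → Exchanged k t
  exchange-correct zero    leaf       _         _ =
    record { invol = refl ; first = refl ; centre = refl ; even = refl ; odd = refl }
  exchange-correct (suc k) leaf       _         _ =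
    record { invol = refl ; first = refl ; centre = refl ; even = refl ; odd = refl }
  exchange-correct (suc k) (node l r) (s≤s p) q =
    exchanged-node k (exchange-correct k) l r p q

-- Enumeration of trees

injection⇒≤length : ∀ {A : Set} k (ys : List A) (f : Fin k → A) → (∀ {i j} → f i ≡ f j → i ≡ j) →
                    (∀ i → f i ∈ ys) → k ≤ length ys
injection⇒≤length k ys f inj mem = injective⇒≤ {f = λ i → index (mem i)} λ {i} {j} eq →
  inj (trans (lookup-index (mem i)) (trans (cong (lookup ys) eq) (sym (lookup-index (mem j)))))

lookup-injective : ∀ {A : Set} {xs : List A} → Unique xs → ∀ {i j} → lookup xs i ≡ lookup xs j → i ≡ j
lookup-injective (_ ∷ _) {Fin.zero}  {Fin.zero}  _  = refl
lookup-injective (x ∷ _) {Fin.zero}  {Fin.suc j} eq = contradiction eq (All.lookup x (∈-lookup j))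
lookup-injective (x ∷ _) {Fin.suc i} {Fin.zero}  eq = contradiction (sym eq) (All.lookup x (∈-lookup i))
lookup-injective (_ ∷ u) {Fin.suc i} {Fin.suc j} eq = cong Fin.suc (lookup-injective u eq)

retract⇒length≤ : ∀ {A B : Set} {xs : List A} {ys : List B} → Unique xs →
                  (g : A → B) (h : B → A) →
                  (∀ {x} → x ∈ xs → g x ∈ ys × h (g x) ≡ x) → length xs ≤ length ys
retract⇒length≤ {xs = xs} {ys} u g h prop =
  injection⇒≤length _ ys (λ i → g (lookup xs i))
    (λ {i} {j} eq → lookup-injective u (trans (sym (proj₂ (prop (∈-lookup i))))
      (trans (cong h eq) (proj₂ (prop (∈-lookup j))))))
    (λ i → proj₁ (prop (∈-lookup i)))

evensF oddsF : ∀ {k} → Vec Tree k → ℕ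
evensF []       = 0
evensF (t ∷ ts) = evens t + oddsF ts
oddsF []        = 0
oddsF (t ∷ ts)  = odds t + evensF ts

-- The inverse of deleting the opening letter of a word that begins with an edge: the closing letter
-- of that edge becomes a separator, so there is one tree more.
graft : ∀ {k} → Vec Tree (2 + k) → Vec Tree (1 + k)
graft (l ∷ r ∷ ts) = node l r ∷ ts

graft-injective : ∀ {k} {x y : Vec Tree (2 + k)} → graft x ≡ graft y → x ≡ y
graft-injective {x = _ ∷ _ ∷ _} {_ ∷ _ ∷ _} refl = refl

-- The forests of k trees are read as words, the separators between trees
-- counting as letters, so that parities alternate from tree to tree.
forests : ∀ k → ℕ → ℕ → List (Vec Tree k)
forests zero    zero    zero    = [] ∷ []
forests zero    zero    (suc b) = []
forests zero    (suc a) b       = []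
forests (suc k) zero    b       = map (leaf ∷_) (forests k b zero)
forests (suc k) (suc a) b       =
  map (leaf ∷_) (forests k b (suc a)) ++ map graft (forests (2 + k) b a)

evensF-graft : ∀ {k} (ts : Vec Tree (2 + k)) → evensF (graft ts) ≡ suc (oddsF ts)
evensF-graft (l ∷ r ∷ ts) = cong suc (+-assoc (odds l) (evens r) (oddsF ts))

oddsF-graft : ∀ {k} (ts : Vec Tree (2 + k)) → oddsF (graft ts) ≡ evensF ts
oddsF-graft (l ∷ r ∷ ts) = +-assoc (evens l) (odds r) (evensF ts)

∈-forests⁺ : ∀ k a b (ts : Vec Tree k) → evensF ts ≡ a → oddsF ts ≡ b → ts ∈ forests k a b
∈-forests⁺ zero    zero    zero    []          refl refl = here refl
∈-forests⁺ (suc k) zero    b       (leaf ∷ ts) p q = ∈-map⁺ (leaf ∷_) (∈-forests⁺ k b zero ts q p)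
∈-forests⁺ (suc k) (suc a) b       (leaf ∷ ts) p q =
  ∈-++⁺ˡ (∈-map⁺ (leaf ∷_) (∈-forests⁺ k b (suc a) ts q p))
∈-forests⁺ (suc k) (suc a) b       (node l r ∷ ts) p q =
  ∈-++⁺ʳ (map (leaf ∷_) (forests k b (suc a))) (∈-map⁺ graft (∈-forests⁺ (2 + k) b a (l ∷ r ∷ ts)
    (trans (sym (oddsF-graft (l ∷ r ∷ ts))) q)
    (suc-injective (trans (sym (evensF-graft (l ∷ r ∷ ts))) p))))

forests-sound : ∀ k a b → All (λ ts → evensF ts ≡ a × oddsF ts ≡ b) (forests k a b)
forests-sound zero    zero    zero    = (refl , refl) All.∷ All.[]
forests-sound zero    zero    (suc b) = All.[]
forests-sound zero    (suc a) b       = All.[]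
forests-sound (suc k) zero    b       = All.map⁺ (All.map (λ (p , q) → q , p) (forests-sound k b zero))
forests-sound (suc k) (suc a) b       = All.++⁺
  (All.map⁺ (All.map (λ (p , q) → q , p) (forests-sound k b (suc a))))
  (All.map⁺ (All.map (λ {ts} (p , q) → trans (evensF-graft ts) (cong suc q) , trans (oddsF-graft ts) p)
    (forests-sound (2 + k) b a)))

leaf∷-injective : ∀ {k} {x y : Vec Tree k} → leaf ∷ x ≡ leaf ∷ y → x ≡ y
leaf∷-injective refl = refl

forests-unique : ∀ k a b → Unique (forests k a b)
forests-unique zero    zero    zero    = All.[] ∷ []
forests-unique zero    zero    (suc b) = []
forests-unique zero    (suc a) b       = []
forests-unique (suc k) zero    b       = Unique.map⁺ leaf∷-injective (forests-unique k b zero)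
forests-unique (suc k) (suc a) b       =
  Unique.++⁺ (Unique.map⁺ leaf∷-injective (forests-unique k b (suc a)))
             (Unique.map⁺ graft-injective (forests-unique (2 + k) b a))
             λ (p , q) → disjoint p q
  where
  disjoint : ∀ {ts} → ts ∈ map (leaf ∷_) (forests k b (suc a)) → ts ∈ map graft (forests (2 + k) b a) → ⊥
  disjoint p q with ∈-map⁻ (leaf ∷_) p | ∈-map⁻ graft q
  ... | _ , _ , refl | (_ ∷ _ ∷ _) , _ , ()

trees : ℕ → ℕ → List Tree
trees a b = map head (forests 1 a b)

∈-trees⁺ : ∀ {a b} t → evens t ≡ a → odds t ≡ b → t ∈ trees a b
∈-trees⁺ {a} {b} t p q = ∈-map⁺ head (∈-forests⁺ 1 a b (t ∷ [])
  (trans (+-identityʳ _) p) (trans (+-identityʳ _) q))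

∈-trees⁻ : ∀ {a b t} → t ∈ trees a b → evens t ≡ a × odds t ≡ b
∈-trees⁻ {a} {b} t∈ with ∈-map⁻ head t∈
... | (t ∷ []) , ts∈ , refl with All.lookup (forests-sound 1 a b) ts∈
... | p , q = trans (sym (+-identityʳ _)) p , trans (sym (+-identityʳ _)) q

trees-unique : ∀ a b → Unique (trees a b)
trees-unique a b = Unique.map⁺ head-injective (forests-unique 1 a b)
  where
  head-injective : {x y : Vec Tree 1} → head x ≡ head y → x ≡ y
  head-injective {_ ∷ []} {_ ∷ []} refl = refl

-- Counting forests by binomial determinants

#forests : ℕ → ℕ → ℕ → ℕ
#forests k a b = length (forests k a b)

#forests-zero : ∀ k b → #forests (suc k) 0 b ≡ #forests k b 0
#forests-zero k b = length-map (leaf ∷_) (forests k b 0)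

#forests-suc : ∀ k a b → #forests (suc k) (suc a) b ≡ #forests k b (suc a) + #forests (2 + k) b a
#forests-suc k a b = trans (length-++ (map (leaf ∷_) (forests k b (suc a))))
  (cong₂ _+_ (length-map (leaf ∷_) (forests k b (suc a))) (length-map graft (forests (2 + k) b a)))

#trees : ℕ → ℕ → ℕ
#trees a b = length (trees a b)

-- n C⁻ k stands for the binomial coefficient of n and k - 1.
_C⁻_ : ℕ → ℕ → ℕ
n C⁻ zero  = 0
n C⁻ suc k = n C k

infix 8 _C⁻_

pascal : ∀ n k → suc n C k ≡ n C⁻ k + n C k
pascal n zero    = refl
pascal n (suc k) = sym (nCk+nC[k+1]≡[n+1]C[k+1] n k)

-- In contrast to `2 * q`, this unfolds to two successors, as the recursion of `forests` in the
-- number of trees requires.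
twice : ℕ → ℕ
twice zero    = zero
twice (suc q) = 2 + twice q

C-symmetric : ∀ a b → (a + b) C a ≡ (a + b) C b
C-symmetric a b = trans (nCk≡nC[n∸k] (m≤m+n a b)) (cong ((a + b) C_) (m+n∸m≡n a b))

-- The base of the induction: edges remain but no tree to hold them. The determinant vanishes
-- because `b` and `a` - 1 add up to `s`, so the symmetry of binomials matches the factors
-- crosswise.
boundary : ∀ a b s → a + b ≡ suc s → s C⁻ a * s C⁻ b ≡ (s C a) * (s C b)
boundary zero    (suc b) s refl = sym (trans (+-identityʳ _) (k>n⇒nCk≡0 {s} {suc s} ≤-refl))
boundary (suc a) zero    s eq   = trans (*-zeroʳ (s C a)) (sym (trans (*-identityʳ _)
  (k>n⇒nCk≡0 (≤-reflexive (trans (sym eq) (+-identityʳ _))))))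
boundary (suc a) (suc b) s refl = trans (*-comm (s C a) (s C b))
  (cong₂ _*_ (trans (cong (_C b) (+-suc a b)) (trans (sym (C-symmetric (suc a) b)) (cong (_C suc a) (sym (+-suc a b)))))
             (C-symmetric a (suc b)))

private
  -- Pascal's rule splits one row of the determinant. The two resulting determinants count the words
  -- that begin with an empty tree and those that begin with an edge.
  combine : ∀ e₁ e₂ b⁻ b w x y → e₁ + b⁻ * x ≡ b * y → e₂ + b⁻ * w ≡ b * x →
            e₁ + e₂ + (w + x) * b⁻ ≡ (x + y) * b
  combine e₁ e₂ b⁻ b w x y p q = begin
    e₁ + e₂ + (w + x) * b⁻         ≡⟨ lhs e₁ e₂ b⁻ w x ⟩
    (e₁ + b⁻ * x) + (e₂ + b⁻ * w)  ≡⟨ cong₂ _+_ p q ⟩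
    b * y + b * x                  ≡⟨ rhs b x y ⟩
    (x + y) * b                    ∎
    where
    open ≡-Reasoning
    lhs : ∀ e₁ e₂ b⁻ w x → e₁ + e₂ + (w + x) * b⁻ ≡ (e₁ + b⁻ * x) + (e₂ + b⁻ * w)
    lhs = solve-∀
    rhs : ∀ b x y → b * y + b * x ≡ (x + y) * b
    rhs = solve-∀

  rotate-sum : ∀ a b q s → suc a + b + q ≡ suc s → b + a + suc q ≡ suc s
  rotate-sum a b q s eq = trans (shuffle a b q) eq
    where
    shuffle : ∀ a b q → b + a + suc q ≡ suc a + b + q
    shuffle = solve-∀

-- The determinant of Lindström, Gessel and Viennot for two non-crossing
-- lattice paths, one for the letters at either parity.
#forests-even : ∀ q a b s → a + b + q ≡ suc s →
  #forests (twice q) a b + s C⁻ a * s C⁻ b ≡ (s C a) * (s C b)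
#forests-odd  : ∀ q a b s → a + b + q ≡ suc s →
  #forests (suc (twice q)) a b + suc s C⁻ a * s C⁻ b ≡ (suc s C a) * (s C b)

#forests-odd q zero b s eq = trans (+-identityʳ _) (trans (#forests-zero (twice q) b)
  (trans (sym (+-identityʳ _)) (trans (cong (#forests (twice q) b 0 +_) (sym (*-zeroʳ (s C⁻ b))))
    (trans (#forests-even q b 0 s (trans (cong (_+ q) (+-identityʳ b)) eq)) (*-comm (s C b) 1)))))
#forests-odd q (suc a) b s eq
  rewrite #forests-suc (twice q) a b | pascal s (suc a) | pascal s a =
  combine (#forests (twice q) b (suc a)) _ (s C⁻ b) (s C b) (s C⁻ a) (s C a) (s C suc a)
    (#forests-even q b (suc a) s (trans (cong (_+ q) (+-comm b (suc a))) eq))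
    (#forests-even (suc q) b a s (rotate-sum a b q s eq))

#forests-even zero zero    (suc b) s eq = boundary zero (suc b) s (trans (sym (+-identityʳ _)) eq)
#forests-even zero (suc a) b       s eq = boundary (suc a) b s (trans (sym (+-identityʳ _)) eq)
#forests-even (suc zero) zero    zero zero eq = refl
#forests-even (suc q)    (suc a) b    zero eq with () ← trans (sym (+-suc (a + b) q)) (suc-injective eq)
#forests-even (suc q)    zero (suc b) zero eq with () ← trans (sym (+-suc b q)) (suc-injective eq)
#forests-even (suc q) zero b (suc s) eq = trans (+-identityʳ _) (trans (#forests-zero (suc (twice q)) b)
  (trans (sym (+-identityʳ _)) (trans (cong (#forests (suc (twice q)) b 0 +_) (sym (*-zeroʳ (suc s C⁻ b))))
    (trans (#forests-odd q b 0 s (trans (cong (_+ q) (+-identityʳ b)) (suc-injective (trans (sym (+-suc b q)) eq))))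
      (*-comm (suc s C b) 1)))))
#forests-even (suc q) (suc a) b (suc s) eq
  rewrite #forests-suc (suc (twice q)) a b | pascal s (suc a) | pascal s a = 
  combine (#forests (suc (twice q)) b (suc a)) _ (suc s C⁻ b) (suc s C b) (s C⁻ a) (s C a) (s C suc a)
    (#forests-odd q b (suc a) s (trans (cong (_+ q) (+-comm b (suc a))) eq'))
    (#forests-odd (suc q) b a s (rotate-sum a b q s eq'))
  where
  eq' : suc a + b + q ≡ suc s
  eq' = suc-injective (trans (sym (+-suc (suc a + b) q)) eq)

#forests-0 : ∀ a b → #forests 0 b (suc a) ≡ 0
#forests-0 a zero    = refl
#forests-0 a (suc b) = refl

-- A Narayana number: deleting the opening letter of a nonempty tree leaves a forest of two trees
-- with the parities exchanged.
#trees-formula : ∀ a b s → a + b ≡ s → #trees (suc a) b + s C⁻ b * s C⁻ a ≡ (s C b) * (s C a)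
#trees-formula a b s refl rewrite length-map head (forests 1 (suc a) b) | #forests-suc 0 a b | #forests-0 a b =
  #forests-even 1 b a (a + b) (trans (+-comm (b + a) 1) (cong suc (+-comm b a)))

#trees-0-suc : ∀ b → #trees 0 (suc b) ≡ 0
#trees-0-suc b = trans (length-map head (forests 1 0 (suc b))) (#forests-zero 0 (suc b))

-- Long against short first edges

length-filter-≟ : ∀ {A : Set} (p : A → Bool) xs →
  length (filter (λ x → p x Bool.≟ false) xs) + length (filter (λ x → p x Bool.≟ true) xs) ≡ length xs
length-filter-≟ p []       = refl
length-filter-≟ p (x ∷ xs) with p x
... | false = cong suc (length-filter-≟ p xs)
... | true  = trans (+-suc _ _) (cong suc (length-filter-≟ p xs))

-- Exchanging the two subtrees of the root turns a short first edge into a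
-- long one, except that one subtree may be empty: that case is recorded on
-- the right of the sum.
mirror unmirror : Tree ⊎ Tree → Tree ⊎ Tree
mirror (inj₁ leaf)                  = inj₁ leaf
mirror (inj₁ (node leaf r))         = inj₂ r
mirror (inj₁ (node l@(node _ _) r)) = inj₁ (node (swap r) (swap l))
mirror (inj₂ l)                     = inj₁ (node l leaf)
unmirror (inj₁ leaf)                  = inj₁ leaf
unmirror (inj₁ (node l leaf))         = inj₂ l
unmirror (inj₁ (node l r@(node _ _))) = inj₁ (node (swap r) (swap l))
unmirror (inj₂ r)                     = inj₁ (node leaf r)

module Count (m : ℕ) (0<m : 0 < m) where
  open Centre m 0<m

  shorts longs : ℕ → ℕ → List Tree
  shorts a b = filter (λ t → firstLong t Bool.≟ false) (trees a b)
  longs a b  = filter (λ t → firstLong t Bool.≟ true) (trees a b)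

  #shorts #longs : ℕ → ℕ → ℕ
  #shorts a b = length (shorts a b)
  #longs a b  = length (longs a b)

  #shorts+#longs : ∀ a b → #shorts a b + #longs a b ≡ #trees a b
  #shorts+#longs a b = length-filter-≟ firstLong (trees a b)

  private
    tagged : List Tree → List Tree → List (Tree ⊎ Tree)
    tagged xs ys = map inj₁ xs ++ map inj₂ ys

    tagged-unique : ∀ {xs ys} → Unique xs → Unique ys → Unique (tagged xs ys)
    tagged-unique {xs} {ys} ux uy = Unique.++⁺ (Unique.map⁺ inj₁-injective ux) (Unique.map⁺ inj₂-injective uy)
      λ (p , q) → disjoint p q
      where
      disjoint : ∀ {z} → z ∈ map inj₁ xs → z ∈ map inj₂ ys → ⊥
      disjoint p q with ∈-map⁻ inj₁ p | ∈-map⁻ inj₂ q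
      ... | _ , _ , refl | _ , _ , ()

    length-tagged : ∀ xs ys → length (tagged xs ys) ≡ length xs + length ys
    length-tagged xs ys = trans (length-++ (map inj₁ xs)) (cong₂ _+_ (length-map inj₁ xs) (length-map inj₂ ys))

    Tagged : (P Q : Tree → Set) → Tree ⊎ Tree → Set
    Tagged P Q (inj₁ t) = P t
    Tagged P Q (inj₂ t) = Q t

    ∈-tagged⁻ : ∀ {xs ys z} → z ∈ tagged xs ys → Tagged (_∈ xs) (_∈ ys) z
    ∈-tagged⁻ {xs} z∈ with ∈-++⁻ (map inj₁ xs) z∈
    ... | inj₁ p with ∈-map⁻ inj₁ p
    ...   | _ , q , refl = q
    ∈-tagged⁻ {xs} z∈ | inj₂ p with ∈-map⁻ inj₂ p
    ...   | _ , q , refl = q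

    ∈-tagged⁺ : ∀ {xs ys} z → Tagged (_∈ xs) (_∈ ys) z → z ∈ tagged xs ys
    ∈-tagged⁺ (inj₁ t) p = ∈-++⁺ˡ (∈-map⁺ inj₁ p)
    ∈-tagged⁺ (inj₂ t) p = ∈-++⁺ʳ _ (∈-map⁺ inj₂ p)

  module _ (a b : ℕ) (eq : suc a + b ≡ 2 * m) where

    private
      Short Long Rest Inner : Tree → Set
      Short t = evens t ≡ suc a × odds t ≡ b × firstLong t ≡ false
      Long t  = evens t ≡ suc a × odds t ≡ b × firstLong t ≡ true
      Rest t  = evens t ≡ a × odds t ≡ b
      Inner t = evens t ≡ b × odds t ≡ a

      size≡2m : ∀ t → evens t ≡ suc a → odds t ≡ b → size t ≡ m + m
      size≡2m t p q = trans (sym (evens+odds≡size t)) (trans (cong₂ _+_ p q)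
        (trans eq (cong (m +_) (+-identityʳ m))))

      -- Each subtree changes sides and is itself swapped, so parities are restored except for its
      -- own first edge. These two exceptions cancel.
      mirror-evens : ∀ l r → 0 < size l → 0 < size r → evens (node (swap r) (swap l)) ≡ evens (node l r)
      mirror-evens l r p q = trans (cong₂ _+_ {x = suc (odds (swap r))} (0<size⇒odds-swap r q) (0<size⇒evens-swap l p))
        (shuffle (evens r) (odds l))
        where
        shuffle : ∀ x y → x + suc y ≡ suc (y + x)
        shuffle = solve-∀

      mirror-odds : ∀ l r → 0 < size l → 0 < size r → odds (node (swap r) (swap l)) ≡ odds (node l r)
      mirror-odds l r p q = suc-injective (trans (cong suc (cong (_+ odds (swap l)) (0<size⇒evens-swap r q)))
        (trans (shuffle (odds r) (odds (swap l))) (cong (λ x → suc (x + odds r)) (0<size⇒odds-swap l p))))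
        where
        shuffle : ∀ x y → suc (suc x + y) ≡ suc (suc y + x)
        shuffle = solve-∀

      -- The subtrees of the root have an odd number 2m - 1 of edges in total, so exactly one of
      -- them reaches m; with `other-short` this is why mirroring reverses the length of the first
      -- edge.
      other-long : ∀ x y → suc (x + y) ≡ m + m → x < m → m ≤ y
      other-long x y e x<m = +-cancelˡ-≤ m m y (≤-trans (≤-reflexive (sym e)) (+-monoˡ-≤ y x<m))

      other-short : ∀ x y → suc (x + y) ≡ m + m → m ≤ x → y < m
      other-short x y e m≤x = +-cancelˡ-≤ m (suc y) m
        (≤-trans (≤-reflexive (+-suc m y)) (≤-trans (s≤s (+-monoˡ-≤ y m≤x)) (≤-reflexive e)))

      mirror-ok : ∀ z → Tagged Short Inner z → Tagged Long Rest (mirror z) × unmirror (mirror z) ≡ z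
      mirror-ok (inj₁ (node leaf r)) (p , q , _) = (suc-injective p , q) , refl
      mirror-ok (inj₁ t@(node l@(node _ _) leaf)) (p , q , f) =
        contradiction (≤-trans 0<m (other-long (size l) 0 (size≡2m t p q) (¬long⁻ l f))) λ ()
      mirror-ok (inj₁ t@(node l@(node _ _) r@(node _ _))) (p , q , f) =
        ( trans (mirror-evens l r z<s z<s) p , trans (mirror-odds l r z<s z<s) q
        , long⁺ (swap r) (≤-trans (other-long (size l) (size r) (size≡2m t p q) (¬long⁻ l f))
            (≤-reflexive (sym (size-swap r))))) , refl
      mirror-ok (inj₂ l) (p , q) =
        ( cong suc (trans (+-identityʳ _) q) , trans (+-identityʳ _) p
        , long⁺ l (other-long 0 (size l) sl 0<m)) , refl
        where
        sl : suc (size l) ≡ m + m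
        sl = trans (cong suc (trans (sym (evens+odds≡size l)) (trans (cong₂ _+_ p q) (+-comm b a))))
               (trans eq (cong (m +_) (+-identityʳ m)))

      unmirror-ok : ∀ z → Tagged Long Rest z → Tagged Short Inner (unmirror z) × mirror (unmirror z) ≡ z
      unmirror-ok (inj₁ (node l leaf)) (p , q , _) =
        (trans (sym (+-identityʳ _)) q , suc-injective (trans (cong suc (sym (+-identityʳ _))) p)) , refl
      unmirror-ok (inj₁ (node leaf r@(node _ _))) (p , q , f) =
        contradiction (≤-trans 0<m (long⁻ leaf f)) λ ()
      unmirror-ok (inj₁ t@(node l@(node _ _) r@(node _ _))) (p , q , f) =
        ( trans (mirror-evens l r z<s z<s) p , trans (mirror-odds l r z<s z<s) q
        , ¬long⁺ (swap r) (≤-<-trans (≤-reflexive (size-swap r))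
            (other-short (size l) (size r) (size≡2m t p q) (long⁻ l f)))) , refl
      unmirror-ok (inj₂ r) (p , q) = (cong suc p , q , ¬long⁺ leaf 0<m) , refl

      S L : List (Tree ⊎ Tree)
      S = tagged (shorts (suc a) b) (trees b a)
      L = tagged (longs (suc a) b) (trees a b)

      S⁻ : ∀ {z} → z ∈ S → Tagged Short Inner z
      S⁻ {inj₁ t} z∈ with ∈-filter⁻ (λ t → firstLong t Bool.≟ false) {xs = trees (suc a) b} (∈-tagged⁻ z∈)
      ... | t∈ , f with ∈-trees⁻ t∈
      ... | p , q = p , q , f
      S⁻ {inj₂ t} z∈ = ∈-trees⁻ (∈-tagged⁻ {shorts (suc a) b} z∈)

      L⁻ : ∀ {z} → z ∈ L → Tagged Long Rest z
      L⁻ {inj₁ t} z∈ with ∈-filter⁻ (λ t → firstLong t Bool.≟ true) {xs = trees (suc a) b} (∈-tagged⁻ z∈)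
      ... | t∈ , f with ∈-trees⁻ t∈
      ... | p , q = p , q , f
      L⁻ {inj₂ t} z∈ = ∈-trees⁻ (∈-tagged⁻ {longs (suc a) b} z∈)

      S⁺ : ∀ z → Tagged Short Inner z → z ∈ S
      S⁺ (inj₁ t) (p , q , f) = ∈-tagged⁺ (inj₁ t) (∈-filter⁺ (λ t → firstLong t Bool.≟ false) (∈-trees⁺ t p q) f)
      S⁺ (inj₂ t) (p , q)     = ∈-tagged⁺ {shorts (suc a) b} (inj₂ t) (∈-trees⁺ t p q)

      L⁺ : ∀ z → Tagged Long Rest z → z ∈ L
      L⁺ (inj₁ t) (p , q , f) = ∈-tagged⁺ (inj₁ t) (∈-filter⁺ (λ t → firstLong t Bool.≟ true) (∈-trees⁺ t p q) f)
      L⁺ (inj₂ t) (p , q)     = ∈-tagged⁺ {longs (suc a) b} (inj₂ t) (∈-trees⁺ t p q)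

    -- The correction `#trees a b` counts the right subtrees beside an empty left one, and
    -- `#trees b a` the left subtrees beside an empty right one, whose parities are exchanged by
    -- their odd offset.
    #shorts-#longs : #shorts (suc a) b + #trees b a ≡ #longs (suc a) b + #trees a b
    #shorts-#longs = trans (sym (length-tagged (shorts (suc a) b) _))
      (trans (≤-antisym
        (retract⇒length≤ {xs = S} {L} (tagged-unique (Unique.filter⁺ _ (trees-unique (suc a) b)) (trees-unique b a)) mirror unmirror
          λ {z} z∈ → let (w , e) = mirror-ok z (S⁻ z∈) in L⁺ _ w , e)
        (retract⇒length≤ {xs = L} {S} (tagged-unique (Unique.filter⁺ _ (trees-unique (suc a) b)) (trees-unique a b)) unmirror mirror
          λ {z} z∈ → let (w , e) = unmirror-ok z (L⁻ z∈) in S⁺ _ w , e))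
      (length-tagged (longs (suc a) b) _))

-- Binomial identities and the size of a class

_C⁻⁻_ : ℕ → ℕ → ℕ
n C⁻⁻ zero  = 0
n C⁻⁻ suc k = n C⁻ k

infix 8 _C⁻⁻_

pascal⁻ : ∀ n k → suc n C⁻ k ≡ n C⁻⁻ k + n C⁻ k
pascal⁻ n zero    = refl
pascal⁻ n (suc k) = pascal n k

absorption : ∀ n k → suc k * (suc n C suc k) ≡ suc n * (n C k)
absorption zero    zero    = refl
absorption zero    (suc k) = trans (cong ((2 + k) *_) (k>n⇒nCk≡0 {1} {2 + k} (s≤s (s≤s z≤n)))) (trans (*-zeroʳ (2 + k))
  (sym (trans (+-identityʳ _) (k>n⇒nCk≡0 {0} {suc k} (s≤s z≤n)))))
absorption (suc n) zero    rewrite sym (nCk+nC[k+1]≡[n+1]C[k+1] (suc n) 0) = begin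
  1 * (1 + (suc n C 1))  ≡⟨ cong (λ x → 1 * (1 + x)) (trans (sym (*-identityˡ _)) (absorption n 0)) ⟩
  1 * (1 + suc n * 1)    ≡⟨ *-identityˡ _ ⟩
  suc (suc n) * 1        ∎
  where open ≡-Reasoning
absorption (suc n) (suc k) = begin
  (2 + k) * ((2 + n) C (2 + k))
    ≡⟨ cong ((2 + k) *_) (sym (nCk+nC[k+1]≡[n+1]C[k+1] (suc n) (suc k))) ⟩
  (2 + k) * (u + (suc n C (2 + k)))
    ≡⟨ expand k u (suc n C (2 + k)) ⟩
  u + (suc k * u + (2 + k) * (suc n C (2 + k)))
    ≡⟨ cong (u +_) (cong₂ _+_ (absorption n k) (absorption n (suc k))) ⟩
  u + (suc n * (n C k) + suc n * (n C suc k))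
    ≡⟨ cong (u +_) (sym (*-distribˡ-+ (suc n) (n C k) (n C suc k))) ⟩
  u + suc n * ((n C k) + (n C suc k))
    ≡⟨ cong (λ x → u + suc n * x) (nCk+nC[k+1]≡[n+1]C[k+1] n k) ⟩
  (2 + n) * u ∎
  where
  open ≡-Reasoning
  u = suc n C suc k
  expand : ∀ k u w → (2 + k) * (u + w) ≡ u + (suc k * u + (2 + k) * w)
  expand = solve-∀

C-step : ∀ k j → suc k * ((k + j) C suc k) ≡ j * ((k + j) C k)
C-step k j = +-cancelˡ-≡ (suc k * x) _ _ (begin
  suc k * x + suc k * y   ≡⟨ sym (*-distribˡ-+ (suc k) x y) ⟩
  suc k * (x + y)         ≡⟨ cong (suc k *_) (nCk+nC[k+1]≡[n+1]C[k+1] (k + j) k) ⟩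
  suc k * (suc (k + j) C suc k) ≡⟨ absorption (k + j) k ⟩
  (suc k + j) * x         ≡⟨ *-distribʳ-+ x (suc k) j ⟩
  suc k * x + j * x       ∎)
  where
  open ≡-Reasoning
  x = (k + j) C k
  y = (k + j) C suc k

-- The ratio of `C-step` one place further along the row; its factor j - 1 is kept free of
-- subtraction.
C-step₂ : ∀ k j → (2 + k) * ((k + j) C (2 + k)) + ((k + j) C suc k) ≡ j * ((k + j) C suc k)
C-step₂ k zero rewrite k>n⇒nCk≡0 {k + 0} {2 + k} (s≤s (≤-trans (≤-reflexive (+-identityʳ k)) (n≤1+n k)))
  | k>n⇒nCk≡0 {k + 0} {suc k} (s≤s (≤-reflexive (+-identityʳ k))) = trans (+-identityʳ _) (*-zeroʳ (2 + k))
C-step₂ k (suc j) rewrite +-suc k j = trans (+-comm _ x) (cong (x +_) (C-step (suc k) j))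
  where x = suc (k + j) C suc k

C⁻-symmetric : ∀ k j → (k + j) C⁻ j ≡ (k + j) C suc k
C⁻-symmetric k zero    = sym (k>n⇒nCk≡0 (s≤s (≤-reflexive (+-identityʳ k))))
C⁻-symmetric k (suc j) rewrite +-suc k j = sym (C-symmetric (suc k) j)

C⁻⁻-symmetric : ∀ k j → (k + j) C⁻⁻ j ≡ (k + j) C (2 + k)
C⁻⁻-symmetric k zero    = sym (k>n⇒nCk≡0 (s≤s (≤-trans (≤-reflexive (+-identityʳ k)) (n≤1+n k))))
C⁻⁻-symmetric k (suc j) rewrite +-suc k j = C⁻-symmetric (suc k) j

C-increasing : ∀ k j → suc k ≤ j → (k + j) C k ≤ (k + j) C suc k
C-increasing k j k<j = *-cancelˡ-≤ (suc k) (begin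
  suc k * ((k + j) C k)     ≤⟨ *-monoˡ-≤ ((k + j) C k) k<j ⟩
  j * ((k + j) C k)         ≡⟨ sym (C-step k j) ⟩
  suc k * ((k + j) C suc k) ∎)
  where open ≤-Reasoning

-- Induction on the distance `d` from the middle of the row, each step moving `k` one place inwards.
C≤central : ∀ d k → (k + (k + (d + d))) C k ≤ ((k + d) + (k + d)) C (k + d)
C≤central zero    k rewrite +-identityʳ k = ≤-refl
C≤central (suc d) k = begin
  (k + (k + suc (d + suc d))) C k     ≤⟨ C-increasing k _ (≤-trans (s≤s (m≤m+n k (d + suc d))) (≤-reflexive (sym (+-suc k _)))) ⟩
  (k + (k + suc (d + suc d))) C suc k ≡⟨ cong (_C suc k) (shift k d) ⟩
  (suc k + (suc k + (d + d))) C suc k ≤⟨ C≤central d (suc k) ⟩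
  ((suc k + d) + (suc k + d)) C (suc k + d) ≡⟨ cong (λ x → (x + x) C x) (sym (+-suc k d)) ⟩
  ((k + suc d) + (k + suc d)) C (k + suc d) ∎
  where
  open ≤-Reasoning
  shift : ∀ k d → k + (k + suc (d + suc d)) ≡ suc k + (suc k + (d + d))
  shift = solve-∀

C-central-max : ∀ a b j → a + b ≡ j + j → (a + b) C a ≤ (j + j) C j
C-central-max a b j eq with ≤-total a j
... | inj₁ a≤j = begin
  (a + b) C a                     ≡⟨ cong (_C a) (trans eq (trans (cong₂ _+_ ja ja) (+-assoc a d (a + d)))) ⟩
  (a + (d + (a + d))) C a         ≡⟨ cong (_C a) (shift a d) ⟩
  (a + (a + (d + d))) C a         ≤⟨ C≤central d a ⟩
  ((a + d) + (a + d)) C (a + d)   ≡⟨ cong (λ x → (x + x) C x) (sym ja) ⟩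
  (j + j) C j                     ∎
  where
  open ≤-Reasoning
  d = j ∸ a
  ja : j ≡ a + d
  ja = sym (m+[n∸m]≡n a≤j)
  shift : ∀ a d → a + (d + (a + d)) ≡ a + (a + (d + d))
  shift = solve-∀
... | inj₂ j≤a = begin
  (a + b) C a                     ≡⟨ C-symmetric a b ⟩
  (a + b) C b                     ≡⟨ cong (_C b) ab ⟩
  (b + (b + (d + d))) C b         ≤⟨ C≤central d b ⟩
  ((b + d) + (b + d)) C (b + d)   ≡⟨ cong (λ x → (x + x) C x) (sym jb) ⟩
  (j + j) C j                     ∎
  where
  open ≤-Reasoning
  d = a ∸ j
  aj : a ≡ j + d
  aj = sym (m+[n∸m]≡n j≤a)
  jb : j ≡ b + d
  jb = +-cancelˡ-≡ j _ _ (trans (sym eq) (trans (cong (_+ b) aj) (trans (+-assoc j d b) (cong (j +_) (+-comm d b)))))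
  ab : a + b ≡ b + (b + (d + d))
  ab = trans (cong (_+ b) (trans aj (cong (_+ d) jb))) (shift b d)
    where
    shift : ∀ b d → b + d + d + b ≡ b + (b + (d + d))
    shift = solve-∀

private
  -- Sum and difference of short and long give 2 sh₁ = N₁ + N₂ - N₃ and 2 lo₂ = N₄ + N₅ - N₆. All
  -- six determinants are expressed in one row of Pascal's triangle: `x₀` is a fixed entry, the
  -- other x lie one and two places to its right, the y to its left.
  combine-counts : ∀ {N₁ N₂ N₃ N₄ N₅ N₆ sh₁ lo₁ sh₂ lo₂} x₀ x₁ x₂ y₁ y₂ →
    N₁ + (x₂ + x₁) * (y₁ + x₀) ≡ (x₁ + x₀) * (x₀ + x₁) →
    N₂ + x₁ * y₁ ≡ x₀ * x₀ →
    N₃ + x₀ * x₂ ≡ x₁ * x₁ →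
    N₄ + (x₁ + x₀) * (y₂ + y₁) ≡ (y₁ + x₀) * (y₁ + x₀) →
    N₅ + y₁ * x₁ ≡ x₀ * x₀ →
    N₆ + x₀ * y₂ ≡ y₁ * y₁ →
    sh₁ + lo₁ ≡ N₁ → sh₁ + N₃ ≡ lo₁ + N₂ →
    sh₂ + lo₂ ≡ N₄ → sh₂ + N₅ ≡ lo₂ + N₆ →
    2 * (sh₁ + lo₂) + (4 * (y₁ * x₁) + y₂ * x₁ + y₁ * x₂) ≡ 4 * (x₀ * x₀) + x₀ * y₁ + x₀ * x₁
  combine-counts {N₁} {N₂} {N₃} {N₄} {N₅} {N₆} {sh₁} {lo₁} {sh₂} {lo₂} x₀ x₁ x₂ y₁ y₂ e₁ e₂ e₃ e₄ e₅ e₆ p₁ p₂ p₃ p₄ =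
    +-cancelʳ-≡ z _ _ (begin
      2 * (sh₁ + lo₂) + (4 * (y₁ * x₁) + y₂ * x₁ + y₁ * x₂) + z
        ≡⟨ split sh₁ lo₂ x₀ x₁ x₂ y₁ y₂ ⟩
      (sh₁ + sh₁ + (lo₂ + lo₂)) + (x₁ * x₁ + y₁ * y₁) + neg
        ≡⟨ cong (λ v → (sh₁ + sh₁ + (lo₂ + lo₂)) + v + neg) (cong₂ _+_ (sym e₃) (sym e₆)) ⟩
      (sh₁ + sh₁ + (lo₂ + lo₂)) + ((N₃ + x₀ * x₂) + (N₆ + x₀ * y₂)) + neg
        ≡⟨ regroup sh₁ lo₂ N₃ N₆ (x₀ * x₂) (x₀ * y₂) neg ⟩
      (sh₁ + (sh₁ + N₃)) + (lo₂ + (lo₂ + N₆)) + (x₀ * x₂ + x₀ * y₂) + neg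
        ≡⟨ cong₂ (λ v w → v + w + (x₀ * x₂ + x₀ * y₂) + neg) q₁ q₂ ⟩
      (N₁ + N₂) + (N₄ + N₅) + (x₀ * x₂ + x₀ * y₂) + neg
        ≡⟨ collect N₁ N₂ N₄ N₅ x₀ x₁ x₂ y₁ y₂ ⟩
      ((N₁ + (x₂ + x₁) * (y₁ + x₀)) + (N₂ + x₁ * y₁))
        + ((N₄ + (x₁ + x₀) * (y₂ + y₁)) + (N₅ + y₁ * x₁)) + (x₀ * x₂ + x₀ * y₂)
        ≡⟨ cong (_+ (x₀ * x₂ + x₀ * y₂)) (cong₂ _+_ (cong₂ _+_ e₁ e₂) (cong₂ _+_ e₄ e₅)) ⟩
      (((x₁ + x₀) * (x₀ + x₁) + x₀ * x₀) + ((y₁ + x₀) * (y₁ + x₀) + x₀ * x₀)) + (x₀ * x₂ + x₀ * y₂)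
        ≡⟨ final x₀ x₁ x₂ y₁ y₂ ⟩
      4 * (x₀ * x₀) + x₀ * y₁ + x₀ * x₁ + z ∎)
    where
    open ≡-Reasoning
    -- `z` contains x₁² and y₁², which bring in N₃ and N₆, and the products that cancel at the end;
    -- `neg` collects the subtracted products of the other four determinants.
    z   = x₁ * x₁ + y₁ * y₁ + x₂ * x₀ + x₁ * x₀ + x₀ * y₂ + x₀ * y₁
    neg = (x₂ + x₁) * (y₁ + x₀) + x₁ * y₁ + ((x₁ + x₀) * (y₂ + y₁) + y₁ * x₁)
    q₁ : sh₁ + (sh₁ + N₃) ≡ N₁ + N₂
    q₁ = trans (cong (sh₁ +_) p₂) (trans (sym (+-assoc sh₁ lo₁ N₂)) (cong (_+ N₂) p₁))
    q₂ : lo₂ + (lo₂ + N₆) ≡ N₄ + N₅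
    q₂ = trans (cong (lo₂ +_) (sym p₄)) (trans (sym (+-assoc lo₂ sh₂ N₅)) (cong (_+ N₅) (trans (+-comm lo₂ sh₂) p₃)))
    split : ∀ s l x₀ x₁ x₂ y₁ y₂ →
      2 * (s + l) + (4 * (y₁ * x₁) + y₂ * x₁ + y₁ * x₂)
        + (x₁ * x₁ + y₁ * y₁ + x₂ * x₀ + x₁ * x₀ + x₀ * y₂ + x₀ * y₁)
      ≡ (s + s + (l + l)) + (x₁ * x₁ + y₁ * y₁)
        + ((x₂ + x₁) * (y₁ + x₀) + x₁ * y₁ + ((x₁ + x₀) * (y₂ + y₁) + y₁ * x₁))
    split = solve-∀
    regroup : ∀ s l a b c d n → (s + s + (l + l)) + ((a + c) + (b + d)) + n
      ≡ (s + (s + a)) + (l + (l + b)) + (c + d) + n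
    regroup = solve-∀
    collect : ∀ a b c d x₀ x₁ x₂ y₁ y₂ →
      (a + b) + (c + d) + (x₀ * x₂ + x₀ * y₂)
        + ((x₂ + x₁) * (y₁ + x₀) + x₁ * y₁ + ((x₁ + x₀) * (y₂ + y₁) + y₁ * x₁))
      ≡ ((a + (x₂ + x₁) * (y₁ + x₀)) + (b + x₁ * y₁))
        + ((c + (x₁ + x₀) * (y₂ + y₁)) + (d + y₁ * x₁)) + (x₀ * x₂ + x₀ * y₂)
    collect = solve-∀
    final : ∀ x₀ x₁ x₂ y₁ y₂ →
      (((x₁ + x₀) * (x₀ + x₁) + x₀ * x₀) + ((y₁ + x₀) * (y₁ + x₀) + x₀ * x₀)) + (x₀ * x₂ + x₀ * y₂)
      ≡ 4 * (x₀ * x₀) + x₀ * y₁ + x₀ * x₁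
        + (x₁ * x₁ + y₁ * y₁ + x₂ * x₀ + x₁ * x₀ + x₀ * y₂ + x₀ * y₁)
    final = solve-∀

  -- The ratios of neighbouring binomials turn every product into a multiple of x₀². Multiplying by
  -- `D` clears their denominators, and the extra term (4 + κ + ν) X Y completes the terms with `x₂`
  -- and `y₂` to left sides of their recurrences.
  clear-denominators : ∀ κ ν T x₀ x₁ x₂ y₁ y₂ →
    (1 + κ) * x₁ ≡ ν * x₀ → (2 + κ) * x₂ + x₁ ≡ ν * x₁ →
    (1 + ν) * y₁ ≡ κ * x₀ → (2 + ν) * y₂ + y₁ ≡ κ * y₁ →
    2 * T + (4 * (y₁ * x₁) + y₂ * x₁ + y₁ * x₂) ≡ 4 * (x₀ * x₀) + x₀ * y₁ + x₀ * x₁ →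
    T * ((1 + κ) * (2 + κ) * ((1 + ν) * (2 + ν))) ≡
      x₀ * x₀ * ((κ + ν + 1) * (κ + ν + 2) * (κ + ν + 4))
  clear-denominators κ ν T x₀ x₁ x₂ y₁ y₂ r₁ r₂ s₁ s₂ t = *-cancelˡ-≡ _ _ 2
    (+-cancelʳ-≡ (rest (ν * x₀) (κ * x₀)) _ _ (begin
      2 * (T * D) + rest (ν * x₀) (κ * x₀)
        ≡⟨ cong₂ (λ v w → 2 * (T * D) + rest v w) (sym r₁) (sym s₁) ⟩
      2 * (T * D) + rest X Y
        ≡⟨ step₁ κ ν T x₁ y₁ ⟩
      2 * (T * D) + (4 * ((2 + κ) * (2 + ν) * (X * Y))
        + (2 + κ) * X * ((1 + ν) * (κ * y₁)) + (2 + ν) * Y * ((1 + κ) * (ν * x₁)))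
        ≡⟨ cong₂ (λ v w → 2 * (T * D) + (4 * ((2 + κ) * (2 + ν) * (X * Y))
             + (2 + κ) * X * ((1 + ν) * v) + (2 + ν) * Y * ((1 + κ) * w))) (sym s₂) (sym r₂) ⟩
      2 * (T * D) + (4 * ((2 + κ) * (2 + ν) * (X * Y))
        + (2 + κ) * X * ((1 + ν) * ((2 + ν) * y₂ + y₁)) + (2 + ν) * Y * ((1 + κ) * ((2 + κ) * x₂ + x₁)))
        ≡⟨ step₂ κ ν T x₁ x₂ y₁ y₂ ⟩
      D * (2 * T + (4 * (y₁ * x₁) + y₂ * x₁ + y₁ * x₂)) + (4 + κ + ν) * (X * Y)
        ≡⟨ cong (λ v → D * v + (4 + κ + ν) * (X * Y)) t ⟩
      D * (4 * (x₀ * x₀) + x₀ * y₁ + x₀ * x₁) + (4 + κ + ν) * (X * Y)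
        ≡⟨ step₃ κ ν x₀ x₁ y₁ ⟩
      4 * (D * (x₀ * x₀)) + (1 + κ) * ((2 + κ) * (2 + ν)) * (x₀ * Y)
        + (1 + ν) * ((2 + κ) * (2 + ν)) * (x₀ * X) + (4 + κ + ν) * (X * Y)
        ≡⟨ cong₂ (λ v w → 4 * (D * (x₀ * x₀)) + (1 + κ) * ((2 + κ) * (2 + ν)) * (x₀ * w)
             + (1 + ν) * ((2 + κ) * (2 + ν)) * (x₀ * v) + (4 + κ + ν) * (v * w)) r₁ s₁ ⟩
      4 * (D * (x₀ * x₀)) + (1 + κ) * ((2 + κ) * (2 + ν)) * (x₀ * (κ * x₀))
        + (1 + ν) * ((2 + κ) * (2 + ν)) * (x₀ * (ν * x₀)) + (4 + κ + ν) * (ν * x₀ * (κ * x₀))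
        ≡⟨ step₄ κ ν x₀ ⟩
      2 * (x₀ * x₀ * ((κ + ν + 1) * (κ + ν + 2) * (κ + ν + 4))) + rest (ν * x₀) (κ * x₀) ∎))
    where
    open ≡-Reasoning
    D = (1 + κ) * (2 + κ) * ((1 + ν) * (2 + ν))
    X = (1 + κ) * x₁
    Y = (1 + ν) * y₁
    rest : ℕ → ℕ → ℕ
    rest v w = 4 * ((2 + κ) * (2 + ν) * (v * w)) + (2 + κ) * v * (κ * w) + (2 + ν) * w * (ν * v)
    step₁ : ∀ κ ν T x₁ y₁ → 2 * (T * ((1 + κ) * (2 + κ) * ((1 + ν) * (2 + ν))))
        + (4 * ((2 + κ) * (2 + ν) * ((1 + κ) * x₁ * ((1 + ν) * y₁)))
          + (2 + κ) * ((1 + κ) * x₁) * (κ * ((1 + ν) * y₁)) + (2 + ν) * ((1 + ν) * y₁) * (ν * ((1 + κ) * x₁)))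
      ≡ 2 * (T * ((1 + κ) * (2 + κ) * ((1 + ν) * (2 + ν))))
        + (4 * ((2 + κ) * (2 + ν) * ((1 + κ) * x₁ * ((1 + ν) * y₁)))
          + (2 + κ) * ((1 + κ) * x₁) * ((1 + ν) * (κ * y₁)) + (2 + ν) * ((1 + ν) * y₁) * ((1 + κ) * (ν * x₁)))
    step₁ = solve-∀
    step₂ : ∀ κ ν T x₁ x₂ y₁ y₂ → 2 * (T * ((1 + κ) * (2 + κ) * ((1 + ν) * (2 + ν))))
        + (4 * ((2 + κ) * (2 + ν) * ((1 + κ) * x₁ * ((1 + ν) * y₁)))
          + (2 + κ) * ((1 + κ) * x₁) * ((1 + ν) * ((2 + ν) * y₂ + y₁))
          + (2 + ν) * ((1 + ν) * y₁) * ((1 + κ) * ((2 + κ) * x₂ + x₁)))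
      ≡ (1 + κ) * (2 + κ) * ((1 + ν) * (2 + ν)) * (2 * T + (4 * (y₁ * x₁) + y₂ * x₁ + y₁ * x₂))
        + (4 + κ + ν) * ((1 + κ) * x₁ * ((1 + ν) * y₁))
    step₂ = solve-∀
    step₃ : ∀ κ ν x₀ x₁ y₁ →
        (1 + κ) * (2 + κ) * ((1 + ν) * (2 + ν)) * (4 * (x₀ * x₀) + x₀ * y₁ + x₀ * x₁)
        + (4 + κ + ν) * ((1 + κ) * x₁ * ((1 + ν) * y₁))
      ≡ 4 * ((1 + κ) * (2 + κ) * ((1 + ν) * (2 + ν)) * (x₀ * x₀))
        + (1 + κ) * ((2 + κ) * (2 + ν)) * (x₀ * ((1 + ν) * y₁))
        + (1 + ν) * ((2 + κ) * (2 + ν)) * (x₀ * ((1 + κ) * x₁))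
        + (4 + κ + ν) * ((1 + κ) * x₁ * ((1 + ν) * y₁))
    step₃ = solve-∀
    step₄ : ∀ κ ν x₀ →
        4 * ((1 + κ) * (2 + κ) * ((1 + ν) * (2 + ν)) * (x₀ * x₀))
        + (1 + κ) * ((2 + κ) * (2 + ν)) * (x₀ * (κ * x₀))
        + (1 + ν) * ((2 + κ) * (2 + ν)) * (x₀ * (ν * x₀)) + (4 + κ + ν) * (ν * x₀ * (κ * x₀))
      ≡ 2 * (x₀ * x₀ * ((κ + ν + 1) * (κ + ν + 2) * (κ + ν + 4)))
        + (4 * ((2 + κ) * (2 + ν) * (ν * x₀ * (κ * x₀))) + (2 + κ) * (ν * x₀) * (κ * (κ * x₀))
          + (2 + ν) * (κ * x₀) * (ν * (ν * x₀)))
    step₄ = solve-∀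

C-two-steps : ∀ a b → suc a * suc b * ((2 + (a + b)) C suc a) ≡ (2 + (a + b)) * suc (a + b) * ((a + b) C a)
C-two-steps a b = begin
  suc a * suc b * (N C suc a)   ≡⟨ shuffle (suc a) (suc b) (N C suc a) ⟩
  suc b * (suc a * (N C suc a)) ≡⟨ cong (suc b *_) (absorption (suc (a + b)) a) ⟩
  suc b * (N * (suc (a + b) C a)) ≡⟨ cong (λ x → suc b * (N * x)) sym₁ ⟩
  suc b * (N * (suc (a + b) C suc b)) ≡⟨ swap* (suc b) N (suc (a + b) C suc b) ⟩
  N * (suc b * (suc (a + b) C suc b)) ≡⟨ cong (N *_) (absorption (a + b) b) ⟩
  N * (suc (a + b) * ((a + b) C b))  ≡⟨ sym (*-assoc N (suc (a + b)) ((a + b) C b)) ⟩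
  N * suc (a + b) * ((a + b) C b)   ≡⟨ cong (N * suc (a + b) *_) (sym (C-symmetric a b)) ⟩
  N * suc (a + b) * ((a + b) C a)   ∎
  where
  open ≡-Reasoning
  N = 2 + (a + b)
  shuffle : ∀ x y z → x * y * z ≡ y * (x * z)
  shuffle = solve-∀
  swap* : ∀ x y z → x * (y * z) ≡ y * (x * z)
  swap* = solve-∀
  sym₁ : suc (a + b) C a ≡ suc (a + b) C suc b
  sym₁ = trans (cong (_C a) (sym (+-suc a b))) (trans (C-symmetric a (suc b)) (cong (_C suc b) (+-suc a b)))

module ClassSize (m : ℕ) (0<m : 0 < m) where
  open Count m 0<m

  -- The size of an exchanged class: `evens` plus the bit of `firstLong` equals 2 + κ on both
  -- summands.
  #class : ℕ → ℕ → ℕ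
  #class κ ν = #shorts (2 + κ) ν + #longs (1 + κ) (1 + ν)

  module _ (κ ν : ℕ) (eq : 2 + (κ + ν) ≡ 2 * m) where
    private
      s  = κ + ν
      x₀ = s C κ
      x₁ = s C (1 + κ)
      x₂ = s C (2 + κ)
      y₁ = s C (1 + ν)
      y₂ = s C (2 + ν)

      xl₀ : s C ν ≡ x₀
      xl₀ = sym (C-symmetric κ ν)
      xl₁ : s C⁻ ν ≡ x₁
      xl₁ = C⁻-symmetric κ ν
      xl₂ : s C⁻⁻ ν ≡ x₂
      xl₂ = C⁻⁻-symmetric κ ν
      yk₁ : s C⁻ κ ≡ y₁
      yk₁ = trans (cong (_C⁻ κ) (+-comm κ ν)) (trans (C⁻-symmetric ν κ) (cong (_C (1 + ν)) (+-comm ν κ)))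
      yk₂ : s C⁻⁻ κ ≡ y₂
      yk₂ = trans (cong (_C⁻⁻ κ) (+-comm κ ν)) (trans (C⁻⁻-symmetric ν κ) (cong (_C (2 + ν)) (+-comm ν κ)))

      S₀ : suc s C ν ≡ x₁ + x₀
      S₀ = trans (pascal s ν) (cong₂ _+_ xl₁ xl₀)
      S₁ : suc s C⁻ ν ≡ x₂ + x₁
      S₁ = trans (pascal⁻ s ν) (cong₂ _+_ xl₂ xl₁)
      R₀ : suc s C κ ≡ y₁ + x₀
      R₀ = trans (pascal s κ) (cong (_+ x₀) yk₁)
      R₁ : suc s C⁻ κ ≡ y₂ + y₁
      R₁ = trans (pascal⁻ s κ) (cong₂ _+_ yk₂ yk₁)
      R₂ : suc s C (1 + κ) ≡ x₀ + x₁
      R₂ = pascal s (1 + κ)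
      S₂ : suc s C (1 + ν) ≡ y₁ + x₀
      S₂ = trans (pascal s (1 + ν)) (trans (cong (_+ y₁) xl₀) (+-comm x₀ y₁))

      e₁ : #trees (2 + κ) ν + (x₂ + x₁) * (y₁ + x₀) ≡ (x₁ + x₀) * (x₀ + x₁)
      e₁ = trans (cong (#trees (2 + κ) ν +_) (cong₂ _*_ (sym S₁) (sym R₀)))
        (trans (#trees-formula (1 + κ) ν (suc s) refl) (cong₂ _*_ S₀ R₂))
      e₂ : #trees (1 + κ) ν + x₁ * y₁ ≡ x₀ * x₀
      e₂ = trans (cong (#trees (1 + κ) ν +_) (cong₂ _*_ (sym xl₁) (sym yk₁)))
        (trans (#trees-formula κ ν s refl) (cong (_* x₀) xl₀))
      e₄ : #trees (1 + κ) (1 + ν) + (x₁ + x₀) * (y₂ + y₁) ≡ (y₁ + x₀) * (y₁ + x₀)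
      e₄ = trans (cong (#trees (1 + κ) (1 + ν) +_) (cong₂ _*_ (sym S₀) (sym R₁)))
        (trans (#trees-formula κ (1 + ν) (suc s) (+-suc κ ν)) (cong₂ _*_ S₂ R₀))
      e₅ : #trees (1 + ν) κ + y₁ * x₁ ≡ x₀ * x₀
      e₅ = trans (cong (#trees (1 + ν) κ +_) (cong₂ _*_ (sym yk₁) (sym xl₁)))
        (trans (#trees-formula ν κ s (+-comm ν κ)) (cong (x₀ *_) xl₀))

    -- The correction terms may ask for trees with odd edges but no even one; there are none, and
    -- the determinant, extended by zero, vanishes too.
    trees-edge : ∀ a b → #trees a (suc b) + ((a + b) C b) * ((a + b) C⁻⁻ a) ≡ ((a + b) C suc b) * ((a + b) C⁻ a)
    trees-edge zero b rewrite #trees-0-suc b = trans (*-zeroʳ (b C b)) (sym (*-zeroʳ (b C suc b)))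
    trees-edge (suc a) b = #trees-formula a (suc b) (suc (a + b)) (+-suc a b)

    private
      e₃ : #trees ν (1 + κ) + x₀ * x₂ ≡ x₁ * x₁
      e₃ = trans (cong (#trees ν (1 + κ) +_) (cong (x₀ *_) (sym xl₂)))
        (trans (subst (λ z → #trees ν (1 + κ) + (z C κ) * (z C⁻⁻ ν) ≡ (z C (1 + κ)) * (z C⁻ ν))
          (+-comm ν κ) (trees-edge ν κ)) (cong (x₁ *_) xl₁))
      e₆ : #trees κ (1 + ν) + x₀ * y₂ ≡ y₁ * y₁
      e₆ = trans (cong (#trees κ (1 + ν) +_) (cong₂ _*_ (sym xl₀) (sym yk₂)))
        (trans (trees-edge κ ν) (cong (y₁ *_) yk₁))

      D = (1 + κ) * (2 + κ) * ((1 + ν) * (2 + ν))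

      #class-D : #class κ ν * D ≡ x₀ * x₀ * ((κ + ν + 1) * (κ + ν + 2) * (κ + ν + 4))
      #class-D = clear-denominators κ ν (#class κ ν) x₀ x₁ x₂ y₁ y₂
        (C-step κ ν) (C-step₂ κ ν)
        (subst (λ z → (1 + ν) * (z C (1 + ν)) ≡ κ * x₀) (+-comm ν κ)
          (trans (C-step ν κ) (cong (κ *_) (trans (cong (_C ν) (+-comm ν κ)) xl₀))))
        (subst (λ z → (2 + ν) * (z C (2 + ν)) + (z C (1 + ν)) ≡ κ * (z C (1 + ν))) (+-comm ν κ)
          (C-step₂ ν κ))
        (combine-counts x₀ x₁ x₂ y₁ y₂ e₁ e₂ e₃ e₄ e₅ e₆
          (#shorts+#longs (2 + κ) ν) (#shorts-#longs (1 + κ) ν eq)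
          (#shorts+#longs (1 + κ) (1 + ν)) (#shorts-#longs κ (1 + ν) (trans (cong suc (+-suc κ ν)) eq)))

      big-D : ((4 + (κ + ν)) C (2 + κ)) * D
        ≡ (4 + (κ + ν)) * (3 + (κ + ν)) * ((2 + (κ + ν)) * (1 + (κ + ν)) * x₀)
      big-D = begin
        c * D ≡⟨ shuffle c (1 + κ) (2 + κ) (1 + ν) (2 + ν) ⟩
        (1 + κ) * (1 + ν) * ((2 + κ) * (2 + ν) * c)
          ≡⟨ cong ((1 + κ) * (1 + ν) *_) (subst (λ z → (2 + κ) * (2 + ν) * ((2 + z) C (2 + κ)) ≡ (2 + z) * suc z * (z C suc κ))
               (cong suc (+-suc κ ν)) (C-two-steps (1 + κ) (1 + ν))) ⟩
        (1 + κ) * (1 + ν) * ((4 + s) * (3 + s) * ((2 + s) C (1 + κ)))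
          ≡⟨ shuffle₂ ((1 + κ) * (1 + ν)) ((4 + s) * (3 + s)) ((2 + s) C (1 + κ)) ⟩
        (4 + s) * (3 + s) * ((1 + κ) * (1 + ν) * ((2 + s) C (1 + κ)))
          ≡⟨ cong ((4 + s) * (3 + s) *_) (C-two-steps κ ν) ⟩
        (4 + s) * (3 + s) * ((2 + s) * (1 + s) * x₀) ∎
        where
        open ≡-Reasoning
        c = (4 + (κ + ν)) C (2 + κ)
        shuffle : ∀ c a b d e → c * (a * b * (d * e)) ≡ a * d * (b * e * c)
        shuffle = solve-∀
        shuffle₂ : ∀ x y z → x * (y * z) ≡ y * (x * z)
        shuffle₂ = solve-∀

    #class-formula : #class κ ν * (3 + (κ + ν)) ≡ ((4 + (κ + ν)) C (2 + κ)) * ((κ + ν) C κ)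
    #class-formula = *-cancelʳ-≡ _ _ D (begin
      #class κ ν * (3 + s) * D       ≡⟨ shuffle (#class κ ν) (3 + s) D ⟩
      #class κ ν * D * (3 + s)       ≡⟨ cong (_* (3 + s)) #class-D ⟩
      x₀ * x₀ * ((κ + ν + 1) * (κ + ν + 2) * (κ + ν + 4)) * (3 + s) ≡⟨ reorder κ ν x₀ ⟩
      (4 + s) * (3 + s) * ((2 + s) * (1 + s) * x₀) * x₀ ≡⟨ cong (_* x₀) (sym big-D) ⟩
      ((4 + s) C (2 + κ)) * D * x₀     ≡⟨ shuffle ((4 + s) C (2 + κ)) D x₀ ⟩
      ((4 + s) C (2 + κ)) * x₀ * D ∎)
      where
      open ≡-Reasoning
      shuffle : ∀ a b c → a * b * c ≡ a * c * b
      shuffle = solve-∀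
      reorder : ∀ κ ν x → x * x * ((κ + ν + 1) * (κ + ν + 2) * (κ + ν + 4)) * (3 + (κ + ν))
        ≡ (4 + (κ + ν)) * (3 + (κ + ν)) * ((2 + (κ + ν)) * (1 + (κ + ν)) * x) * x
      reorder = solve-∀

    #class≤narayana : #class κ ν * suc (2 * m) ≤ narayanaNum 1 (2 * m) m
    #class≤narayana = begin
      #class κ ν * suc (2 * m)       ≡⟨ cong (λ x → #class κ ν * suc x) (sym eq) ⟩
      #class κ ν * (3 + (κ + ν))   ≡⟨ #class-formula ⟩
      ((4 + (κ + ν)) C (2 + κ)) * ((κ + ν) C κ)
        ≤⟨ *-mono-≤ (≤-trans (≤-reflexive (cong (_C (2 + κ)) four))
                      (C-central-max (2 + κ) (2 + ν) (suc m) (trans (sym four) upper)))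
                    (C-central-max κ ν (pred m) lower) ⟩
      ((suc m + suc m) C suc m) * ((pred m + pred m) C pred m)
        ≡⟨ cong₂ (λ x y → x * (y C pred m)) middle (trans (sym lower) n-2) ⟩
      narayanaNum 1 (2 * m) m ∎
      where
      open ≤-Reasoning
      m+m : 2 + (κ + ν) ≡ m + m
      m+m = trans eq (cong (m +_) (+-identityʳ m))
      four : 4 + (κ + ν) ≡ 2 + κ + (2 + ν)
      four = rearrange κ ν
        where
        rearrange : ∀ a b → 4 + (a + b) ≡ 2 + a + (2 + b)
        rearrange = solve-∀
      upper : 4 + (κ + ν) ≡ suc m + suc m
      upper = trans (cong (2 +_) m+m) (cong suc (sym (+-suc m m)))
      n-2 : κ + ν ≡ 2 * m ∸ 1 ∸ 1
      n-2 = cong (λ x → x ∸ 1 ∸ 1) eq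
      lower : κ + ν ≡ pred m + pred m
      lower = halve m m+m
        where
        halve : ∀ m → 2 + (κ + ν) ≡ m + m → κ + ν ≡ pred m + pred m
        halve (suc m) p = suc-injective (trans (suc-injective p) (+-suc m m))
      -- The central binomial is the sum of two equal neighbours in the row above; the resulting 2
      -- is the factor r + 1 of N_r for r = 1.
      middle : (suc m + suc m) C suc m ≡ 2 * (suc (2 * m) C m)
      middle = begin-equality
        (suc m + suc m) C suc m
          ≡⟨ cong (_C suc m) (cong suc (+-suc m m)) ⟩
        (2 + (m + m)) C suc m
          ≡⟨ sym (nCk+nC[k+1]≡[n+1]C[k+1] (suc (m + m)) m) ⟩
        (suc (m + m) C m) + (suc (m + m) C suc m)
          ≡⟨ cong ((suc (m + m) C m) +_) (C-symmetric (suc m) m) ⟩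
        (suc (m + m) C m) + (suc (m + m) C m)
          ≡⟨ cong (λ x → x + x) (cong (λ x → suc (m + x) C m) (sym (+-identityʳ m))) ⟩
        (suc (2 * m) C m) + (suc (2 * m) C m)
          ≡⟨ cong ((suc (2 * m) C m) +_) (sym (+-identityʳ _)) ⟩
        2 * (suc (2 * m) C m) ∎

-- Families of trees with constant invariant

bit : Bool → ℕ
bit true  = 1
bit false = 0

0<size⇒0<evens : ∀ t → 0 < size t → 0 < evens t
0<size⇒0<evens (node l r) _ = s≤s z≤n

module ClassBound (m : ℕ) (0<m : 0 < m) where
  open Centre m 0<m
  open Count m 0<m
  open ClassSize m 0<m

  private
    class : ℕ → ℕ → List Tree
    class κ ν = shorts (2 + κ) ν ++ longs (1 + κ) (1 + ν)

    split-size : ∀ {e o} → e + o ≡ 2 * m → 2 ≤ e → ∃ λ κ → ∃ λ ν → 2 + (κ + ν) ≡ 2 * m × e ≡ 2 + κ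
    split-size {suc (suc κ)} {ν} eq _ = κ , ν , eq , refl
    split-size {suc zero} _ (s≤s ())

    -- The extreme values do not occur. Beside a short first edge the right subtree is nonempty and
    -- adds a second even edge; below a long one the left subtree adds an odd edge.
    level : ∀ t → size t ≡ 2 * m →
            ∃ λ κ → ∃ λ ν → 2 + (κ + ν) ≡ 2 * m × evens t + bit (firstLong t) ≡ 2 + κ
    level leaf eq = contradiction (trans eq (cong (m +_) (+-identityʳ m))) (<⇒≢ (≤-trans 0<m (m≤m+n m m)))
    level t@(node l r) eq with long l in ll
    ... | false with split-size {evens t} {odds t} (trans (evens+odds≡size t) eq)
                       (s≤s (≤-trans (0<size⇒0<evens r 0<r) (m≤n+m (evens r) (odds l))))
      where
      m≤r : m ≤ size r
      m≤r = +-cancelˡ-≤ m m (size r) (≤-trans (≤-reflexive (trans (cong (m +_) (sym (+-identityʳ m))) (sym eq)))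
              (+-monoˡ-≤ (size r) (¬long⁻ l ll)))
      0<r = ≤-trans 0<m m≤r
    ...   | κ , ν , p , q = κ , ν , p , trans (+-identityʳ _) q
    level t@(node l r) eq | true with odds t in o
    ... | zero = contradiction o (m<n⇒n≢0 (≤-trans (0<size⇒0<evens l (≤-trans 0<m (long⁻ l ll))) (m≤m+n (evens l) (odds r))))
    ... | suc o' with split-size {evens t + 1} {o'} (trans (+-assoc (evens t) 1 o')
                        (trans (cong (evens t +_) (sym o)) (trans (evens+odds≡size t) eq)))
                        (≤-trans (s≤s (m≤n+m 1 (odds l + evens r))) ≤-refl)
    ...   | κ , ν , p , q = κ , ν , p , q

    ∈-class : ∀ κ ν t → 2 + (κ + ν) ≡ 2 * m → size t ≡ 2 * m →
              evens t + bit (firstLong t) ≡ 2 + κ → t ∈ class κ ν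
    ∈-class κ ν t eq sz lv with firstLong t in f
    ... | false = ∈-++⁺ˡ (∈-filter⁺ (λ t → firstLong t Bool.≟ false) (∈-trees⁺ t ev
                    (+-cancelˡ-≡ (2 + κ) _ _ (trans (cong (_+ odds t) (sym ev))
                      (trans (evens+odds≡size t) (trans sz (sym eq)))))) f)
      where ev = trans (sym (+-identityʳ (evens t))) lv
    ... | true  = ∈-++⁺ʳ (shorts (2 + κ) ν) (∈-filter⁺ (λ t → firstLong t Bool.≟ true) (∈-trees⁺ t ev
                    (+-cancelˡ-≡ (1 + κ) _ _ (trans (cong (_+ odds t) (sym ev))
                      (trans (evens+odds≡size t) (trans sz (trans (sym eq) (sym (cong suc (+-suc κ ν))))))))) f)
      where ev = suc-injective (trans (+-comm 1 (evens t)) lv)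

    module Exchange {k} (t : Fin k → Tree) (sz : ∀ i → size (t i) ≡ 2 * m) where
      t' : Fin k → Tree
      t' i = exchange (2 * m) (t i)

      module E i = Exchanged (exchange-correct (2 * m) (t i) (≤-reflexive (sz i)) (≤-reflexive (sz i)))

      sz' : ∀ i → size (t' i) ≡ 2 * m
      sz' i = trans (E.sz i) (sz i)

  -- The exchange is injective, keeps `evens` and turns the bit of the centre into the bit of the
  -- first edge, so it carries the whole family into a single exchanged class.
  family≤narayana : ∀ k (t : Fin k → Tree) → (∀ {i j} → t i ≡ t j → i ≡ j) →
    (∀ i → size (t i) ≡ 2 * m) →
    (∀ i j → evens (t i) + bit (centreOdd (t i)) ≡ evens (t j) + bit (centreOdd (t j))) →
    k * suc (2 * m) ≤ narayanaNum 1 (2 * m) m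
  family≤narayana zero    t inj sz inv = z≤n
  family≤narayana (suc k) t inj sz inv with level (t' Fin.zero) (sz' Fin.zero)
    where open Exchange t sz
  ... | κ , ν , eq , lv = ≤-trans (*-monoˡ-≤ (suc (2 * m)) k≤class) (#class≤narayana κ ν eq)
    where
    open Exchange t sz
    lv' : ∀ i → evens (t' i) + bit (firstLong (t' i)) ≡ 2 + κ
    lv' i = trans (trans (cong₂ (λ x y → x + bit y) (E.even i) (E.first i)) (trans (inv i Fin.zero)
      (sym (cong₂ (λ x y → x + bit y) (E.even Fin.zero) (E.first Fin.zero))))) lv
    k≤class : suc k ≤ #class κ ν
    k≤class = ≤-trans (injection⇒≤length (suc k) (class κ ν) t'
        (λ {i} {j} e → inj (trans (sym (E.invol i)) (trans (cong (exchange (2 * m)) e) (E.invol j))))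
        (λ i → ∈-class κ ν (t' i) eq (sz' i) (lv' i)))
      (≤-reflexive (length-++ (shorts (2 + κ) ν)))

-- Matchings as trees

sumFrom : ℕ → ℕ → (ℕ → ℕ) → ℕ
sumFrom a zero    f = 0
sumFrom a (suc k) f = f a + sumFrom (suc a) k f

sumFrom-split : ∀ a j k f → sumFrom a (j + k) f ≡ sumFrom a j f + sumFrom (a + j) k f
sumFrom-split a zero    k f = cong (λ x → sumFrom x k f) (sym (+-identityʳ a))
sumFrom-split a (suc j) k f = trans (cong (f a +_) (trans (sumFrom-split (suc a) j k f)
  (cong (λ x → sumFrom (suc a) j f + sumFrom x k f) (sym (+-suc a j))))) (sym (+-assoc (f a) _ _))

isEven : ℕ → Bool
isEven zero    = true
isEven (suc n) = not (isEven n)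

width : Tree → ℕ
width leaf       = 0
width (node l r) = 2 + (width l + width r)

width≡2*size : ∀ t → width t ≡ 2 * size t
width≡2*size leaf       = refl
width≡2*size (node l r) = trans (cong (2 +_) (cong₂ _+_ (width≡2*size l) (width≡2*size r)))
  (double (size l) (size r))
  where
  double : ∀ a b → 2 + (2 * a + 2 * b) ≡ 2 * suc (a + b)
  double = solve-∀

isEven-+width : ∀ a t → isEven (a + width t) ≡ isEven a
isEven-+width a leaf       = cong isEven (+-identityʳ a)
isEven-+width a (node l r) rewrite +-suc a (suc (width l + width r)) | +-suc a (width l + width r)
  | sym (+-assoc a (width l) (width r)) =
  trans (not-involutive _) (trans (isEven-+width (a + width l) r) (isEven-+width a l))

-- On the points a, …, a + width t - 1, f is the matching encoded by t.
Encodes : (ℕ → ℕ) → ℕ → Tree → Set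
Encodes f a leaf       = ⊤
Encodes f a (node l r) =
  f a ≡ suc a + width l × f (suc a + width l) ≡ a ×
  Encodes f (suc a) l × Encodes f (2 + a + width l) r

Inside : ℕ → ℕ → ℕ → Set
Inside a w x = a ≤ x × x < a + w

¬Inside-0 : ∀ {a x} → ¬ Inside a 0 x
¬Inside-0 (p , q) = <-irrefl refl (≤-trans q (≤-trans (≤-reflexive (+-identityʳ _)) p))

data Position (a : ℕ) (l r : Tree) (x : ℕ) : Set where
  start : x ≡ a → Position a l r x
  left  : Inside (suc a) (width l) x → Position a l r x
  end   : x ≡ suc a + width l → Position a l r x
  right : Inside (2 + a + width l) (width r) x → Position a l r x

width-sum : ∀ a l r → a + width (node l r) ≡ 2 + a + width l + width r
width-sum a l r = shuffle a (width l) (width r)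
  where
  shuffle : ∀ a b c → a + (2 + (b + c)) ≡ 2 + a + b + c
  shuffle = solve-∀

position : ∀ a l r x → Inside a (width (node l r)) x → Position a l r x
position a l r x (a≤x , x<) with <-cmp x (suc a + width l)
... | tri≈ _ e _ = end e
... | tri> _ _ p = right (p , subst (x <_) (width-sum a l r) x<)
... | tri< p _ _ with m≤n⇒m<n∨m≡n a≤x
...   | inj₁ q = left (q , p)
...   | inj₂ e = start (sym e)

left⊆ : ∀ {a} l r {x} → Inside (suc a) (width l) x → Inside a (width (node l r)) x
left⊆ {a} l r (p , q) = <⇒≤ p , <-≤-trans q (≤-trans (n≤1+n _)
  (≤-trans (m≤m+n _ (width r)) (≤-reflexive (sym (width-sum a l r)))))

right⊆ : ∀ {a} l r {x} → Inside (2 + a + width l) (width r) x → Inside a (width (node l r)) x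
right⊆ {a} l r {x} (p , q) = ≤-trans (≤-trans (m≤n+m a 2) (m≤m+n (2 + a) (width l))) p ,
  subst (x <_) (sym (width-sum a l r)) q

start∈ : ∀ {a} l r → Inside a (width (node l r)) a
start∈ {a} l r = ≤-refl , m<m+n a z<s

end∈ : ∀ {a} l r → Inside a (width (node l r)) (suc a + width l)
end∈ {a} l r = ≤-trans (n≤1+n a) (m≤m+n (suc a) (width l)) ,
  ≤-trans (m≤m+n (2 + a + width l) (width r)) (≤-reflexive (sym (width-sum a l r)))

module _ {f : ℕ → ℕ} where

  encodes-closed : ∀ {a} t → Encodes f a t → ∀ {x} → Inside a (width t) x → Inside a (width t) (f x)
  encodes-closed leaf _ x∈ = ⊥-elim (¬Inside-0 x∈)
  encodes-closed {a} (node l r) (p , q , el , er) {x} x∈ with position a l r x x∈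
  ... | start refl = subst (Inside a _) (sym p) (end∈ l r)
  ... | left x∈l   = left⊆ l r (encodes-closed l el x∈l)
  ... | end refl   = subst (Inside a _) (sym q) (start∈ l r)
  ... | right x∈r  = right⊆ l r (encodes-closed r er x∈r)

  encodes-involutive : ∀ {a} t → Encodes f a t → ∀ {x} → Inside a (width t) x → f (f x) ≡ x
  encodes-involutive leaf _ x∈ = ⊥-elim (¬Inside-0 x∈)
  encodes-involutive {a} (node l r) (p , q , el , er) {x} x∈ with position a l r x x∈
  ... | start refl = trans (cong f p) q
  ... | left x∈l   = encodes-involutive l el x∈l
  ... | end refl   = trans (cong f q) p
  ... | right x∈r  = encodes-involutive r er x∈r

  encodes-parity : ∀ {a} t → Encodes f a t → ∀ {x} → Inside a (width t) x → isEven (f x) ≡ not (isEven x)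
  encodes-parity leaf _ x∈ = ⊥-elim (¬Inside-0 x∈)
  encodes-parity {a} (node l r) (p , q , el , er) {x} x∈ with position a l r x x∈
  ... | start refl = trans (cong isEven p) (isEven-+width (suc a) l)
  ... | left x∈l   = encodes-parity l el x∈l
  ... | end refl   = trans (cong isEven q) (sym (trans (not-involutive _) (isEven-+width a l)))
  ... | right x∈r  = encodes-parity r er x∈r

  encodes-noncrossing : ∀ {a} t → Encodes f a t → ∀ {x y} → Inside a (width t) x → Inside a (width t) y →
                        x < y → y < f x → ¬ f x < f y
  encodes-noncrossing leaf _ x∈ _ _ _ _ = ¬Inside-0 x∈
  encodes-noncrossing {a} (node l r) (p , q , el , er) {x} {y} x∈ y∈ x<y y<fx fx<fy
    with position a l r x x∈ | position a l r y y∈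
  ... | end refl   | _ = <-asym x<y (<-≤-trans (subst (y <_) q y<fx) (≤-trans (n≤1+n a) (m≤m+n (suc a) (width l))))
  ... | left x∈l   | left y∈l = encodes-noncrossing l el x∈l y∈l x<y y<fx fx<fy
  ... | right x∈r  | right y∈r = encodes-noncrossing r er x∈r y∈r x<y y<fx fx<fy
  ... | left x∈l   | start refl = <-asym x<y (proj₁ x∈l)
  ... | left x∈l   | end refl = <-asym y<fx (proj₂ (encodes-closed l el x∈l))
  ... | left x∈l   | right y∈r = <-asym y<fx (<-trans (proj₂ (encodes-closed l el x∈l)) (proj₁ y∈r))
  ... | right x∈r  | start refl = <-asym x<y (<-≤-trans (s≤s (m≤m+n a (suc (width l)))) (≤-trans (≤-reflexive (cong suc (+-suc a (width l)))) (proj₁ x∈r)))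
  ... | right x∈r  | left y∈l = <-asym x<y (<-trans (proj₂ y∈l) (proj₁ x∈r))
  ... | right x∈r  | end refl = <-asym x<y (proj₁ x∈r)
  ... | start refl | start refl = <-irrefl refl x<y
  ... | start refl | left y∈l = <-asym (subst (_< f y) p fx<fy) (proj₂ (encodes-closed l el y∈l))
  ... | start refl | end refl = <-irrefl (sym p) y<fx
  ... | start refl | right y∈r = <-asym (subst (y <_) p y<fx) (proj₁ y∈r)

encodes-unique : ∀ {f g} {a} t → Encodes f a t → Encodes g a t → ∀ {x} → Inside a (width t) x → f x ≡ g x
encodes-unique leaf _ _ x∈ = ⊥-elim (¬Inside-0 x∈)
encodes-unique {a = a} (node l r) (p , q , el , er) (p' , q' , el' , er') {x} x∈ with position a l r x x∈
... | start refl = trans p (sym p')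
... | left x∈l   = encodes-unique l el el' x∈l
... | end refl   = trans q (sym q')
... | right x∈r  = encodes-unique r er er' x∈r

encodes-cong : ∀ {f g} {a} t → (∀ {x} → Inside a (width t) x → f x ≡ g x) → Encodes f a t → Encodes g a t
encodes-cong leaf _ _ = tt
encodes-cong {a = a} (node l r) f≗g (p , q , el , er) =
  trans (sym (f≗g (start∈ l r))) p , trans (sym (f≗g (end∈ l r))) q ,
  encodes-cong l (λ x∈ → f≗g (left⊆ l r x∈)) el , encodes-cong r (λ x∈ → f≗g (right⊆ l r x∈)) er

-- Matchings from trees, and the possible edges

decode : Tree → ℕ → ℕ → ℕ
decode leaf       a x = x
decode (node l r) a x with <-cmp x (suc a + width l)
... | tri≈ _ _ _ = a
... | tri> _ _ _ = decode r (2 + a + width l) x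
... | tri< _ _ _ with x ≟ a
...   | yes _ = suc a + width l
...   | no  _ = decode l (suc a) x

encodes-decode : ∀ a t → Encodes (decode t a) a t
encodes-decode a leaf       = tt
encodes-decode a (node l r) = first , last , encodes-cong l inˡ (encodes-decode (suc a) l) ,
  encodes-cong r inʳ (encodes-decode (2 + a + width l) r)
  where
  first : decode (node l r) a a ≡ suc a + width l
  first with <-cmp a (suc a + width l)
  ... | tri≈ a≮ _ _ = contradiction (s≤s (m≤m+n a (width l))) a≮
  ... | tri> a≮ _ _ = contradiction (s≤s (m≤m+n a (width l))) a≮
  ... | tri< _ _ _ with a ≟ a
  ...   | yes _ = refl
  ...   | no ¬p = contradiction refl ¬p
  last : decode (node l r) a (suc a + width l) ≡ a
  last with <-cmp (suc a + width l) (suc a + width l)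
  ... | tri≈ _ _ _ = refl
  ... | tri> _ ¬p _ = contradiction refl ¬p
  ... | tri< _ ¬p _ = contradiction refl ¬p
  inˡ : ∀ {x} → Inside (suc a) (width l) x → decode l (suc a) x ≡ decode (node l r) a x
  inˡ {x} (p , q) with <-cmp x (suc a + width l)
  ... | tri≈ ¬q _ _ = contradiction q ¬q
  ... | tri> ¬q _ _ = contradiction q ¬q
  ... | tri< _ _ _ with x ≟ a
  ...   | yes refl = contradiction p (<-irrefl refl)
  ...   | no _ = refl
  inʳ : ∀ {x} → Inside (2 + a + width l) (width r) x → decode r (2 + a + width l) x ≡ decode (node l r) a x
  inʳ {x} (p , q) with <-cmp x (suc a + width l)
  ... | tri≈ _ _ ¬p = contradiction p ¬p
  ... | tri> _ _ _ = refl
  ... | tri< _ _ ¬p = contradiction p ¬p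

isEven-≢ : ∀ {x y} → isEven y ≡ not (isEven x) → y ≢ x
isEven-≢ {x} e refl with isEven x
... | true with () ← e
... | false with () ← e

treeMatching : ∀ n t → width t ≡ 2 * n → Matching n
treeMatching n t w = record
  { partner       = λ i → fromℕ< (bound i)
  ; involutive    = λ i → toℕ-injective (trans (toℕ-fromℕ< _) (trans (cong f (toℕ-fromℕ< (bound i)))
                      (encodes-involutive t enc (inside i))))
  ; fixpoint-free = λ i eq → isEven-≢ (encodes-parity t enc (inside i)) (trans (sym (toℕ-fromℕ< (bound i))) (cong toℕ eq))
  ; noncrossing   = λ { a b c d a<c c<b b<d refl refl → encodes-noncrossing t enc (inside a) (inside c) a<c
                      (subst (toℕ c <_) (toℕ-fromℕ< (bound a)) c<b)
                      (subst₂ _<_ (toℕ-fromℕ< (bound a)) (toℕ-fromℕ< (bound c)) b<d) }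
  }
  where
  f = decode t 0
  enc = encodes-decode 0 t
  inside : ∀ (i : Point n) → Inside 0 (width t) (toℕ i)
  inside i = z≤n , subst (toℕ i <_) (sym w) (toℕ<n i)
  bound : ∀ i → f (toℕ i) < 2 * n
  bound i = subst (f (toℕ i) <_) w (proj₂ (encodes-closed t enc (inside i)))

-- Edges between neighbouring points, used to fill the space before and below a prescribed edge, and
-- the space after it.
hair : ℕ → Tree → Tree
hair zero    t = t
hair (suc k) t = node leaf (hair k t)

width-hair : ∀ k t → width (hair k t) ≡ 2 * k + width t
width-hair k t = trans (width≡2*size (hair k t)) (trans (cong (2 *_) (size-hair k)) 
  (trans (*-distribˡ-+ 2 k (size t)) (cong (2 * k +_) (sym (width≡2*size t)))))
  where
  size-hair : ∀ k → size (hair k t) ≡ k + size t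
  size-hair zero    = refl
  size-hair (suc k) = cong suc (size-hair k)

encodes-hair : ∀ {f} {a} k t → Encodes f a (hair k t) → Encodes f (2 * k + a) t
encodes-hair zero t e = e
encodes-hair {f} {a} (suc k) t (_ , _ , _ , e) = subst (λ x → Encodes f x t) (shift k a) (encodes-hair k t e)
  where
  shift : ∀ k a → 2 * k + (2 + a + 0) ≡ 2 * suc k + a
  shift = solve-∀

possible-even : ∀ n x y j i k → x ≡ 2 * j → y ≡ suc x + 2 * i → j + suc (i + k) ≡ n →
  ∃ λ t → width t ≡ 2 * n × decode t 0 x ≡ y
possible-even n x y j i k refl refl refl = t , wt ,
  trans (cong (decode t 0) (sym (+-identityʳ _)))
    (trans (proj₁ (encodes-hair j _ (encodes-decode 0 t)))
      (cong₂ (λ u v → suc u + v) (+-identityʳ (2 * j)) (trans (width-hair i leaf) (+-identityʳ _))))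
  where
  t = hair j (node (hair i leaf) (hair k leaf))
  wt : width t ≡ 2 * (j + suc (i + k))
  wt = trans (width-hair j _) (trans (cong (λ z → 2 * j + (2 + z)) (cong₂ _+_ (width-hair i leaf) (width-hair k leaf)))
         (shuffle j i k))
    where
    shuffle : ∀ j i k → 2 * j + (2 + (2 * i + 0 + (2 * k + 0))) ≡ 2 * (j + suc (i + k))
    shuffle = solve-∀

possible-odd : ∀ n x y j i k → x ≡ suc (2 * j) → y ≡ suc x + 2 * i → suc (j + suc (i + k)) ≡ n →
  ∃ λ t → width t ≡ 2 * n × decode t 0 x ≡ y
possible-odd n x y j i k refl refl refl = t , wt ,
  trans (cong (decode t 0) (+-comm 1 (2 * j)))
    (trans (proj₁ (encodes-hair j _ (proj₁ (proj₂ (proj₂ (encodes-decode 0 t))))))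
      (cong₂ (λ u v → suc u + v) (+-comm (2 * j) 1) (trans (width-hair i leaf) (+-identityʳ _))))
  where
  inner = hair j (node (hair i leaf) (hair k leaf))
  -- Top-level edges start at even points. An odd left end therefore needs an enclosing edge, here
  -- from the first point to the last.
  t = node inner leaf
  wt : width t ≡ 2 * suc (j + suc (i + k))
  wt = trans (cong (λ z → 2 + (z + 0)) (trans (width-hair j _)
         (cong (λ z → 2 * j + (2 + z)) (cong₂ _+_ (width-hair i leaf) (width-hair k leaf)))))
         (shuffle j i k)
    where
    shuffle : ∀ j i k → 2 + (2 * j + (2 + (2 * i + 0 + (2 * k + 0))) + 0) ≡ 2 * suc (j + suc (i + k))
    shuffle = solve-∀

halves : ∀ x → ∃ λ j → (x ≡ 2 * j × isEven x ≡ true) ⊎ (x ≡ suc (2 * j) × isEven x ≡ false)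
halves zero = 0 , inj₁ (refl , refl)
halves (suc x) with halves x
... | j , inj₁ (p , q) = j , inj₂ (cong suc p , cong not q)
... | j , inj₂ (p , q) = suc j , inj₁ (trans (cong suc p) (sym (trans (*-suc 2 j) refl)) , cong not q)

isEven-2* : ∀ k → isEven (2 * k) ≡ true
isEven-2* k with halves (2 * k)
... | j , inj₁ (_ , e) = e
... | j , inj₂ (p , _) = contradiction p (even≢odd k j)

isEven-+ : ∀ x d → isEven (x + d) ≡ (if isEven d then isEven x else not (isEven x))
isEven-+ x zero    = cong isEven (+-identityʳ x)
isEven-+ x (suc d) rewrite +-suc x d | isEven-+ x d with isEven d
... | true  = refl
... | false = not-involutive (isEven x)

possible-tree : ∀ n x y → x < y → y < 2 * n → isEven y ≡ not (isEven x) →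
  ∃ λ t → width t ≡ 2 * n × decode t 0 x ≡ y
possible-tree n x y x<y y<2n par with m≤n⇒∃[o]m+o≡n x<y
... | d , refl with halves d
...   | i , inj₂ (refl , e) = ⊥-elim (isEven-≢ {x} {x} (trans (sym (trans (isEven-+ (suc x) d) (odd-step e))) par) refl)
  where
  odd-step : isEven d ≡ false → (if isEven d then not (isEven x) else not (not (isEven x))) ≡ isEven x
  odd-step e rewrite e = not-involutive (isEven x)
...   | i , inj₁ (refl , _) with halves x
...     | j , inj₁ (refl , _) with m≤n⇒∃[o]m+o≡n {j + suc i} {n} (*-cancelˡ-≤ 2 (≤-trans (≤-reflexive (shuffle j i)) y<2n))
  where
  shuffle : ∀ j i → 2 * (j + suc i) ≡ suc (suc (2 * j) + 2 * i)
  shuffle = solve-∀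
...       | k , e = possible-even n x y j i k refl refl (trans (sym (+-assoc j (suc i) k)) e)
possible-tree n x y x<y y<2n par | d , refl | i , inj₁ (refl , _) | j , inj₂ (refl , _)
  with m≤n⇒∃[o]m+o≡n {suc (j + suc i)} {n} (*-cancelˡ-< 2 _ _ (≤-trans (≤-reflexive (shuffle j i)) y<2n))
  where
  shuffle : ∀ j i → suc (2 * (j + suc i)) ≡ suc (suc (suc (2 * j)) + 2 * i)
  shuffle = solve-∀
... | k , e = possible-odd n x y j i k refl refl (trans (cong suc (sym (+-assoc j (suc i) k))) e)

-- Makes the rainbow condition available for every pair at odd distance, so that sums over possible
-- edges become sums over such pairs.
odd⇒possible : ∀ {n} (x y : Point n) → toℕ x < toℕ y → isEven (toℕ y) ≡ not (isEven (toℕ x)) → PossibleEdge n x y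
odd⇒possible {n} x y x<y par with possible-tree n (toℕ x) (toℕ y) x<y (toℕ<n y) par
... | t , w , e = treeMatching n t w , toℕ-injective (trans (toℕ-fromℕ< _) e)

-- Trees from matchings

extend : ∀ {n} → Matching n → ℕ → ℕ
extend {n} M x with x <? 2 * n
... | yes p = toℕ (partner M (fromℕ< p))
... | no  _ = x

extend-toℕ : ∀ {n} (M : Matching n) i → extend M (toℕ i) ≡ toℕ (partner M i)
extend-toℕ {n} M i with toℕ i <? 2 * n
... | yes p = cong (λ j → toℕ (partner M j)) (fromℕ<-toℕ i p)
... | no ¬p = contradiction (toℕ<n i) ¬p

extend-point : ∀ {n} (M : Matching n) {x} (p : x < 2 * n) → extend M x ≡ toℕ (partner M (fromℕ< p))
extend-point M p = trans (cong (extend M) (sym (toℕ-fromℕ< p))) (extend-toℕ M (fromℕ< p))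

module _ {n} (M : Matching n) where
  private f = extend M

  extend-< : ∀ {x} → x < 2 * n → f x < 2 * n
  extend-< {x} p = subst (_< 2 * n) (sym (extend-point M p)) (toℕ<n _)

  extend-involutive : ∀ {x} → x < 2 * n → f (f x) ≡ x
  extend-involutive {x} p = trans (cong f (extend-point M p)) (trans (extend-toℕ M _)
    (trans (cong toℕ (involutive M (fromℕ< p))) (toℕ-fromℕ< p)))

  extend-≢ : ∀ {x} → x < 2 * n → f x ≢ x
  extend-≢ {x} p eq = fixpoint-free M (fromℕ< p)
    (toℕ-injective (trans (sym (extend-point M p)) (trans eq (sym (toℕ-fromℕ< p)))))

  extend-noncrossing : ∀ {x y} → x < 2 * n → y < 2 * n → x < y → y < f x → ¬ f x < f y
  extend-noncrossing {x} {y} p q x<y y<fx fx<fy = noncrossing M (fromℕ< p) _ (fromℕ< q) _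
    (subst₂ _<_ (sym (toℕ-fromℕ< p)) (sym (toℕ-fromℕ< q)) x<y)
    (subst₂ _<_ (sym (toℕ-fromℕ< q)) (extend-point M p) y<fx)
    (subst₂ _<_ (extend-point M p) (extend-point M q) fx<fy) refl refl

  -- Recursion with fuel `k`: the edge of the first point cuts an interval closed under `f` into the
  -- points below the edge and those after it, and by non-crossing both parts are closed again.
  encode-interval : ∀ k w a → w ≤ k → a + w ≤ 2 * n →
    (∀ {x} → Inside a w x → Inside a w (f x)) → ∃ λ t → width t ≡ w × Encodes f a t
  encode-interval k zero a _ _ _ = leaf , refl , tt
  encode-interval (suc k) (suc w) a (s≤s w≤k) a+w≤ closed
    with closed {a} (≤-refl , m<m+n a z<s)
  ... | a≤fa , fa< with m≤n⇒∃[o]m+o≡n (≤∧≢⇒< a≤fa (λ e → extend-≢ (≤-trans (m<m+n a z<s) a+w≤) (sym e)))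
  ...   | d , d-eq with m≤n⇒∃[o]m+o≡n {2 + a + d} {a + suc w} (subst (_< a + suc w) (sym d-eq) fa<)
  ...     | e , e-eq with encode-interval k d (suc a) d≤k d-bound closedˡ
                        | encode-interval k e (2 + a + d) e≤k (≤-trans (≤-reflexive e-eq) a+w≤) closedʳ
    where
    fa = suc a + d
    <2n : ∀ {x} → x < a + suc w → x < 2 * n
    <2n p = ≤-trans p a+w≤
    w-eq : w ≡ suc (d + e)
    w-eq = suc-injective (+-cancelˡ-≡ a _ _ (trans (sym e-eq) (shuffle a d e)))
      where
      shuffle : ∀ a d e → 2 + a + d + e ≡ a + suc (suc (d + e))
      shuffle = solve-∀
    d≤k = ≤-trans (≤-trans (≤-trans (m≤m+n d e) (n≤1+n _)) (≤-reflexive (sym w-eq))) w≤k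
    e≤k = ≤-trans (≤-trans (≤-trans (m≤n+m e d) (n≤1+n _)) (≤-reflexive (sym w-eq))) w≤k
    fa<end : fa < a + suc w
    fa<end = subst (_< a + suc w) (sym d-eq) fa<
    d-bound = ≤-trans (<⇒≤ fa<end) a+w≤
    a< : a < a + suc w
    a< = m<m+n a z<s
    ffa : f fa ≡ a
    ffa = trans (cong f d-eq) (extend-involutive (<2n a<))
    closedˡ : ∀ {x} → Inside (suc a) d x → Inside (suc a) d (f x)
    closedˡ {x} (a<x , x<fa) with closed {x} (<⇒≤ a<x , <-trans x<fa fa<end)
    -- A partner beyond `fa` would make the edge of `x` cross that of `a`; the partners `a` and `fa`
    -- themselves are taken by each other.
    ... | a≤fx , fx< = ≤∧≢⇒< a≤fx (λ eq → <⇒≢ x<fa (trans (sym (extend-involutive x<2n)) (trans (cong f (sym eq)) (sym d-eq)))) ,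
      ≤∧≢⇒< (≮⇒≥ λ fa<fx → extend-noncrossing (<2n a<) x<2n a<x (subst (x <_) d-eq x<fa) (subst (_< f x) d-eq fa<fx))
        (λ eq → <⇒≢ a<x (trans (sym ffa) (trans (cong f (sym eq)) (extend-involutive x<2n))))
      where x<2n = <2n (<-trans x<fa fa<end)
    closedʳ : ∀ {x} → Inside (2 + a + d) e x → Inside (2 + a + d) e (f x)
    closedʳ {x} (fa<x , x<) with closed {x} (≤-trans (≤-trans (≤-trans (n≤1+n a) (m≤m+n (suc a) d)) (n≤1+n _)) fa<x , x<end)
      where x<end = subst (x <_) e-eq x<
    ... | a≤fx , fx< = fa<fx , subst (f x <_) (sym e-eq) fx<
      where
      x<2n = <2n (subst (x <_) e-eq x<)
      fa<fx : fa < f x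
      fa<fx with <-cmp (f x) fa
      ... | tri> _ _ p = p
      ... | tri≈ _ eq _ = ⊥-elim (<⇒≱ fa<x (≤-trans (≤-reflexive (trans (sym (extend-involutive x<2n)) (trans (cong f eq) ffa)))
                            (≤-trans (n≤1+n a) (m≤m+n (suc a) d))))
      ... | tri< p _ _ with m≤n⇒m<n∨m≡n a≤fx
      ...   | inj₂ eq = ⊥-elim (<⇒≢ fa<x (trans d-eq (trans (cong f eq) (extend-involutive x<2n))))
      -- A partner below the first edge is excluded since that part is closed and `f` would lead
      -- back to `x` inside it.
      ...   | inj₁ q = ⊥-elim (<-asym fa<x (subst (_< fa) (extend-involutive x<2n) (proj₂ (closedˡ (q , p)))))
  ...       | l , refl , el | r , refl , er = node l r , width-eq , sym d-eq , ffa , el , er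
    where
    width-eq : 2 + (width l + width r) ≡ suc w
    width-eq = +-cancelˡ-≡ a _ _ (trans (width-sum a l r) e-eq)
    ffa : f (suc a + width l) ≡ a
    ffa = trans (cong f d-eq) (extend-involutive (≤-trans (m<m+n a z<s) a+w≤))

  encode : ∃ λ t → width t ≡ 2 * n × Encodes f 0 t
  encode = encode-interval (2 * n) (2 * n) 0 ≤-refl ≤-refl λ (_ , p) → z≤n , extend-< p

code : ∀ {n} → Matching n → Tree
code M = proj₁ (encode M)

width-code : ∀ {n} (M : Matching n) → width (code M) ≡ 2 * n
width-code M = proj₁ (proj₂ (encode M))

encodes-code : ∀ {n} (M : Matching n) → Encodes (extend M) 0 (code M)
encodes-code M = proj₂ (proj₂ (encode M))

inside-code : ∀ {n} (M : Matching n) {x} → x < 2 * n → Inside 0 (width (code M)) x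
inside-code M {x} p = z≤n , subst (x <_) (sym (width-code M)) p

size-code : ∀ {n} (M : Matching n) → size (code M) ≡ n
size-code M = *-cancelˡ-≡ _ _ 2 (trans (sym (width≡2*size (code M))) (width-code M))

code-injective : ∀ {n} (M M' : Matching n) → code M ≡ code M' → SameMatching M M'
code-injective {n} M M' eq i = toℕ-injective (trans (sym (extend-toℕ M i)) (trans
  (encodes-unique (code M) (encodes-code M) (subst (Encodes (extend M') 0) (sym eq) (encodes-code M'))
    (inside-code M (toℕ<n i)))
  (extend-toℕ M' i)))

extend-parity : ∀ {n} (M : Matching n) {x} → x < 2 * n → isEven (extend M x) ≡ not (isEven x)
extend-parity M p = encodes-parity (code M) (encodes-code M) (inside-code M p)

-- The invariant as a sum over points

<ᵇ-true : ∀ {x y} → x < y → (x <ᵇ y) ≡ true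
<ᵇ-true {x} {y} p with x <ᵇ y in eq
... | true  = refl
... | false = ⊥-elim (subst T eq (<⇒<ᵇ p))

<ᵇ-false : ∀ {x y} → y ≤ x → (x <ᵇ y) ≡ false
<ᵇ-false {x} {y} p with x <ᵇ y in eq
... | false = refl
... | true  = contradiction (<ᵇ⇒< x y (subst T (sym eq) _)) (≤⇒≯ p)

module Weight (m : ℕ) (0<m : 0 < m) where
  open Centre m 0<m

  -- One more than the contribution of an edge to (number of edges starting
  -- at an even point) + (number of long ones among these) - (number of long
  -- edges starting at an odd point).
  edgeValue : Bool → Bool → ℕ
  edgeValue true  false = 2
  edgeValue true  true  = 3
  edgeValue false false = 1
  edgeValue false true  = 0

  weight : ℕ → ℕ → ℕ
  weight x y = if x <ᵇ y then edgeValue (isEven x) (2 * m <ᵇ y ∸ x) else 0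

  treeWeight : Bool → Tree → ℕ
  treeWeight e leaf       = 0
  treeWeight e (node l r) = edgeValue e (long l) + (treeWeight (not e) l + treeWeight e r)

  private
    subtree≤ˡ : ∀ l r → size (node l r) ≤ 2 * m → size l ≤ 2 * m
    subtree≤ˡ l r p = ≤-trans (m≤m+n (size l) (size r)) (<⇒≤ p)

    subtree≤ʳ : ∀ l r → size (node l r) ≤ 2 * m → size r ≤ 2 * m
    subtree≤ʳ l r p = ≤-trans (m≤n+m (size r) (size l)) (<⇒≤ p)

    rest-short : ∀ l r → long l ≡ true → size (node l r) ≤ 2 * m → size r < m
    rest-short l r ll p = +-cancelˡ-≤ m (suc (size r)) m (≤-trans (≤-reflexive (+-suc m (size r)))
      (≤-trans (s≤s (+-monoˡ-≤ (size r) (long⁻ l ll))) (≤-trans p (≤-reflexive (cong (m +_) (+-identityʳ m))))))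

  -- At most one subtree at each stage has room for a long edge, so the long edges are nested, and
  -- their left ends alternate in parity. Their alternating sum is thus 0 or 1; with an odd start
  -- its sign changes, which moves the bit to the other side. The summand `size t` is the shift by
  -- one per edge.
  treeWeight-even : ∀ t → size t ≤ 2 * m → treeWeight true t ≡ size t + evens t + bit (centreOdd t)
  treeWeight-odd  : ∀ t → size t ≤ 2 * m → treeWeight false t + bit (centreOdd t) ≡ size t + odds t
  treeWeight-even leaf _ = refl
  treeWeight-even (node l r) p with long l in ll
  ... | true with centreOdd l | treeWeight-odd l (subtree≤ˡ l r p)
                | centreOdd r | size≤m⇒¬centreOdd r (<⇒≤ (rest-short l r ll p)) | treeWeight-even r (subtree≤ʳ l r p)
  ...   | true  | ihl | false | refl | ihr = trans (split (treeWeight false l) (treeWeight true r))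
                                     (trans (cong₂ (λ u v → 2 + (u + v)) ihl ihr) (join (size l) (odds l) (size r) (evens r)))
    where
    split : ∀ a b → 3 + (a + b) ≡ 2 + (a + 1 + b)
    split = solve-∀
    join : ∀ a b c d → 2 + (a + b + (c + d + 0)) ≡ suc (a + c) + suc (b + d) + 0
    join = solve-∀
  ...   | false | ihl | false | refl | ihr = trans (split (treeWeight false l) (treeWeight true r))
                                     (trans (cong₂ (λ u v → 3 + (u + v)) ihl ihr) (join (size l) (odds l) (size r) (evens r)))
    where
    split : ∀ a b → 3 + (a + b) ≡ 3 + (a + 0 + b)
    split = solve-∀
    join : ∀ a b c d → 3 + (a + b + (c + d + 0)) ≡ suc (a + c) + suc (b + d) + 1
    join = solve-∀
  treeWeight-even (node l r) p | false
    with centreOdd l | size≤m⇒¬centreOdd l (<⇒≤ (¬long⁻ l ll)) | treeWeight-odd l (subtree≤ˡ l r p)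
  ... | false | refl | ihl = trans (split (treeWeight false l) (treeWeight true r))
            (trans (cong₂ (λ u v → 2 + (u + v)) ihl (treeWeight-even r (subtree≤ʳ l r p)))
              (join (size l) (odds l) (size r) (evens r) (bit (centreOdd r))))
    where
    split : ∀ a b → 2 + (a + b) ≡ 2 + (a + 0 + b)
    split = solve-∀
    join : ∀ a b c d e → 2 + (a + b + (c + d + e)) ≡ suc (a + c) + suc (b + d) + e
    join = solve-∀
  treeWeight-odd leaf _ = refl
  treeWeight-odd (node l r) p with long l in ll
  ... | true with centreOdd l | treeWeight-even l (subtree≤ˡ l r p)
                | centreOdd r | size≤m⇒¬centreOdd r (<⇒≤ (rest-short l r ll p)) | treeWeight-odd r (subtree≤ʳ l r p)
  ...   | true  | ihl | false | refl | ihr = trans (split (treeWeight true l) (treeWeight false r))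
            (trans (cong₂ _+_ ihl ihr) (join (size l) (evens l) (size r) (odds r)))
    where
    split : ∀ a b → a + b + 0 ≡ a + (b + 0)
    split = solve-∀
    join : ∀ a b c d → a + b + 1 + (c + d) ≡ suc (a + c) + (b + d)
    join = solve-∀
  ...   | false | ihl | false | refl | ihr = trans (split (treeWeight true l) (treeWeight false r))
            (trans (cong₂ (λ u v → 1 + (u + v)) ihl ihr) (join (size l) (evens l) (size r) (odds r)))
    where
    split : ∀ a b → a + b + 1 ≡ 1 + (a + (b + 0))
    split = solve-∀
    join : ∀ a b c d → 1 + (a + b + 0 + (c + d)) ≡ suc (a + c) + (b + d)
    join = solve-∀
  treeWeight-odd (node l r) p | false
    with centreOdd l | size≤m⇒¬centreOdd l (<⇒≤ (¬long⁻ l ll)) | treeWeight-even l (subtree≤ˡ l r p)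
  ... | false | refl | ihl = trans (split (treeWeight true l) (treeWeight false r) (bit (centreOdd r)))
            (trans (cong₂ (λ u v → 1 + (u + v)) ihl (treeWeight-odd r (subtree≤ʳ l r p)))
              (join (size l) (evens l) (size r) (odds r)))
    where
    split : ∀ a b c → 1 + (a + b) + c ≡ 1 + (a + (b + c))
    split = solve-∀
    join : ∀ a b c d → 1 + (a + b + 0 + (c + d)) ≡ suc (a + c) + (b + d)
    join = solve-∀

  private
    long-width : ∀ l → (2 * m <ᵇ suc (width l)) ≡ long l
    long-width l with long l in ll
    ... | true  = <ᵇ-true (s≤s (≤-trans (*-monoʳ-≤ 2 (long⁻ l ll)) (≤-reflexive (sym (width≡2*size l)))))
    ... | false = <ᵇ-false (≤-trans (≤-trans (≤-reflexive (cong suc (width≡2*size l))) (*-monoʳ-< 2 (¬long⁻ l ll))) ≤-refl)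

    weight-start : ∀ a l → weight a (suc a + width l) ≡ edgeValue (isEven a) (long l)
    weight-start a l rewrite <ᵇ-true {a} {suc a + width l} (s≤s (m≤m+n a (width l)))
      | trans (cong (_∸ a) (sym (+-suc a (width l)))) (m+n∸m≡n a (suc (width l)))
      | long-width l = refl

    weight-end : ∀ x y → y < x → weight x y ≡ 0
    weight-end x y p rewrite <ᵇ-false {x} {y} (<⇒≤ p) = refl

  sum-weight : ∀ {f} a t → Encodes f a t →
    sumFrom a (width t) (λ x → weight x (f x)) ≡ treeWeight (isEven a) t
  sum-weight a leaf _ = refl
  sum-weight {f} a (node l r) (p , q , el , er) = begin
    w a + sumFrom (suc a) (suc (width l + width r)) w
      ≡⟨ cong (λ k → w a + sumFrom (suc a) k w) (sym (+-suc (width l) (width r))) ⟩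
    w a + sumFrom (suc a) (width l + suc (width r)) w
      ≡⟨ cong (w a +_) (sumFrom-split (suc a) (width l) (suc (width r)) w) ⟩
    w a + (sumFrom (suc a) (width l) w + (w (suc a + width l) + sumFrom (2 + a + width l) (width r) w))
      ≡⟨ cong₂ (λ u v → u + (sumFrom (suc a) (width l) w + (v + sumFrom (2 + a + width l) (width r) w)))
           (trans (cong (weight a) p) (weight-start a l))
           (trans (cong (weight (suc a + width l)) q) (weight-end (suc a + width l) a (s≤s (m≤m+n a (width l))))) ⟩
    edgeValue (isEven a) (long l) + (sumFrom (suc a) (width l) w + sumFrom (2 + a + width l) (width r) w)
      ≡⟨ cong₂ (λ u v → edgeValue (isEven a) (long l) + (u + v)) (sum-weight (suc a) l el)
           (trans (sum-weight (2 + a + width l) r er) (cong (λ e → treeWeight e r)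
             (trans (not-involutive _) (isEven-+width a l)))) ⟩
    treeWeight (isEven a) (node l r) ∎
    where
    open ≡-Reasoning
    w = λ x → weight x (f x)

  matchingWeight : Matching (2 * m) → ℕ
  matchingWeight M = sumFrom 0 (2 * (2 * m)) (λ x → weight x (extend M x))

  matchingWeight-code : ∀ M → matchingWeight M ≡ 2 * m + (evens (code M) + bit (centreOdd (code M)))
  matchingWeight-code M = begin
    matchingWeight M ≡⟨ cong (λ k → sumFrom 0 k (λ x → weight x (extend M x))) (sym (width-code M)) ⟩
    sumFrom 0 (width (code M)) (λ x → weight x (extend M x)) ≡⟨ sum-weight 0 (code M) (encodes-code M) ⟩
    treeWeight true (code M) ≡⟨ treeWeight-even (code M) (≤-reflexive (size-code M)) ⟩
    size (code M) + evens (code M) + bit (centreOdd (code M)) ≡⟨ cong (λ s → s + evens (code M) + bit (centreOdd (code M))) (size-code M) ⟩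
    2 * m + evens (code M) + bit (centreOdd (code M)) ≡⟨ +-assoc (2 * m) _ _ ⟩
    2 * m + (evens (code M) + bit (centreOdd (code M))) ∎
    where open ≡-Reasoning

-- Finite sums

sumFrom-cong : ∀ a k {f g} → (∀ {x} → Inside a k x → f x ≡ g x) → sumFrom a k f ≡ sumFrom a k g
sumFrom-cong a zero    eq = refl
sumFrom-cong a (suc k) eq = cong₂ _+_ (eq (≤-refl , m<m+n a z<s))
  (sumFrom-cong (suc a) k λ {x} (p , q) → eq (<⇒≤ p , subst (x <_) (sym (+-suc a k)) q))

sumFrom-+ : ∀ a k f g → sumFrom a k (λ x → f x + g x) ≡ sumFrom a k f + sumFrom a k g
sumFrom-+ a zero    f g = refl
sumFrom-+ a (suc k) f g = trans (cong (f a + g a +_) (sumFrom-+ (suc a) k f g)) (shuffle (f a) (g a) _ _)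
  where
  shuffle : ∀ a b c d → a + b + (c + d) ≡ a + c + (b + d)
  shuffle = solve-∀

sumFrom-* : ∀ a k c f → sumFrom a k (λ x → c * f x) ≡ c * sumFrom a k f
sumFrom-* a zero    c f = sym (*-zeroʳ c)
sumFrom-* a (suc k) c f = trans (cong (c * f a +_) (sumFrom-* (suc a) k c f)) (sym (*-distribˡ-+ c (f a) _))

sumFrom-const : ∀ a k c → sumFrom a k (λ _ → c) ≡ k * c
sumFrom-const a zero    c = refl
sumFrom-const a (suc k) c = cong (c +_) (sumFrom-const (suc a) k c)

sumFrom-zero : ∀ a k {f} → (∀ {x} → Inside a k x → f x ≡ 0) → sumFrom a k f ≡ 0
sumFrom-zero a k eq = trans (sumFrom-cong a k eq) (trans (sumFrom-const a k 0) (*-zeroʳ k))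

sumFrom-mono : ∀ a k {f g} → (∀ {x} → Inside a k x → f x ≤ g x) → sumFrom a k f ≤ sumFrom a k g
sumFrom-mono a zero    le = z≤n
sumFrom-mono a (suc k) le = +-mono-≤ (le (≤-refl , m<m+n a z<s))
  (sumFrom-mono (suc a) k λ {x} (p , q) → le (<⇒≤ p , subst (x <_) (sym (+-suc a k)) q))

sumFrom-swap : ∀ a k b j (f : ℕ → ℕ → ℕ) →
  sumFrom a k (λ x → sumFrom b j (f x)) ≡ sumFrom b j (λ y → sumFrom a k (λ x → f x y))
sumFrom-swap a zero    b j f = sym (sumFrom-zero b j (λ _ → refl))
sumFrom-swap a (suc k) b j f = trans (cong (sumFrom b j (f a) +_) (sumFrom-swap (suc a) k b j f))
  (sym (sumFrom-+ b j (f a) (λ y → sumFrom (suc a) k (λ x → f x y))))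

sumFrom-snoc : ∀ k f → sumFrom 0 (suc k) f ≡ sumFrom 0 k f + f k
sumFrom-snoc k f = trans (cong (λ z → sumFrom 0 z f) (+-comm 1 k))
  (trans (sumFrom-split 0 k 1 f) (cong (sumFrom 0 k f +_) (+-identityʳ (f k))))

sumFrom-shift : ∀ a k f → sumFrom (suc a) k f ≡ sumFrom a k (λ x → f (suc x))
sumFrom-shift a zero    f = refl
sumFrom-shift a (suc k) f = cong (f (suc a) +_) (sumFrom-shift (suc a) k f)

sumFrom-offset : ∀ a k f → sumFrom a k f ≡ sumFrom 0 k (λ x → f (a + x))
sumFrom-offset zero    k f = refl
sumFrom-offset (suc a) k f = trans (sumFrom-shift a k f) (sumFrom-offset a k (λ x → f (suc x)))

sumFrom-reverse : ∀ k f → sumFrom 0 k (λ x → f (k ∸ suc x)) ≡ sumFrom 0 k f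
sumFrom-reverse zero    f = refl
sumFrom-reverse (suc k) f = trans (cong (f k +_) (trans (sumFrom-shift 0 k (λ x → f (suc k ∸ suc x))) (sumFrom-reverse k f)))
  (trans (+-comm (f k) _) (sym (sumFrom-snoc k f)))

-- This turns the total distance over the cycle into a statement about every single flip.
sumFrom-tight : ∀ a k c {f} → (∀ {x} → Inside a k x → f x ≤ c) → k * c ≤ sumFrom a k f →
  ∀ {x} → Inside a k x → f x ≡ c
sumFrom-tight a zero    c le eq x∈ = ⊥-elim (¬Inside-0 x∈)
sumFrom-tight a (suc k) c {f} le eq {x} x∈ with m≤n⇒m<n∨m≡n (proj₁ x∈)
... | inj₂ refl = ≤-antisym (le x∈) (+-cancelʳ-≤ (sumFrom (suc a) k f) c (f a)
        (≤-trans (+-monoʳ-≤ c rest≤) eq))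
  where
  rest≤ : sumFrom (suc a) k f ≤ k * c
  rest≤ = ≤-trans (sumFrom-mono (suc a) k λ {x} (p , q) → le (<⇒≤ p , subst (x <_) (sym (+-suc a k)) q))
            (≤-reflexive (sumFrom-const (suc a) k c))
... | inj₁ a<x = sumFrom-tight (suc a) k c (λ {x} (p , q) → le (<⇒≤ p , subst (x <_) (sym (+-suc a k)) q))
        (+-cancelˡ-≤ c _ _ (≤-trans eq (+-monoˡ-≤ _ (le (≤-refl , m<m+n a z<s)))))
        (a<x , subst (x <_) (+-suc a k) (proj₂ x∈))

-- Indicators of added and removed edges

δ : ℕ → ℕ → ℕ
δ x y = bit (x ≡ᵇ y)

δ-≡ : ∀ {x y} → x ≡ y → δ x y ≡ 1
δ-≡ {x} {y} p with x ≡ᵇ y in eq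
... | true  = refl
... | false = ⊥-elim (subst T eq (≡⇒≡ᵇ x y p))

δ-≢ : ∀ {x y} → x ≢ y → δ x y ≡ 0
δ-≢ {x} {y} p with x ≡ᵇ y in eq
... | true  = contradiction (≡ᵇ⇒≡ x y (subst T (sym eq) _)) p
... | false = refl

sumFrom-δ : ∀ a k p (g : ℕ → ℕ) → Inside a k p → sumFrom a k (λ x → δ p x * g x) ≡ g p
sumFrom-δ a zero    p g p∈ = ⊥-elim (¬Inside-0 p∈)
sumFrom-δ a (suc k) p g p∈ with m≤n⇒m<n∨m≡n (proj₁ p∈)
... | inj₂ refl = trans (cong₂ _+_ (trans (cong (_* g a) (δ-≡ {a} refl)) (*-identityˡ (g a)))
                    (sumFrom-zero (suc a) k λ {x} (q , _) → cong (_* g x) (δ-≢ (<⇒≢ q)))) (+-identityʳ (g a))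
... | inj₁ a<p = trans (cong (λ z → z * g a + sumFrom (suc a) k (λ x → δ p x * g x)) (δ-≢ (≢-sym (<⇒≢ a<p))))
                    (sumFrom-δ (suc a) k p g (a<p , subst (p <_) (+-suc a k) (proj₂ p∈)))

length-filter-upTo : ∀ {P : ℕ → Set} (P? : Decidable P) k →
  length (filter P? (upTo k)) ≡ sumFrom 0 k (λ i → bit (does (P? i)))
length-filter-upTo P? zero    = refl
length-filter-upTo P? (suc k) = trans (cong (λ xs → length (filter P? xs)) (sym (upTo-∷ʳ k)))
  (trans (cong length (filter-++ P? (upTo k) (k ∷ [])))
    (trans (length-++ (filter P? (upTo k)))
      (trans (cong₂ _+_ (length-filter-upTo P? k) single) (sym (sumFrom-snoc k _)))))
  where
  single : length (filter P? (k ∷ [])) ≡ bit (does (P? k))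
  single with does (P? k)
  ... | true  = refl
  ... | false = refl

-- The indicator of `Added` at a point whose partner is `u` before the step and `u'` after it.
gain : ℕ → ℕ → ℕ → ℕ
gain u u' y = δ u' y * (1 ∸ δ u y)

gain-added : ∀ {n} (M M' : Matching n) x y →
  bit (does (added? M M' x y)) ≡ gain (extend M (toℕ x)) (extend M' (toℕ x)) (toℕ y)
gain-added M M' x y with partner M' x Fin.≟ y | partner M x Fin.≟ y
... | yes p | yes q rewrite δ-≡ (trans (extend-toℕ M' x) (cong toℕ p)) | δ-≡ (trans (extend-toℕ M x) (cong toℕ q)) = refl
... | yes p | no ¬q rewrite δ-≡ (trans (extend-toℕ M' x) (cong toℕ p))
    | δ-≢ (λ e → ¬q (toℕ-injective (trans (sym (extend-toℕ M x)) e))) = refl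
... | no ¬p | yes q rewrite δ-≢ (λ e → ¬p (toℕ-injective (trans (sym (extend-toℕ M' x)) e))) = refl
... | no ¬p | no ¬q rewrite δ-≢ (λ e → ¬p (toℕ-injective (trans (sym (extend-toℕ M' x)) e))) = refl

gain-balance : ∀ u u' y → gain u u' y + δ u y ≡ gain u' u y + δ u' y
gain-balance u u' y with u ≡ᵇ y | u' ≡ᵇ y
... | true  | true  = refl
... | true  | false = refl
... | false | true  = refl
... | false | false = refl

-- Counts additions and removals alike, so that the direction of a flip does not matter.
toggle : ℕ → ℕ → ℕ → ℕ
toggle u u' y = gain u u' y + gain u' u y

toggle-same : ∀ u y → toggle u u y ≡ 0
toggle-same u y with u ≡ᵇ y
... | true  = refl
... | false = refl

toggle-≢ : ∀ {u u'} y → u ≢ u' → toggle u u' y ≡ δ u y + δ u' y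
toggle-≢ {u} {u'} y ne with u ≡ᵇ y in e | u' ≡ᵇ y in e'
... | true  | true  = contradiction (trans (≡ᵇ⇒≡ u y (subst T (sym e) _)) (sym (≡ᵇ⇒≡ u' y (subst T (sym e') _)))) ne
... | true  | false = refl
... | false | true  = refl
... | false | false = refl

-- Flips

pairSum : ℕ → (ℕ → ℕ → ℕ) → ℕ
pairSum N h = sumFrom 0 N (λ x → sumFrom 0 N (λ y → bit (x <ᵇ y) * h x y))

-- Oriented so that `f` has the sides p₁p₂, p₃p₄ and `f'` the sides p₁p₄, p₂p₃; a flip is a `Quad`
-- in one of the two directions.
record Quad (N : ℕ) (f f' : ℕ → ℕ) (p₁ p₂ p₃ p₄ : ℕ) : Set where
  field
    p₁<p₂ : p₁ < p₂
    p₂<p₃ : p₂ < p₃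
    p₃<p₄ : p₃ < p₄
    p₄<N  : p₄ < N
    f₁    : f p₁ ≡ p₂
    f₂    : f p₂ ≡ p₁
    f₃    : f p₃ ≡ p₄
    f₄    : f p₄ ≡ p₃
    f'₁   : f' p₁ ≡ p₄
    f'₂   : f' p₂ ≡ p₃
    f'₃   : f' p₃ ≡ p₂
    f'₄   : f' p₄ ≡ p₁
    other : ∀ {x} → x < N → x ≢ p₁ → x ≢ p₂ → x ≢ p₃ → x ≢ p₄ → f' x ≡ f x

  p₁<p₃ = <-trans p₁<p₂ p₂<p₃
  p₁<p₄ = <-trans p₁<p₃ p₃<p₄
  p₂<p₄ = <-trans p₂<p₃ p₃<p₄
  p₃<N  = <-trans p₃<p₄ p₄<N
  p₂<N  = <-trans p₂<p₃ p₃<N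
  p₁<N  = <-trans p₁<p₂ p₂<N

  -- Exchanging the corner values between the two sides makes the sums agree point by point; `at`
  -- places these values at the corners.
  sum-corners : ∀ (φ φ' : ℕ → ℕ) →
    (∀ {x} → x < N → x ≢ p₁ → x ≢ p₂ → x ≢ p₃ → x ≢ p₄ → φ x ≡ φ' x) →
    sumFrom 0 N φ + (φ' p₁ + φ' p₂ + φ' p₃ + φ' p₄) ≡ sumFrom 0 N φ' + (φ p₁ + φ p₂ + φ p₃ + φ p₄)
  sum-corners φ φ' agree = begin
    sumFrom 0 N φ + (φ' p₁ + φ' p₂ + φ' p₃ + φ' p₄)   ≡⟨ cong (sumFrom 0 N φ +_) (sym (spread φ')) ⟩
    sumFrom 0 N φ + sumFrom 0 N (at φ')               ≡⟨ sym (sumFrom-+ 0 N φ (at φ')) ⟩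
    sumFrom 0 N (λ x → φ x + at φ' x)                 ≡⟨ sumFrom-cong 0 N (λ {x} (_ , p) → pointwise x p) ⟩
    sumFrom 0 N (λ x → φ' x + at φ x)                 ≡⟨ sumFrom-+ 0 N φ' (at φ) ⟩
    sumFrom 0 N φ' + sumFrom 0 N (at φ)               ≡⟨ cong (sumFrom 0 N φ' +_) (spread φ) ⟩
    sumFrom 0 N φ' + (φ p₁ + φ p₂ + φ p₃ + φ p₄)      ∎
    where
    open ≡-Reasoning
    at : (ℕ → ℕ) → ℕ → ℕ
    at ψ x = δ p₁ x * ψ x + δ p₂ x * ψ x + δ p₃ x * ψ x + δ p₄ x * ψ x
    spread : ∀ ψ → sumFrom 0 N (at ψ) ≡ ψ p₁ + ψ p₂ + ψ p₃ + ψ p₄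
    spread ψ = trans (sumFrom-+ 0 N _ _) (cong₂ _+_
      (trans (sumFrom-+ 0 N _ _) (cong₂ _+_
        (trans (sumFrom-+ 0 N _ _) (cong₂ _+_ (sumFrom-δ 0 N p₁ ψ (z≤n , p₁<N)) (sumFrom-δ 0 N p₂ ψ (z≤n , p₂<N))))
        (sumFrom-δ 0 N p₃ ψ (z≤n , p₃<N))))
      (sumFrom-δ 0 N p₄ ψ (z≤n , p₄<N)))
    corner : ∀ {a b c d} u v → a + b + c + d ≡ 1 →
      u + (a * v + b * v + c * v + d * v) ≡ v + (a * u + b * u + c * u + d * u)
    corner {a} {b} {c} {d} u v e = trans (cong (u +_) (collect a b c d v))
      (trans (cong (λ z → u + z * v) e) (trans (cong (u +_) (*-identityˡ v)) (trans (+-comm u v)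
        (sym (trans (cong (v +_) (collect a b c d u)) (trans (cong (λ z → v + z * u) e) (cong (v +_) (*-identityˡ u))))))))
      where
      collect : ∀ a b c d v → a * v + b * v + c * v + d * v ≡ (a + b + c + d) * v
      collect = solve-∀
    pointwise : ∀ x → x < N → φ x + at φ' x ≡ φ' x + at φ x
    pointwise x x<N with x ≟ p₁ | x ≟ p₂ | x ≟ p₃ | x ≟ p₄
    ... | yes refl | _ | _ | _ = corner {a = δ p₁ x} (φ x) (φ' x) (count (δ-≡ {x} refl)
            (δ-≢ (≢-sym (<⇒≢ p₁<p₂))) (δ-≢ (≢-sym (<⇒≢ p₁<p₃))) (δ-≢ (≢-sym (<⇒≢ p₁<p₄))))
      where
      count : ∀ {a b c d} → a ≡ 1 → b ≡ 0 → c ≡ 0 → d ≡ 0 → a + b + c + d ≡ 1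
      count refl refl refl refl = refl
    ... | no _ | yes refl | _ | _ = corner {a = δ p₁ x} (φ x) (φ' x) (count (δ-≢ (<⇒≢ p₁<p₂))
            (δ-≡ {x} refl) (δ-≢ (≢-sym (<⇒≢ p₂<p₃))) (δ-≢ (≢-sym (<⇒≢ p₂<p₄))))
      where
      count : ∀ {a b c d} → a ≡ 0 → b ≡ 1 → c ≡ 0 → d ≡ 0 → a + b + c + d ≡ 1
      count refl refl refl refl = refl
    ... | no _ | no _ | yes refl | _ = corner {a = δ p₁ x} (φ x) (φ' x) (count (δ-≢ (<⇒≢ p₁<p₃))
            (δ-≢ (<⇒≢ p₂<p₃)) (δ-≡ {x} refl) (δ-≢ (≢-sym (<⇒≢ p₃<p₄))))
      where
      count : ∀ {a b c d} → a ≡ 0 → b ≡ 0 → c ≡ 1 → d ≡ 0 → a + b + c + d ≡ 1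
      count refl refl refl refl = refl
    ... | no _ | no _ | no _ | yes refl = corner {a = δ p₁ x} (φ x) (φ' x) (count (δ-≢ (<⇒≢ p₁<p₄))
            (δ-≢ (<⇒≢ p₂<p₄)) (δ-≢ (<⇒≢ p₃<p₄)) (δ-≡ {x} refl))
      where
      count : ∀ {a b c d} → a ≡ 0 → b ≡ 0 → c ≡ 0 → d ≡ 1 → a + b + c + d ≡ 1
      count refl refl refl refl = refl
    ... | no ¬1 | no ¬2 | no ¬3 | no ¬4 = cong₂ _+_ (agree x<N ¬1 ¬2 ¬3 ¬4) (trans (none φ') (sym (none φ)))
      where
      none : ∀ ψ → at ψ x ≡ 0
      none ψ rewrite δ-≢ (≢-sym ¬1) | δ-≢ (≢-sym ¬2) | δ-≢ (≢-sym ¬3) | δ-≢ (≢-sym ¬4) = refl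

  sides : (ℕ → ℕ → ℕ) → ℕ
  sides g = g p₁ p₂ + g p₁ p₄ + g p₂ p₃ + g p₃ p₄

  private
    row : (g : ℕ → ℕ → ℕ) → ℕ → ℕ → ℕ → ℕ
    row g x u u' = sumFrom 0 N (λ y → bit (x <ᵇ y) * (toggle u u' y * g x y))

    row-same : ∀ g x u → row g x u u ≡ 0
    row-same g x u = sumFrom-zero 0 N λ {y} _ → trans (cong (λ z → bit (x <ᵇ y) * (z * g x y)) (toggle-same u y))
      (*-zeroʳ (bit (x <ᵇ y)))

    row-≢ : ∀ g x {u u'} → u < N → u' < N → u ≢ u' →
            row g x u u' ≡ bit (x <ᵇ u) * g x u + bit (x <ᵇ u') * g x u'
    row-≢ g x {u} {u'} u<N u'<N ne = begin
      row g x u u' ≡⟨ sumFrom-cong 0 N (λ {y} _ → trans (cong (λ z → bit (x <ᵇ y) * (z * g x y)) (toggle-≢ y ne))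
                        (distribute (bit (x <ᵇ y)) (δ u y) (δ u' y) (g x y))) ⟩
      sumFrom 0 N (λ y → δ u y * (bit (x <ᵇ y) * g x y) + δ u' y * (bit (x <ᵇ y) * g x y)) ≡⟨ sumFrom-+ 0 N _ _ ⟩
      _ ≡⟨ cong₂ _+_ (sumFrom-δ 0 N u (λ y → bit (x <ᵇ y) * g x y) (z≤n , u<N))
                     (sumFrom-δ 0 N u' (λ y → bit (x <ᵇ y) * g x y) (z≤n , u'<N)) ⟩
      bit (x <ᵇ u) * g x u + bit (x <ᵇ u') * g x u' ∎
      where
      open ≡-Reasoning
      distribute : ∀ b d e g → b * ((d + e) * g) ≡ d * (b * g) + e * (b * g)
      distribute = solve-∀

  -- Only the corners change partners, and each side is counted once, at its lower end.
  toggle-sides : ∀ g → pairSum N (λ x y → toggle (f x) (f' x) y * g x y) ≡ sides g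
  toggle-sides g = begin
    sumFrom 0 N ψ ≡⟨ sym (+-identityʳ _) ⟩
    sumFrom 0 N ψ + 0 ≡⟨ sum-corners ψ (λ _ → 0) (λ {x} p a b c d → trans (cong (row g x (f x)) (other p a b c d)) (row-same g x (f x))) ⟩
    sumFrom 0 N (λ _ → 0) + (ψ p₁ + ψ p₂ + ψ p₃ + ψ p₄) ≡⟨ cong (_+ (ψ p₁ + ψ p₂ + ψ p₃ + ψ p₄)) (sumFrom-zero 0 N (λ _ → refl)) ⟩
    ψ p₁ + ψ p₂ + ψ p₃ + ψ p₄ ≡⟨ cong₂ _+_ (cong₂ _+_ (cong₂ _+_ ψ₁ ψ₂) ψ₃) ψ₄ ⟩
    (g p₁ p₂ + g p₁ p₄) + g p₂ p₃ + g p₃ p₄ + 0 ≡⟨ +-identityʳ _ ⟩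
    sides g ∎
    where
    open ≡-Reasoning
    ψ = λ x → row g x (f x) (f' x)
    ψ₁ : ψ p₁ ≡ g p₁ p₂ + g p₁ p₄
    ψ₁ rewrite f₁ | f'₁ | row-≢ g p₁ p₂<N p₄<N (<⇒≢ p₂<p₄) | <ᵇ-true p₁<p₂ | <ᵇ-true p₁<p₄ =
      cong₂ _+_ (+-identityʳ (g p₁ p₂)) (+-identityʳ (g p₁ p₄))
    ψ₂ : ψ p₂ ≡ g p₂ p₃
    ψ₂ rewrite f₂ | f'₂ | row-≢ g p₂ p₁<N p₃<N (<⇒≢ p₁<p₃) | <ᵇ-false (<⇒≤ p₁<p₂) | <ᵇ-true p₂<p₃ = +-identityʳ _
    ψ₃ : ψ p₃ ≡ g p₃ p₄
    ψ₃ rewrite f₃ | f'₃ | row-≢ g p₃ p₄<N p₂<N (≢-sym (<⇒≢ p₂<p₄)) | <ᵇ-false (<⇒≤ p₂<p₃) | <ᵇ-true p₃<p₄ =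
      trans (+-identityʳ _) (+-identityʳ _)
    ψ₄ : ψ p₄ ≡ 0
    ψ₄ rewrite f₄ | f'₄ | row-≢ g p₄ p₃<N p₁<N (≢-sym (<⇒≢ p₁<p₃)) | <ᵇ-false (<⇒≤ p₃<p₄) | <ᵇ-false (<⇒≤ p₁<p₄) = refl

-- Lengths of the sides of a quadrilateral

distance : ℕ → ℕ → ℕ → ℕ
distance N x y = (y ∸ x) ⊓ (N ∸ (y ∸ x))

squeeze₂ : ∀ {a b a' b'} → a ≤ a' → b ≤ b' → a' + b' ≤ a + b → a ≡ a' × b ≡ b'
squeeze₂ {a} {b} {a'} {b'} p q le =
  ≤-antisym p (+-cancelʳ-≤ b' a' a (≤-trans le (+-monoʳ-≤ a q))) ,
  ≤-antisym q (+-cancelˡ-≤ a' b' b (≤-trans le (+-monoˡ-≤ b p)))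

squeeze : ∀ {a b c d a' b' c' d'} → a ≤ a' → b ≤ b' → c ≤ c' → d ≤ d' → a' + b' + c' + d' ≤ a + b + c + d →
  a ≡ a' × b ≡ b' × c ≡ c' × d ≡ d'
squeeze {a} {b} {c} {d} {a'} {b'} {c'} {d'} p q r s le with squeeze₂ (+-mono-≤ (+-mono-≤ p q) r) s le
... | e , s≡ with squeeze₂ (+-mono-≤ p q) r (≤-reflexive (sym e))
...   | e' , r≡ with squeeze₂ p q (≤-reflexive (sym e'))
...     | p≡ , q≡ = p≡ , q≡ , r≡ , s≡

-- These are the arcs that the sides cut off outside the quadrilateral; the one at p₁p₄ runs through
-- the point 0.
arcs-sum : ∀ {N p₁ p₂ p₃ p₄} → p₁ ≤ p₂ → p₂ ≤ p₃ → p₃ ≤ p₄ → p₄ ≤ N →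
  (p₂ ∸ p₁) + (N ∸ (p₄ ∸ p₁)) + (p₃ ∸ p₂) + (p₄ ∸ p₃) ≡ N
arcs-sum {N} {p₁} p₁≤p₂ p₂≤p₃ p₃≤p₄ p₄≤N
  with m≤n⇒∃[o]m+o≡n p₁≤p₂ | m≤n⇒∃[o]m+o≡n p₂≤p₃ | m≤n⇒∃[o]m+o≡n p₃≤p₄
... | a , refl | b , refl | c , refl
  rewrite m+n∸m≡n p₁ a | m+n∸m≡n (p₁ + a) b | m+n∸m≡n (p₁ + a + b) c
    | +-assoc (p₁ + a) b c | +-assoc p₁ a (b + c) | m+n∸m≡n p₁ (a + (b + c)) =
  trans (shuffle a (N ∸ (a + (b + c))) b c) (m+[n∸m]≡n (≤-trans (m≤n+m (a + (b + c)) p₁) p₄≤N))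
  where
  shuffle : ∀ a d b c → a + d + b + c ≡ a + (b + c) + d
  shuffle = solve-∀

module _ {N f f' p₁ p₂ p₃ p₄} (q : Quad N f f' p₁ p₂ p₃ p₄) where
  open Quad q

  private
    span-sum = arcs-sum (<⇒≤ p₁<p₂) (<⇒≤ p₂<p₃) (<⇒≤ p₃<p₄) (<⇒≤ p₄<N)

  sides-distance≤ : sides (distance N) ≤ N
  sides-distance≤ = ≤-trans (+-mono-≤ (+-mono-≤ (+-mono-≤
      (m⊓n≤m (p₂ ∸ p₁) _) (m⊓n≤n (p₄ ∸ p₁) _)) (m⊓n≤m (p₃ ∸ p₂) _)) (m⊓n≤m (p₄ ∸ p₃) _))
    (≤-reflexive span-sum)

  -- No outer arc exceeds half the circle. For p₁p₄ the outer arc is the complement, which reverses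
  -- the inequality.
  Centred : ℕ → Set
  Centred n = p₂ ∸ p₁ ≤ n × n ≤ p₄ ∸ p₁ × p₃ ∸ p₂ ≤ n × p₄ ∸ p₃ ≤ n

  -- Each distance is at most the outer arc of its side, so equality of the sums forces each minimum
  -- to be attained on the outer arc.
  sides-tight : ∀ n → N ≡ 2 * n → N ≤ sides (distance N) → Centred n
  sides-tight n N≡ le with squeeze (m⊓n≤m (p₂ ∸ p₁) _) (m⊓n≤n (p₄ ∸ p₁) _) (m⊓n≤m (p₃ ∸ p₂) _) (m⊓n≤m (p₄ ∸ p₃) _)
                                   (≤-trans (≤-reflexive span-sum) le)
  ... | e₁₂ , e₁₄ , e₂₃ , e₃₄ = short e₁₂ (≤-trans (m∸n≤m p₂ p₁) (<⇒≤ p₂<N)) ,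
      long e₁₄ (≤-trans (m∸n≤m p₄ p₁) (<⇒≤ p₄<N)) ,
      short e₂₃ (≤-trans (m∸n≤m p₃ p₂) (<⇒≤ p₃<N)) , short e₃₄ (≤-trans (m∸n≤m p₄ p₃) (<⇒≤ p₄<N))
    where
    short : ∀ {d} → d ⊓ (N ∸ d) ≡ d → d ≤ N → d ≤ n
    short {d} e d≤N = *-cancelˡ-≤ 2 (≤-trans (+-monoʳ-≤ d (≤-trans (≤-reflexive (+-identityʳ d)) d≤N∸d))
        (≤-trans (≤-reflexive (m+[n∸m]≡n d≤N)) (≤-reflexive N≡)))
      where
      d≤N∸d : d ≤ N ∸ d
      d≤N∸d = ≤-trans (≤-reflexive (sym e)) (m⊓n≤n d (N ∸ d))
    long : ∀ {d} → d ⊓ (N ∸ d) ≡ N ∸ d → d ≤ N → n ≤ d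
    long {d} e d≤N = *-cancelˡ-≤ 2 (≤-trans (≤-reflexive (sym N≡)) (≤-trans (≤-reflexive (sym (m+[n∸m]≡n d≤N)))
        (+-monoʳ-≤ d (≤-trans N∸d≤d (≤-reflexive (sym (+-identityʳ d)))))))
      where
      N∸d≤d : N ∸ d ≤ d
      N∸d≤d = ≤-trans (≤-reflexive (sym e)) (m⊓n≤m d (N ∸ d))

flip⇒quad : ∀ {n} (M M' : Matching n) → Flip M M' →
  ∃ λ p₁ → ∃ λ p₂ → ∃ λ p₃ → ∃ λ p₄ →
    Quad (2 * n) (extend M) (extend M') p₁ p₂ p₃ p₄ ⊎ Quad (2 * n) (extend M') (extend M) p₁ p₂ p₃ p₄
flip⇒quad {n} M M' (q₁ , q₂ , q₃ , q₄ , lt₁ , lt₂ , lt₃ , _ , edges , same) =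
  toℕ q₁ , toℕ q₂ , toℕ q₃ , toℕ q₄ , quads edges
  where
  at : ∀ (M : Matching n) {x y} → HasEdge M x y → extend M (toℕ x) ≡ toℕ y
  at M {x} e = trans (extend-toℕ M x) (cong toℕ e)
  back : ∀ (M : Matching n) {x y} → HasEdge M x y → extend M (toℕ y) ≡ toℕ x
  back M {x} e = at M (trans (cong (partner M) (sym e)) (involutive M x))
  unchanged : ∀ {x} → x < 2 * n → x ≢ toℕ q₁ → x ≢ toℕ q₂ → x ≢ toℕ q₃ → x ≢ toℕ q₄ → extend M' x ≡ extend M x
  unchanged {x} p ¬1 ¬2 ¬3 ¬4 = trans (extend-point M' p) (trans (cong toℕ (same (fromℕ< p)
      (off ¬1 , off ¬2 , off ¬3 , off ¬4))) (sym (extend-point M p)))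
    where
    off : ∀ {q} → x ≢ toℕ q → fromℕ< p ≢ q
    off ne e = ne (trans (sym (toℕ-fromℕ< p)) (cong toℕ e))
  quads : (HasEdge M q₁ q₂ × HasEdge M q₃ q₄ × HasEdge M' q₁ q₄ × HasEdge M' q₂ q₃)
        ⊎ (HasEdge M q₁ q₄ × HasEdge M q₂ q₃ × HasEdge M' q₁ q₂ × HasEdge M' q₃ q₄) → _
  quads (inj₁ (e₁₂ , e₃₄ , e₁₄ , e₂₃)) = inj₁ (record
    { p₁<p₂ = lt₁ ; p₂<p₃ = lt₂ ; p₃<p₄ = lt₃ ; p₄<N = toℕ<n q₄
    ; f₁ = at M e₁₂ ; f₂ = back M e₁₂ ; f₃ = at M e₃₄ ; f₄ = back M e₃₄
    ; f'₁ = at M' e₁₄ ; f'₂ = at M' e₂₃ ; f'₃ = back M' e₂₃ ; f'₄ = back M' e₁₄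
    ; other = unchanged })
  quads (inj₂ (e₁₄ , e₂₃ , e₁₂ , e₃₄)) = inj₂ (record
    { p₁<p₂ = lt₁ ; p₂<p₃ = lt₂ ; p₃<p₄ = lt₃ ; p₄<N = toℕ<n q₄
    ; f₁ = at M' e₁₂ ; f₂ = back M' e₁₂ ; f₃ = at M' e₃₄ ; f₄ = back M' e₃₄
    ; f'₁ = at M e₁₄ ; f'₂ = at M e₂₃ ; f'₃ = back M e₂₃ ; f'₄ = back M e₁₄
    ; other = λ p a b c d → sym (unchanged p a b c d) })

-- Invariance under centred flips

module Invariance (m : ℕ) (0<m : 0 < m) where
  open Weight m 0<m

  weight-invariant : ∀ (M M' : Matching (2 * m)) {p₁ p₂ p₃ p₄}
    (q : Quad (2 * (2 * m)) (extend M) (extend M') p₁ p₂ p₃ p₄) → Centred q (2 * m) →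
    matchingWeight M ≡ matchingWeight M'
  weight-invariant M M' {p₁} {p₂} {p₃} {p₄} q (s₁₂ , l₁₄ , s₂₃ , s₃₄) =
    +-cancelʳ-≡ _ _ _ (trans (cong (matchingWeight M +_) (sym corners)) (sum-corners φ φ' λ p a b c d → cong (weight _) (sym (other p a b c d))))
    where
    open Quad q
    φ  = λ x → weight x (extend M x)
    φ' = λ x → weight x (extend M' x)
    e₁ = isEven p₁
    par₂ : isEven p₂ ≡ not e₁
    par₂ = trans (cong isEven (sym f₁)) (extend-parity M p₁<N)
    par₃ : isEven p₃ ≡ e₁
    par₃ = trans (cong isEven (sym f'₂)) (trans (extend-parity M' p₂<N) (trans (cong not par₂) (not-involutive e₁)))
    par₄ : isEven p₄ ≡ not e₁
    par₄ = trans (cong isEven (sym f'₁)) (extend-parity M' p₁<N)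
    -- Centredness gives only a weak inequality. It is strict because the ends of an edge differ in
    -- parity while 2m is even.
    far : 2 * m < p₄ ∸ p₁
    far = ≤∧≢⇒< l₁₄ λ e → isEven-≢ {p₁} {p₁} (trans (sym (trans (isEven-+ p₁ (2 * m)) (cong (λ b → if b then e₁ else not e₁) (isEven-2* m))))
      (trans (cong isEven (trans (cong (p₁ +_) e) (m+[n∸m]≡n (<⇒≤ p₁<p₄)))) par₄)) refl
    down : ∀ {x y} → y < x → weight x y ≡ 0
    down {x} {y} p rewrite <ᵇ-false {x} {y} (<⇒≤ p) = refl
    short : ∀ {x y} → x < y → y ∸ x ≤ 2 * m → weight x y ≡ edgeValue (isEven x) false
    short {x} {y} p s rewrite <ᵇ-true {x} {y} p | <ᵇ-false {2 * m} {y ∸ x} s = refl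
    φ₁ : φ p₁ ≡ edgeValue e₁ false
    φ₁ = trans (cong (weight p₁) f₁) (short p₁<p₂ s₁₂)
    φ₂ : φ p₂ ≡ 0
    φ₂ = trans (cong (weight p₂) f₂) (down p₁<p₂)
    φ₃ : φ p₃ ≡ edgeValue e₁ false
    φ₃ = trans (cong (weight p₃) f₃) (trans (short p₃<p₄ s₃₄) (cong (λ b → edgeValue b false) par₃))
    φ₄ : φ p₄ ≡ 0
    φ₄ = trans (cong (weight p₄) f₄) (down p₃<p₄)
    φ'₁ : φ' p₁ ≡ edgeValue e₁ true
    φ'₁ = trans (cong (weight p₁) f'₁) far-weight
      where
      far-weight : weight p₁ p₄ ≡ edgeValue e₁ true
      far-weight rewrite <ᵇ-true p₁<p₄ | <ᵇ-true far = refl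
    φ'₂ : φ' p₂ ≡ edgeValue (not e₁) false
    φ'₂ = trans (cong (weight p₂) f'₂) (trans (short p₂<p₃ s₂₃) (cong (λ b → edgeValue b false) par₂))
    φ'₃ : φ' p₃ ≡ 0
    φ'₃ = trans (cong (weight p₃) f'₃) (down p₂<p₃)
    φ'₄ : φ' p₄ ≡ 0
    φ'₄ = trans (cong (weight p₄) f'₄) (down p₁<p₄)
    balance : ∀ e → edgeValue e true + edgeValue (not e) false + 0 + 0 ≡ edgeValue e false + 0 + edgeValue e false + 0
    balance true  = refl
    balance false = refl
    corners : φ' p₁ + φ' p₂ + φ' p₃ + φ' p₄ ≡ φ p₁ + φ p₂ + φ p₃ + φ p₄
    corners rewrite φ₁ | φ₂ | φ₃ | φ₄ | φ'₁ | φ'₂ | φ'₃ | φ'₄ = balance e₁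

-- The total distance of all edges

∸-suc : ∀ {e n} → e < n → n ∸ e ≡ suc (n ∸ suc e)
∸-suc e<n = +-∸-assoc 1 e<n

-- Seen from `x`, each gap below N - 1 - x occurs once; reversing the order of the points lists
-- these ranges as prefixes.
pairSum-difference : ∀ N (Φ : ℕ → ℕ) h → (∀ {x y} → x < y → h x y ≡ Φ (y ∸ suc x)) →
  pairSum N h ≡ sumFrom 0 N (λ k → sumFrom 0 k Φ)
pairSum-difference N Φ h eq = trans (sumFrom-cong 0 N (λ {x} (_ , p) → row x p)) (sumFrom-reverse N (λ k → sumFrom 0 k Φ))
  where
  row : ∀ x → x < N → sumFrom 0 N (λ y → bit (x <ᵇ y) * h x y) ≡ sumFrom 0 (N ∸ suc x) Φ
  row x x<N with m≤n⇒∃[o]m+o≡n x<N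
  ... | k , refl = begin
    sumFrom 0 (suc x + k) ρ                   ≡⟨ sumFrom-split 0 (suc x) k ρ ⟩
    sumFrom 0 (suc x) ρ + sumFrom (suc x) k ρ ≡⟨ cong (_+ sumFrom (suc x) k ρ) (sumFrom-zero 0 (suc x)
        λ { {y} (_ , s≤s y≤x) → cong (λ b → bit b * h x y) (<ᵇ-false y≤x) }) ⟩
    sumFrom (suc x) k ρ                       ≡⟨ sumFrom-offset (suc x) k ρ ⟩
    sumFrom 0 k (λ d → ρ (suc x + d))         ≡⟨ sumFrom-cong 0 k (λ {d} _ → above d) ⟩
    sumFrom 0 k Φ                             ≡⟨ cong (λ z → sumFrom 0 z Φ) (sym (m+n∸m≡n (suc x) k)) ⟩
    sumFrom 0 (suc x + k ∸ suc x) Φ           ∎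
    where
    open ≡-Reasoning
    ρ = λ y → bit (x <ᵇ y) * h x y
    above : ∀ d → ρ (suc x + d) ≡ Φ d
    above d = trans (cong (λ b → bit b * h x (suc x + d)) (<ᵇ-true {x} {suc x + d} (s≤s (m≤m+n x d))))
      (trans (+-identityʳ _) (trans (eq (s≤s (m≤m+n x d))) (cong Φ (m+n∸m≡n (suc x) d))))

module _ (γ : ℕ → ℕ) where
  private
    Φ : ℕ → ℕ
    Φ d = bit (isEven d) * γ d

    Q : ℕ → ℕ
    Q j = sumFrom 0 j (λ e → γ (2 * e))

    at-even : ∀ j → sumFrom 0 (suc (2 * j)) Φ ≡ sumFrom 0 (2 * j) Φ + γ (2 * j)
    at-even j = trans (sumFrom-snoc (2 * j) Φ) (cong (sumFrom 0 (2 * j) Φ +_)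
      (trans (cong (λ b → bit b * γ (2 * j)) (isEven-2* j)) (+-identityʳ _)))

    prefix : ∀ j → sumFrom 0 (2 * j) Φ ≡ Q j
    prefix zero    = refl
    prefix (suc j) = begin
      sumFrom 0 (2 * suc j) Φ                        ≡⟨ cong (λ z → sumFrom 0 z Φ) (*-suc 2 j) ⟩
      sumFrom 0 (2 + 2 * j) Φ                        ≡⟨ sumFrom-snoc (suc (2 * j)) Φ ⟩
      sumFrom 0 (suc (2 * j)) Φ + Φ (suc (2 * j))    ≡⟨ cong (sumFrom 0 (suc (2 * j)) Φ +_)
        (cong (λ b → bit (not b) * γ (suc (2 * j))) (isEven-2* j)) ⟩
      sumFrom 0 (suc (2 * j)) Φ + 0                  ≡⟨ +-identityʳ _ ⟩
      sumFrom 0 (suc (2 * j)) Φ                      ≡⟨ at-even j ⟩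
      sumFrom 0 (2 * j) Φ + γ (2 * j)                ≡⟨ cong (_+ γ (2 * j)) (prefix j) ⟩
      Q j + γ (2 * j)                                ≡⟨ sym (sumFrom-snoc j (λ e → γ (2 * e))) ⟩
      Q (suc j)                                      ∎
      where open ≡-Reasoning

  -- The gap 2e belongs to 2n - 1 - 2e pairs, which is the coefficient on the right.
  sum-of-prefixes : ∀ n → sumFrom 0 (2 * n) (λ k → sumFrom 0 k Φ)
    ≡ sumFrom 0 n (λ e → suc (2 * (n ∸ suc e)) * γ (2 * e))
  sum-of-prefixes zero    = refl
  sum-of-prefixes (suc n) = begin
    sumFrom 0 (2 * suc n) S                         ≡⟨ cong (λ z → sumFrom 0 z S) (*-suc 2 n) ⟩
    sumFrom 0 (2 + 2 * n) S                         ≡⟨ sumFrom-snoc (suc (2 * n)) S ⟩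
    sumFrom 0 (suc (2 * n)) S + S (suc (2 * n))     ≡⟨ cong (_+ S (suc (2 * n))) (sumFrom-snoc (2 * n) S) ⟩
    sumFrom 0 (2 * n) S + S (2 * n) + S (suc (2 * n))
      ≡⟨ cong₂ _+_ (cong₂ _+_ (sum-of-prefixes n) (prefix n)) (trans (at-even n) (cong (_+ γ (2 * n)) (prefix n))) ⟩
    U n + Q n + (Q n + γ (2 * n))                   ≡⟨ shuffle (U n) (Q n) (γ (2 * n)) ⟩
    U n + 2 * Q n + γ (2 * n)
      ≡⟨ cong (_+ γ (2 * n)) (trans (cong (U n +_) (sym (sumFrom-* 0 n 2 (λ e → γ (2 * e))))) (sym (sumFrom-+ 0 n _ _))) ⟩
    sumFrom 0 n (λ e → suc (2 * (n ∸ suc e)) * γ (2 * e) + 2 * γ (2 * e)) + γ (2 * n)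
      ≡⟨ cong₂ _+_ (sumFrom-cong 0 n (λ {e} (_ , p) → raise e p))
           (sym (trans (cong (λ z → suc (2 * z) * γ (2 * n)) (n∸n≡0 n)) (+-identityʳ _))) ⟩
    sumFrom 0 n (λ e → suc (2 * (suc n ∸ suc e)) * γ (2 * e)) + suc (2 * (suc n ∸ suc n)) * γ (2 * n)
      ≡⟨ sym (sumFrom-snoc n (λ e → suc (2 * (suc n ∸ suc e)) * γ (2 * e))) ⟩
    U (suc n) ∎
    where
    open ≡-Reasoning
    S = λ k → sumFrom 0 k Φ
    U = λ n → sumFrom 0 n (λ e → suc (2 * (n ∸ suc e)) * γ (2 * e))
    shuffle : ∀ t q g → t + q + (q + g) ≡ t + 2 * q + g
    shuffle = solve-∀
    raise : ∀ e → e < n → suc (2 * (n ∸ suc e)) * γ (2 * e) + 2 * γ (2 * e) ≡ suc (2 * (n ∸ e)) * γ (2 * e)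
    raise e e<n = trans (expand (n ∸ suc e) (γ (2 * e))) (cong (λ z → suc (2 * z) * γ (2 * e)) (sym (∸-suc e<n)))
      where
      expand : ∀ k g → suc (2 * k) * g + 2 * g ≡ suc (2 * suc k) * g
      expand = solve-∀

sum-odds : ∀ n → sumFrom 0 n (λ e → suc (2 * (n ∸ suc e)) * 1) ≡ n * n
sum-odds n = trans (sumFrom-reverse n (λ u → suc (2 * u) * 1)) (squares n)
  where
  squares : ∀ n → sumFrom 0 n (λ u → suc (2 * u) * 1) ≡ n * n
  squares zero    = refl
  squares (suc n) = trans (sumFrom-snoc n (λ u → suc (2 * u) * 1)) (trans (cong (_+ suc (2 * n) * 1) (squares n)) (step n))
    where
    step : ∀ n → n * n + suc (2 * n) * 1 ≡ suc n * suc n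
    step = solve-∀

minSum : ℕ → ℕ
minSum n = sumFrom 0 n (λ e → suc (2 * e) ⊓ suc (2 * (n ∸ suc e)))

-- The outermost summands are 1, and each of the n inner ones exceeds its counterpart in `minSum n`
-- by 2.
minSum-step : ∀ n → minSum (2 + n) ≡ minSum n + (2 + 2 * n)
minSum-step n = begin
  minSum (2 + n)                                ≡⟨ cong (1 +_) (sumFrom-shift 0 (suc n) μ) ⟩
  1 + sumFrom 0 (suc n) (λ e → μ (suc e))       ≡⟨ cong (1 +_) (sumFrom-snoc n (λ e → μ (suc e))) ⟩
  1 + (sumFrom 0 n (λ e → μ (suc e)) + μ (suc n))
    ≡⟨ cong₂ (λ u v → 1 + (u + v)) (sumFrom-cong 0 n (λ {e} (_ , p) → inner e p)) last ⟩
  1 + (sumFrom 0 n (λ e → μ' e + 2) + 1)        ≡⟨ cong (λ z → 1 + (z + 1)) (trans (sumFrom-+ 0 n μ' (λ _ → 2)) (cong (minSum n +_) (sumFrom-const 0 n 2))) ⟩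
  1 + (minSum n + n * 2 + 1)                    ≡⟨ shuffle (minSum n) n ⟩
  minSum n + (2 + 2 * n)                        ∎
  where
  open ≡-Reasoning
  μ  = λ e → suc (2 * e) ⊓ suc (2 * (2 + n ∸ suc e))
  μ' = λ e → suc (2 * e) ⊓ suc (2 * (n ∸ suc e))
  shuffle : ∀ s n → 1 + (s + n * 2 + 1) ≡ s + (2 + 2 * n)
  shuffle = solve-∀
  last : μ (suc n) ≡ 1
  last = trans (cong (λ z → suc (2 * suc n) ⊓ suc (2 * z)) (n∸n≡0 n)) (cong suc (⊓-zeroʳ (2 * suc n)))
  inner : ∀ e → e < n → μ (suc e) ≡ μ' e + 2
  inner e e<n = trans (cong₂ (λ u v → suc u ⊓ suc v) (*-suc 2 e) (trans (cong (2 *_) (∸-suc e<n)) (*-suc 2 (n ∸ suc e))))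
    (+-comm 2 (μ' e))

2*minSum : ∀ n → 2 * minSum n ≡ n * n + bit (not (isEven n))
2*minSum zero          = refl
2*minSum (suc zero)    = refl
2*minSum (suc (suc n)) = begin
  2 * minSum (2 + n)                              ≡⟨ cong (2 *_) (minSum-step n) ⟩
  2 * (minSum n + (2 + 2 * n))                    ≡⟨ *-distribˡ-+ 2 (minSum n) _ ⟩
  2 * minSum n + 2 * (2 + 2 * n)                  ≡⟨ cong (_+ 2 * (2 + 2 * n)) (2*minSum n) ⟩
  n * n + bit (not (isEven n)) + 2 * (2 + 2 * n)  ≡⟨ shuffle n (bit (not (isEven n))) ⟩
  (2 + n) * (2 + n) + bit (not (isEven n))        ≡⟨ cong (λ b → (2 + n) * (2 + n) + bit (not b)) (sym (not-involutive (isEven n))) ⟩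
  (2 + n) * (2 + n) + bit (not (isEven (2 + n)))  ∎
  where
  open ≡-Reasoning
  shuffle : ∀ n b → n * n + b + 2 * (2 + 2 * n) ≡ (2 + n) * (2 + n) + b
  shuffle = solve-∀

-- The gap is one less than the distance, so this marks the pairs at odd distance, which are the
-- possible edges.
parityBit : ℕ → ℕ → ℕ
parityBit x y = bit (isEven (y ∸ suc x))

count-edges : ∀ n → pairSum (2 * n) (λ x y → parityBit x y * 1) ≡ n * n
count-edges n = trans (pairSum-difference (2 * n) (λ d → bit (isEven d) * 1) _ (λ _ → refl))
  (trans (sum-of-prefixes (λ _ → 1) n) (sum-odds n))

sum-distances : ∀ n → pairSum (2 * n) (λ x y → parityBit x y * distance (2 * n) x y) ≡ n * minSum n
sum-distances n = trans (pairSum-difference (2 * n) (λ d → bit (isEven d) * γ d) _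
    (λ {x} {y} x<y → cong (λ z → parityBit x y * (z ⊓ (2 * n ∸ z))) (∸-suc x<y)))
  (trans (sum-of-prefixes γ n) (trans (sumFrom-cong 0 n (λ {e} (_ , p) → cong (λ z → c (n ∸ suc e) * (c e ⊓ z)) (opposite e p))) symmetrise))
  where
  γ : ℕ → ℕ
  γ d = suc d ⊓ (2 * n ∸ suc d)
  c : ℕ → ℕ
  c e = suc (2 * e)
  μ : ℕ → ℕ
  μ e = c e ⊓ c (n ∸ suc e)
  total : ∀ e → e < n → c (n ∸ suc e) + c e ≡ 2 * n
  total e e<n = trans (expand (n ∸ suc e) e) (cong (2 *_) (m∸n+n≡m e<n))
    where
    expand : ∀ a e → suc (2 * a) + suc (2 * e) ≡ 2 * (a + suc e)
    expand = solve-∀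
  opposite : ∀ e → e < n → 2 * n ∸ c e ≡ c (n ∸ suc e)
  opposite e e<n = trans (cong (_∸ c e) (sym (total e e<n))) (m+n∸n≡m (c (n ∸ suc e)) (c e))
  back : ∀ e → e < n → n ∸ suc (n ∸ suc e) ≡ e
  back e e<n = trans (cong (n ∸_) (sym (∸-suc e<n))) (m∸[m∸n]≡n (<⇒≤ e<n))
  -- The indices e and n - 1 - e have the same distance, and their multiplicities add up to 2n.
  symmetrise : sumFrom 0 n (λ e → c (n ∸ suc e) * μ e) ≡ n * minSum n
  symmetrise = *-cancelˡ-≡ _ _ 2 (begin
    2 * X                                     ≡⟨ cong (X +_) (trans (+-identityʳ X) reversed) ⟩
    X + sumFrom 0 n (λ e → c e * μ e)         ≡⟨ sym (sumFrom-+ 0 n _ _) ⟩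
    sumFrom 0 n (λ e → c (n ∸ suc e) * μ e + c e * μ e)
      ≡⟨ sumFrom-cong 0 n (λ {e} (_ , p) → trans (sym (*-distribʳ-+ (μ e) (c (n ∸ suc e)) (c e))) (cong (_* μ e) (total e p))) ⟩
    sumFrom 0 n (λ e → 2 * n * μ e)           ≡⟨ sumFrom-* 0 n (2 * n) μ ⟩
    2 * n * minSum n                          ≡⟨ *-assoc 2 n (minSum n) ⟩
    2 * (n * minSum n)                        ∎)
    where
    open ≡-Reasoning
    X = sumFrom 0 n (λ e → c (n ∸ suc e) * μ e)
    reversed : X ≡ sumFrom 0 n (λ e → c e * μ e)
    reversed = trans (sumFrom-cong 0 n (λ {e} (_ , p) → cong (c (n ∸ suc e) *_)
        (trans (⊓-comm (c e) (c (n ∸ suc e))) (cong (λ z → c (n ∸ suc e) ⊓ c z) (sym (back e p))))))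
      (sumFrom-reverse n (λ e → c e * μ e))

-- Rainbow cycles

pairSum-cong : ∀ N {h h'} → (∀ {x y} → x < y → x < N → y < N → h x y ≡ h' x y) → pairSum N h ≡ pairSum N h'
pairSum-cong N {h} {h'} eq = sumFrom-cong 0 N λ {x} (_ , x<N) → sumFrom-cong 0 N λ {y} (_ , y<N) → entry x y x<N y<N
  where
  entry : ∀ x y → x < N → y < N → bit (x <ᵇ y) * h x y ≡ bit (x <ᵇ y) * h' x y
  entry x y x<N y<N with x <ᵇ y in e
  ... | true  = cong (1 *_) (eq (<ᵇ⇒< x y (subst T (sym e) _)) x<N y<N)
  ... | false = refl

pairSum-* : ∀ N c h → pairSum N (λ x y → c * h x y) ≡ c * pairSum N h
pairSum-* N c h = trans (sumFrom-cong 0 N λ {x} _ → trans (sumFrom-cong 0 N λ {y} _ → swap* (bit (x <ᵇ y)) c (h x y))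
    (sumFrom-* 0 N c _)) (sumFrom-* 0 N c _)
  where
  swap* : ∀ b c h → b * (c * h) ≡ c * (b * h)
  swap* = solve-∀

sumFrom-pairSum : ∀ k N (h : ℕ → ℕ → ℕ → ℕ) →
  sumFrom 0 k (λ i → pairSum N (h i)) ≡ pairSum N (λ x y → sumFrom 0 k (λ i → h i x y))
sumFrom-pairSum k N h = trans (sumFrom-swap 0 k 0 N _) (sumFrom-cong 0 N λ {x} _ →
  trans (sumFrom-swap 0 k 0 N _) (sumFrom-cong 0 N λ {y} _ → sumFrom-* 0 k (bit (x <ᵇ y)) (λ i → h i x y)))

module Cycle {n r : ℕ} (R : RainbowCycle n r) where
  open RainbowCycle R

  N : ℕ
  N = 2 * n

  F : ℕ → ℕ → ℕ
  F i = extend (W i)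

  added removed : ℕ → ℕ → ℕ
  added x y   = sumFrom 0 len (λ i → gain (F i x) (F (suc i) x) y)
  removed x y = sumFrom 0 len (λ i → gain (F (suc i) x) (F i x) y)

  -- Additions minus removals is the change in presence of the edge; once around the closed walk
  -- this change is zero.
  telescope : ∀ k x y → sumFrom 0 k (λ i → gain (F i x) (F (suc i) x) y) + δ (F 0 x) y
                      ≡ sumFrom 0 k (λ i → gain (F (suc i) x) (F i x) y) + δ (F k x) y
  telescope zero    x y = refl
  telescope (suc k) x y = begin
    sumFrom 0 (suc k) a + d 0        ≡⟨ cong (_+ d 0) (sumFrom-snoc k a) ⟩
    sumFrom 0 k a + a k + d 0        ≡⟨ shuffle (sumFrom 0 k a) (a k) (d 0) ⟩
    sumFrom 0 k a + d 0 + a k        ≡⟨ cong (_+ a k) (telescope k x y) ⟩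
    sumFrom 0 k b + d k + a k        ≡⟨ rotate (sumFrom 0 k b) (d k) (a k) ⟩
    sumFrom 0 k b + (a k + d k)      ≡⟨ cong (sumFrom 0 k b +_) (gain-balance (F k x) (F (suc k) x) y) ⟩
    sumFrom 0 k b + (b k + d (suc k)) ≡⟨ sym (+-assoc (sumFrom 0 k b) (b k) (d (suc k))) ⟩
    sumFrom 0 k b + b k + d (suc k)  ≡⟨ cong (_+ d (suc k)) (sym (sumFrom-snoc k b)) ⟩
    sumFrom 0 (suc k) b + d (suc k)  ∎
    where
    open ≡-Reasoning
    a = λ i → gain (F i x) (F (suc i) x) y
    b = λ i → gain (F (suc i) x) (F i x) y
    d = λ i → δ (F i x) y
    shuffle : ∀ x y z → x + y + z ≡ x + z + y
    shuffle = solve-∀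
    rotate : ∀ x y z → x + y + z ≡ x + (z + y)
    rotate = solve-∀

  added≡removed : ∀ {x} y → x < N → added x y ≡ removed x y
  added≡removed {x} y x<N = +-cancelʳ-≡ (δ (F 0 x) y) _ _ (trans (telescope len x y)
    (cong (λ z → removed x y + δ z y) (trans (extend-point (W len) x<N)
      (trans (cong toℕ (closed (fromℕ< x<N))) (sym (extend-point (W 0) x<N))))))

  isEven-gap : ∀ {x y} → x < y → isEven y ≡ (if isEven (y ∸ suc x) then not (isEven x) else isEven x)
  isEven-gap {x} {y} x<y = trans (cong isEven (sym (m+[n∸m]≡n x<y))) (trans (isEven-+ (suc x) (y ∸ suc x)) (simplify _))
    where
    simplify : ∀ b → (if b then not (isEven x) else not (not (isEven x))) ≡ (if b then not (isEven x) else isEven x)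
    simplify true  = refl
    simplify false = not-involutive (isEven x)

  -- At odd distance the pair is a possible edge and the rainbow condition applies; at even distance
  -- no matching contains it, by parity.
  added-count : ∀ {x y} → x < y → x < N → y < N → added x y ≡ r * parityBit x y
  added-count {x} {y} x<y x<N y<N with isEven (y ∸ suc x) | isEven-gap x<y
  ... | true  | par = trans (sym (trans (length-filter-upTo _ len) (sumFrom-cong 0 len λ {i} _ →
          trans (gain-added (W i) (W (suc i)) x' y') (cong₂ (λ u v → gain (F i u) (F (suc i) u) v) (toℕ-fromℕ< x<N) (toℕ-fromℕ< y<N)))))
        (trans (rainbow x' y' x'<y' (odd⇒possible x' y' x'<y'
          (trans (cong isEven (toℕ-fromℕ< y<N)) (trans par (cong (λ z → not (isEven z)) (sym (toℕ-fromℕ< x<N)))))))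
          (sym (*-identityʳ r)))
    where
    x' = fromℕ< x<N
    y' = fromℕ< y<N
    x'<y' : toℕ x' < toℕ y'
    x'<y' = subst₂ _<_ (sym (toℕ-fromℕ< x<N)) (sym (toℕ-fromℕ< y<N)) x<y
  ... | false | par = trans (sumFrom-zero 0 len λ {i} _ → cong (_* (1 ∸ δ (F i x) y)) (δ-≢ {F (suc i) x} {y} (λ e →
          isEven-≢ {x} {x} (trans (sym par) (trans (cong isEven (sym e)) (extend-parity (W (suc i)) x<N))) refl)))
        (sym (*-zeroʳ r))

  toggles : ℕ → (ℕ → ℕ → ℕ) → ℕ
  toggles i g = pairSum N (λ x y → toggle (F i x) (F (suc i) x) y * g x y)

  -- Double counting by flips and by pairs. The constant weight 1 yields the length of the cycle,
  -- since each flip toggles four edges; the weight `distance` yields the comparison with 2n per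
  -- flip.
  total-toggles : ∀ g → sumFrom 0 len (λ i → toggles i g) ≡ 2 * r * pairSum N (λ x y → parityBit x y * g x y)
  total-toggles g = begin
    sumFrom 0 len (λ i → toggles i g)
      ≡⟨ sumFrom-pairSum len N (λ i x y → toggle (F i x) (F (suc i) x) y * g x y) ⟩
    pairSum N (λ x y → sumFrom 0 len (λ i → toggle (F i x) (F (suc i) x) y * g x y))
      ≡⟨ pairSum-cong N (λ {x} {y} x<y x<N y<N → entry x<y x<N y<N) ⟩
    pairSum N (λ x y → 2 * r * (parityBit x y * g x y))
      ≡⟨ pairSum-* N (2 * r) _ ⟩
    2 * r * pairSum N (λ x y → parityBit x y * g x y) ∎
    where
    open ≡-Reasoning
    entry : ∀ {x y} → x < y → x < N → y < N →
      sumFrom 0 len (λ i → toggle (F i x) (F (suc i) x) y * g x y) ≡ 2 * r * (parityBit x y * g x y)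
    entry {x} {y} x<y x<N y<N = begin
      sumFrom 0 len (λ i → toggle (F i x) (F (suc i) x) y * g x y)
        ≡⟨ sumFrom-cong 0 len (λ {i} _ → *-comm (toggle (F i x) (F (suc i) x) y) (g x y)) ⟩
      sumFrom 0 len (λ i → g x y * toggle (F i x) (F (suc i) x) y)
        ≡⟨ sumFrom-* 0 len (g x y) _ ⟩
      g x y * sumFrom 0 len (λ i → toggle (F i x) (F (suc i) x) y)
        ≡⟨ cong (g x y *_) (sumFrom-+ 0 len _ _) ⟩
      g x y * (added x y + removed x y)
        ≡⟨ cong (λ z → g x y * (added x y + z)) (sym (added≡removed y x<N)) ⟩
      g x y * (added x y + added x y)
        ≡⟨ cong (λ z → g x y * (z + z)) (added-count x<y x<N y<N) ⟩
      g x y * (r * parityBit x y + r * parityBit x y)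
        ≡⟨ shuffle (g x y) r (parityBit x y) ⟩
      2 * r * (parityBit x y * g x y) ∎
      where
      shuffle : ∀ g r b → g * (r * b + r * b) ≡ 2 * r * (b * g)
      shuffle = solve-∀

  toggle-comm : ∀ u u' y → toggle u u' y ≡ toggle u' u y
  toggle-comm u u' y = +-comm (gain u u' y) (gain u' u y)

  QuadStep : ℕ → ℕ → ℕ → ℕ → ℕ → Set
  QuadStep i p₁ p₂ p₃ p₄ = Quad N (F i) (F (suc i)) p₁ p₂ p₃ p₄ ⊎ Quad N (F (suc i)) (F i) p₁ p₂ p₃ p₄

  toggles-quad : ∀ {i p₁ p₂ p₃ p₄} → QuadStep i p₁ p₂ p₃ p₄ → ∀ g →
    toggles i g ≡ g p₁ p₂ + g p₁ p₄ + g p₂ p₃ + g p₃ p₄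
  toggles-quad (inj₁ q) g = Quad.toggle-sides q g
  toggles-quad {i} (inj₂ q) g = trans (pairSum-cong N λ {x} {y} _ _ _ →
    cong (_* g x y) (toggle-comm (F i x) (F (suc i) x) y)) (Quad.toggle-sides q g)

  quad : ∀ i → i < len → ∃ λ p₁ → ∃ λ p₂ → ∃ λ p₃ → ∃ λ p₄ → QuadStep i p₁ p₂ p₃ p₄
  quad i i<len = flip⇒quad (W i) (W (suc i)) (steps i i<len)

  length-formula : 2 * len ≡ r * (n * n)
  length-formula = *-cancelˡ-≡ _ _ 2 (begin
    2 * (2 * len)       ≡⟨ four len ⟩
    len * 4             ≡⟨ sym (sumFrom-const 0 len 4) ⟩
    sumFrom 0 len (λ _ → 4) ≡⟨ sumFrom-cong 0 len (λ {i} (_ , i<len) → sym (count i i<len)) ⟩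
    sumFrom 0 len (λ i → toggles i (λ _ _ → 1)) ≡⟨ total-toggles (λ _ _ → 1) ⟩
    2 * r * pairSum N (λ x y → parityBit x y * 1) ≡⟨ cong (2 * r *_) (count-edges n) ⟩
    2 * r * (n * n)     ≡⟨ *-assoc 2 r (n * n) ⟩
    2 * (r * (n * n))   ∎)
    where
    open ≡-Reasoning
    four : ∀ l → 2 * (2 * l) ≡ l * 4
    four = solve-∀
    count : ∀ i → i < len → toggles i (λ _ _ → 1) ≡ 4
    count i i<len with quad i i<len
    ... | _ , _ , _ , _ , q = toggles-quad q (λ _ _ → 1)

  toggles-distance≤ : ∀ i → i < len → toggles i (distance N) ≤ N
  toggles-distance≤ i i<len with quad i i<len
  ... | _ , _ , _ , _ , inj₁ q = ≤-trans (≤-reflexive (toggles-quad {i} (inj₁ q) (distance N))) (sides-distance≤ q)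
  ... | _ , _ , _ , _ , inj₂ q = ≤-trans (≤-reflexive (toggles-quad {i} (inj₂ q) (distance N))) (sides-distance≤ q)

  total-distance : sumFrom 0 len (λ i → toggles i (distance N)) ≡ r * n * (n * n + bit (not (isEven n)))
  total-distance = begin
    sumFrom 0 len (λ i → toggles i (distance N)) ≡⟨ total-toggles (distance N) ⟩
    2 * r * pairSum N (λ x y → parityBit x y * distance N x y) ≡⟨ cong (2 * r *_) (sum-distances n) ⟩
    2 * r * (n * minSum n)     ≡⟨ shuffle r n (minSum n) ⟩
    r * n * (2 * minSum n)     ≡⟨ cong (r * n *_) (2*minSum n) ⟩
    r * n * (n * n + bit (not (isEven n))) ∎
    where
    open ≡-Reasoning
    shuffle : ∀ r n s → 2 * r * (n * s) ≡ r * n * (2 * s)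
    shuffle = solve-∀

  len*N : len * N ≡ r * n * (n * n)
  len*N = trans (shuffle len n) (trans (cong (_* n) length-formula) (shuffle₂ r n))
    where
    shuffle : ∀ l n → l * (2 * n) ≡ 2 * l * n
    shuffle = solve-∀
    shuffle₂ : ∀ r n → r * (n * n) * n ≡ r * n * (n * n)
    shuffle₂ = solve-∀

  no-odd : isEven n ≡ false → 1 ≤ n → 1 ≤ r → ⊥
  no-odd odd 1≤n 1≤r = <-irrefl refl (begin-strict
    r * n * (n * n)          <⟨ *-monoʳ-< (r * n) {{>-nonZero (*-mono-≤ 1≤r 1≤n)}} (≤-reflexive (+-comm 1 (n * n))) ⟩
    r * n * (n * n + 1)      ≡⟨ cong (λ b → r * n * (n * n + bit (not b))) (sym odd) ⟩
    r * n * (n * n + bit (not (isEven n))) ≡⟨ sym total-distance ⟩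
    sumFrom 0 len (λ i → toggles i (distance N)) ≤⟨ sumFrom-mono 0 len (λ {i} (_ , p) → toggles-distance≤ i p) ⟩
    sumFrom 0 len (λ _ → N)  ≡⟨ sumFrom-const 0 len N ⟩
    len * N                  ≡⟨ len*N ⟩
    r * n * (n * n)          ∎)
    where open ≤-Reasoning

  toggles-distance≡ : isEven n ≡ true → ∀ i → i < len → toggles i (distance N) ≡ N
  toggles-distance≡ even i i<len = sumFrom-tight 0 len N (λ {i} (_ , p) → toggles-distance≤ i p)
    (≤-reflexive (trans len*N (sym (trans total-distance (trans (cong (λ b → r * n * (n * n + bit (not b))) even)
      (cong (r * n *_) (+-identityʳ (n * n)))))))) (z≤n , i<len)

module EvenCycle {m r : ℕ} (0<m : 0 < m) (R : RainbowCycle (2 * m) r) where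
  open RainbowCycle R
  open Cycle R
  open Centre m 0<m using (centreOdd)
  open Weight m 0<m
  open Invariance m 0<m using (weight-invariant)
  open ClassBound m 0<m

  step-weight : ∀ i → i < len → matchingWeight (W i) ≡ matchingWeight (W (suc i))
  step-weight i i<len with quad i i<len | toggles-distance≡ (isEven-2* m) i i<len
  ... | p₁ , p₂ , p₃ , p₄ , inj₁ q | e = weight-invariant (W i) (W (suc i)) q
        (sides-tight q (2 * m) refl (≤-reflexive (trans (sym e) (toggles-quad {i} (inj₁ q) (distance N)))))
  ... | p₁ , p₂ , p₃ , p₄ , inj₂ q | e = sym (weight-invariant (W (suc i)) (W i) q
        (sides-tight q (2 * m) refl (≤-reflexive (trans (sym e) (toggles-quad {i} (inj₂ q) (distance N))))))

  weight-constant : ∀ i → i < len → matchingWeight (W i) ≡ matchingWeight (W 0)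
  weight-constant zero    _     = refl
  weight-constant (suc i) i<len = trans (sym (step-weight i (<⇒≤ i<len))) (weight-constant i (<⇒≤ i<len))

  length-bound : len * suc (2 * m) ≤ narayanaNum 1 (2 * m) m
  length-bound = family≤narayana len (λ i → code (W (toℕ i))) injective (λ i → size-code (W (toℕ i)))
    λ i j → +-cancelˡ-≡ (2 * m) _ _ (trans (sym (matchingWeight-code (W (toℕ i)))) (trans (weight-constant (toℕ i) (toℕ<n i))
      (trans (sym (weight-constant (toℕ j) (toℕ<n j))) (matchingWeight-code (W (toℕ j))))))
    where
    injective : ∀ {i j : Fin len} → code (W (toℕ i)) ≡ code (W (toℕ j)) → i ≡ j
    injective {i} {j} e with <-cmp (toℕ i) (toℕ j)
    ... | tri< p _ _ = contradiction (code-injective (W (toℕ i)) (W (toℕ j)) e) (distinct (toℕ i) (toℕ j) p (toℕ<n j))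
    ... | tri≈ _ p _ = toℕ-injective p
    ... | tri> _ _ p = contradiction (code-injective (W (toℕ j)) (W (toℕ i)) (sym e)) (distinct (toℕ j) (toℕ i) p (toℕ<n i))

  not-above : ¬ AboveBound r (2 * m) m
  not-above above = <-irrefl refl (begin-strict
    2 * narayanaNum 1 (2 * m) m      <⟨ above ⟩
    r * ((2 * m) ^ 2) * suc (2 * m)  ≡⟨ cong (λ z → r * (2 * m * z) * suc (2 * m)) (*-identityʳ (2 * m)) ⟩
    r * (2 * m * (2 * m)) * suc (2 * m) ≡⟨ cong (_* suc (2 * m)) (sym length-formula) ⟩
    2 * len * suc (2 * m)            ≡⟨ *-assoc 2 len (suc (2 * m)) ⟩
    2 * (len * suc (2 * m))          ≤⟨ *-monoʳ-≤ 2 length-bound ⟩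
    2 * narayanaNum 1 (2 * m) m      ∎)
    where open ≤-Reasoning

theorem22 : (∀ n r → n % 2 ≡ 1 → 3 ≤ n → 1 ≤ r → ¬ RainbowCycle n r)
    × (∀ n r → n % 2 ≡ 0 → 2 ≤ n → 1 ≤ r → AboveBound r n (n / 2) → ¬ RainbowCycle n r)
theorem22 = odd-case , even-case
  where
  odd-case : ∀ n r → n % 2 ≡ 1 → 3 ≤ n → 1 ≤ r → ¬ RainbowCycle n r
  odd-case n r n%2 3≤n 1≤r R = Cycle.no-odd R isOdd (≤-trans (s≤s z≤n) 3≤n) 1≤r
    where
    isOdd : isEven n ≡ false
    isOdd = trans (cong isEven (trans (m≡m%n+[m/n]*n n 2) (cong₂ _+_ n%2 (*-comm (n / 2) 2))))
      (cong not (isEven-2* (n / 2)))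
  even-case : ∀ n r → n % 2 ≡ 0 → 2 ≤ n → 1 ≤ r → AboveBound r n (n / 2) → ¬ RainbowCycle n r
  even-case n r n%2 2≤n 1≤r above R = EvenCycle.not-above 0<m (subst (λ k → RainbowCycle k r) n≡ R)
      (subst (λ k → AboveBound r k (n / 2)) n≡ above)
    where
    n≡ : n ≡ 2 * (n / 2)
    n≡ = trans (m≡m%n+[m/n]*n n 2) (trans (cong (_+ n / 2 * 2) n%2) (*-comm (n / 2) 2))
    0<m : 0 < n / 2
    0<m = *-cancelˡ-< 2 0 (n / 2) (≤-trans (s≤s z≤n) (≤-trans 2≤n (≤-reflexive n≡)))
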